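{- Let $f(t),g(t)\in\mathbb{C}[[t]]$ be a delta series and an invertible series respectively with $g(0)=1$, let $r\ge 1$ be an integer, and put $A(t)=1/g(f^{ -1}(t))$, $H(t)=f^{ -1}(t)$, $\partial_y=\frac{\partial}{\partial y}$. For every $n\ge 0$ the Legendre-Gould Hopper based Sheffer polynomials have the explicit representations $${}_{{}_{s}LeG^{(r)}}s_{n}(x,y,z)=\left(\left(y+2D_x^{ -1}\frac{\partial}{\partial y}+rz\frac{\partial^{r-1}}{\partial y^{r-1}}-\frac{g'(\partial_y)}{g(\partial_y)}\right)\frac{1}{f'(\partial_y)}\right)^{n}\{1\}$$ and $${}_{{}_{s}LeG^{(r)}}s_{n}(x,y,z)=\left(\left(y+2D_x^{ -1}\frac{\partial}{\partial y}+rz\frac{\partial^{r-1}}{\partial y^{r-1}}\right)H'\!\left(H^{ -1}(\partial_y)\right)+\frac{A'\!\left(H^{ -1}(\partial_y)\right)}{A\!\left(H^{ -1}(\partial_y)\right)}\right)^{n}\{1\}.$$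
   Context: A delta series is $f\in\mathbb{C}[[t]]$ with $f(0)=0$, $f'(0)\neq 0$; $f^{ -1}$ and $H^{ -1}$ denote compositional inverses. An invertible series is $g\in\mathbb{C}[[t]]$ with $g(0)\ne 0$. $C_0(x)=\sum_{k\ge 0}\frac{(-1)^k x^k}{(k!)^2}$. $D_x^{ -1}h=\int_0^x h\,d\xi$ (integration in the variable $x$). All operators act on $\mathbb{C}[x,y,z]$; a formal power series in $\partial_y$ acts termwise (locally finite sum); $\{1\}$ denotes application to the constant polynomial $1$. The polynomials are determined by the generating function $$\frac{1}{g(f^{ -1}(t))}\,C_0\!\left(-x\,(f^{ -1}(t))^2\right)\exp\!\left(y f^{ -1}(t)+z\,(f^{ -1}(t))^r\right)=\sum_{n=0}^{\infty}{}_{{}_{s}LeG^{(r)}}s_{n}(x,y,z)\frac{t^n}{n!}.$$ -}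

module Defs where

open import Algebra.Apartness.Bundles using (HeytingField; HeytingCommutativeRing)
open import Algebra.Bundles using (CommutativeRing; RawRing)
import Algebra.Apartness.Properties.HeytingCommutativeRing as HeytingProperties
import Algebra.Definitions.RawSemiring as RawSemiringDefs
import Algebra.Properties.Semiring.Sum as SemiringSum
open import Data.Bool.Base using (if_then_else_; _∧_)
open import Data.Fin.Base using (Fin; toℕ)
open import Data.Fin.Properties using (toℕ<n)
open import Data.List.Base using (List; []; _∷_; [_]; _++_; map; concatMap; cartesianProductWith)
open import Data.Nat.Base as ℕ using (ℕ; zero; suc; _∸_; _≤_; _<_; z≤n; s≤s; s≤s⁻¹; _≡ᵇ_; _!; NonZero)
open import Data.Nat.GeneralisedArithmetic using (fold)
open import Data.Nat.Properties as ℕₚ using (_!≢0)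
open import Data.Product.Base using (_,_; proj₁; proj₂)
open import Data.Sum.Base using (inj₁; inj₂)
open import Function.Base using (_∘_)
open import Level using (Level; _⊔_)
open import Relation.Binary.PropositionalEquality.Core as ≡ using (_≡_)
import Relation.Binary.Reasoning.Setoid as SetoidReasoning

-- Formal power series a(t) = Σ a n tⁿ over a ring.

module Series {c ℓ : Level} (R : RawRing c ℓ) where

  private
    module R = RawRing R
    open RawSemiringDefs R.rawSemiring using (sum; _×_)

  rawRing : RawRing c ℓ
  rawRing = record
    { Carrier = ℕ → R.Carrier
    ; _≈_     = λ a b → ∀ n → a n R.≈ b n
    ; _+_     = λ a b n → a n R.+ b n
    ; _*_     = λ a b n → sum {suc n} (λ i → a (toℕ i) R.* b (n ∸ toℕ i))
    ; -_      = λ a n → R.- a n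
    ; 0#      = λ _ → R.0#
    ; 1#      = λ { zero → R.1# ; (suc _) → R.0# }
    }

  open RawRing rawRing public
  open RawSemiringDefs rawSemiring public using (_^_)

  constant : R.Carrier → Carrier
  constant x zero    = x
  constant x (suc _) = R.0#

  t : Carrier
  t 1 = R.1#
  t _ = R.0#

  infix 11 _′
  _′ : Carrier → Carrier
  (a ′) n = suc n × a (suc n)

  -- a(u(t)), for u with zero constant term: then u ^ k has no term in tⁿ
  -- when n < k, so the sum for the n-th coefficient may stop at k = n.
  infixr 9 _∘ₛ_
  _∘ₛ_ : Carrier → Carrier → Carrier
  (a ∘ₛ u) n = sum {suc n} (λ k → a (toℕ k) R.* (u ^ toℕ k) n)

CharacteristicZero : ∀ {c ℓ₁ ℓ₂} → HeytingField c ℓ₁ ℓ₂ → Set ℓ₂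
CharacteristicZero K = ∀ n → .{{NonZero n}} → (n × 1#) # 0#
  where
  open HeytingField K using (_#_; 0#; 1#; heytingCommutativeRing)
  open HeytingCommutativeRing heytingCommutativeRing using (commutativeRing)
  open RawSemiringDefs (RawRing.rawSemiring (CommutativeRing.rawRing commutativeRing)) using (_×_)

-- The library has no complex numbers; a field of characteristic zero with an
-- apartness # replaces ℂ, and "nonzero", wherever it is to yield an inverse,
-- means # 0#.
module OverField {c ℓ₁ ℓ₂ : Level} (K : HeytingField c ℓ₁ ℓ₂) (char0 : CharacteristicZero K) where

  open HeytingField K using (heytingCommutativeRing)
  open HeytingCommutativeRing heytingCommutativeRing public
    using (Carrier; _≈_; _#_; _+_; _*_; -_; 0#; 1#; #⇒invertible)
  open HeytingCommutativeRing heytingCommutativeRing using (commutativeRing)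
  open HeytingProperties heytingCommutativeRing using (x-0≈x; invertibleʳ⇒#; #-congʳ; 1#0)
  private
    module K = CommutativeRing commutativeRing

  open RawSemiringDefs (RawRing.rawSemiring K.rawRing) using (_×_; _^_; sum)

  inverse : ∀ x → x # 0# → Carrier
  inverse x x#0 = proj₁ (#⇒invertible x#0)

  1/_ : ∀ n → .{{NonZero n}} → Carrier
  1/ n = inverse (n × 1#) (char0 n)

  module K⟦t⟧ = Series K.rawRing
  open K⟦t⟧ public using (t; _′; _∘ₛ_)
    renaming (Carrier to K⟦t⟧; _*_ to _*ₛ_; _^_ to _^ₛ_; _≈_ to _≈ₛ_)

  record InvertibleSeries : Set (c ⊔ ℓ₂) where
    field
      series : K⟦t⟧
      unit   : series 0 # 0#

  record DeltaSeries : Set (c ⊔ ℓ₁ ⊔ ℓ₂) where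
    field
      series : K⟦t⟧
      root   : series 0 ≈ 0#
      slope  : (series ′) 0 # 0#

  -- Inverses of series.  Each is the solution b of an equation b = Φ b in
  -- which the n-th coefficient of Φ b depends only on b 0, …, b (n - 1).

  fix : (K⟦t⟧ → K⟦t⟧) → K⟦t⟧
  fix Φ n = fold K⟦t⟧.0# Φ (suc n) n

  -- A solution of a * b = 1: b = (1 - (a - a₀) * b) / a₀.
  reciprocalStep : (a : K⟦t⟧) → a 0 # 0# → K⟦t⟧ → K⟦t⟧
  reciprocalStep a a₀#0 b n = inverse (a 0) a₀#0 * (K⟦t⟧.1# n + - (a⁺ *ₛ b) n)
    where
    a⁺ : K⟦t⟧
    a⁺ zero    = 0#
    a⁺ (suc m) = a (suc m)

  reciprocalSeries : (a : K⟦t⟧) → a 0 # 0# → K⟦t⟧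
  reciprocalSeries a a₀#0 = fix (reciprocalStep a a₀#0)

  t·_ : K⟦t⟧ → K⟦t⟧
  (t· q) zero    = 0#
  (t· q) (suc n) = q n

  dropLinear : K⟦t⟧ → K⟦t⟧
  dropLinear a (suc (suc n)) = a (suc (suc n))
  dropLinear a _             = 0#

  -- A solution h = t q of f ∘ h = t, for f = f₁ t + f⁺ with f⁺ of order at
  -- least 2: q = (1 - (f⁺ ∘ t q) / t) / f₁.
  reversionStep : (f : K⟦t⟧) → (f ′) 0 # 0# → K⟦t⟧ → K⟦t⟧
  reversionStep f f₁#0 q n =
    inverse ((f ′) 0) f₁#0 * (K⟦t⟧.1# n + - (dropLinear f ∘ₛ t· q) (suc n))

  reversionSeries : (f : K⟦t⟧) → (f ′) 0 # 0# → K⟦t⟧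
  reversionSeries f f₁#0 = t· fix (reversionStep f f₁#0)

  private
    open SetoidReasoning K.setoid
    module Sum = SemiringSum K.semiring

    inverseʳ : ∀ x (x#0 : x # 0#) → x * inverse x x#0 ≈ 1#
    inverseʳ x x#0 = K.trans (K.*-congʳ (K.sym (x-0≈x x))) (proj₂ (proj₂ (#⇒invertible x#0)))

    #-from-inverse : ∀ {x y} → x * y ≈ 1# → y # 0#
    #-from-inverse {x} {y} xy≈1 =
      invertibleʳ⇒# (x , K.trans (K.*-congʳ (x-0≈x y)) (K.trans (K.*-comm y x) xy≈1))

    sum-zero : ∀ {n} {v : Fin n → Carrier} → (∀ i → v i ≈ 0#) → sum v ≈ 0#
    sum-zero {n} v≈0 = K.trans (Sum.sum-cong-≋ v≈0) (Sum.sum-replicate-zero n)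

    solve-linear : ∀ x (x#0 : x # 0#) e r → x * (inverse x x#0 * (e + - r)) + r ≈ e
    solve-linear x x#0 e r = begin
      x * (inverse x x#0 * (e + - r)) + r  ≈⟨ K.+-congʳ (K.*-assoc _ _ _) ⟨
      x * inverse x x#0 * (e + - r) + r    ≈⟨ K.+-congʳ (K.*-congʳ (inverseʳ x x#0)) ⟩
      1# * (e + - r) + r                   ≈⟨ K.+-congʳ (K.*-identityˡ _) ⟩
      e + - r + r                          ≈⟨ K.+-assoc _ _ _ ⟩
      e + (- r + r)                        ≈⟨ K.+-congˡ (K.-‿inverseˡ r) ⟩
      e + 0#                               ≈⟨ K.+-identityʳ e ⟩
      e                                    ∎

    Agree : ℕ → K⟦t⟧ → K⟦t⟧ → Set ℓ₁
    Agree n a b = ∀ i → i < n → a i ≈ b i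

    Contractive : (K⟦t⟧ → K⟦t⟧) → Set (c ⊔ ℓ₁)
    Contractive Φ = ∀ n {a b} → Agree n a b → Agree (suc n) (Φ a) (Φ b)

    fix-equation : ∀ {Φ} → Contractive Φ → fix Φ ≈ₛ Φ (fix Φ)
    fix-equation {Φ} contractive n =
      K.sym (contractive n (λ i i<n → stable (suc i) (ℕₚ.m∸n+n≡m i<n) i ℕₚ.≤-refl) n ℕₚ.≤-refl)
      where
      approx : ℕ → K⟦t⟧
      approx = fold K⟦t⟧.0# Φ

      agree : ∀ m k → Agree m (approx m) (approx (m ℕ.+ k))
      agree (suc m) k = contractive m (agree m k)

      stable : ∀ m {k} → k ℕ.+ m ≡ n → Agree m (approx m) (approx n)
      stable m {k} eq =
        ≡.subst (λ p → Agree m (approx m) (approx p)) (≡.trans (ℕₚ.+-comm m k) eq) (agree m k)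

    reciprocal-contractive : ∀ a a₀#0 → Contractive (reciprocalStep a a₀#0)
    reciprocal-contractive a a₀#0 n {b} {b′} b~b′ i i<1+n =
      K.*-congˡ (K.+-congˡ (K.-‿cong (K.+-cong
        (K.trans (K.zeroˡ _) (K.sym (K.zeroˡ _)))
        (Sum.sum-cong-≋ (λ j → K.*-congˡ (b~b′ _ (index i i<1+n j)))))))
      where
      index : ∀ i → i < suc n → (j : Fin i) → i ∸ suc (toℕ j) < n
      index (suc i) i<1+n j = ℕₚ.≤-<-trans (ℕₚ.m∸n≤m i (toℕ j)) (s≤s⁻¹ i<1+n)

    Agree-* : ∀ n {a a′ b b′} → a 0 ≈ 0# → a′ 0 ≈ 0# → b 0 ≈ 0# → b′ 0 ≈ 0# →
              Agree n a a′ → Agree n b b′ → Agree (suc n) (a *ₛ b) (a′ *ₛ b′)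
    Agree-* n {a} {a′} {b} {b′} a₀ a′₀ b₀ b′₀ a~ b~ i i<1+n = K.+-cong
      (K.trans (K.trans (K.*-congʳ a₀) (K.zeroˡ _))
        (K.sym (K.trans (K.*-congʳ a′₀) (K.zeroˡ _))))
      (Sum.sum-cong-≋ (term i i<1+n))
      where
      term : ∀ i → i < suc n → (j : Fin i) →
             a (suc (toℕ j)) * b (i ∸ suc (toℕ j)) ≈ a′ (suc (toℕ j)) * b′ (i ∸ suc (toℕ j))
      term (suc i) i<1+n j with ℕₚ.m≤n⇒m<n∨m≡n (s≤s⁻¹ (toℕ<n j))
      ... | inj₁ j<i = K.*-cong (a~ _ (ℕₚ.≤-trans (s≤s j<i) (s≤s⁻¹ i<1+n)))
                                (b~ _ (ℕₚ.≤-<-trans (ℕₚ.m∸n≤m i (toℕ j)) (s≤s⁻¹ i<1+n)))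
      ... | inj₂ j≡i rewrite j≡i | ℕₚ.n∸n≡0 i =
        K.trans (K.trans (K.*-congˡ b₀) (K.zeroʳ _))
          (K.sym (K.trans (K.*-congˡ b′₀) (K.zeroʳ _)))

    *-zero₀ : ∀ a b → a 0 ≈ 0# → (a *ₛ b) 0 ≈ 0#
    *-zero₀ a b a₀ = K.trans (K.+-identityʳ _) (K.trans (K.*-congʳ a₀) (K.zeroˡ _))

    *-identityʳ : ∀ a → (a *ₛ K⟦t⟧.1#) ≈ₛ a
    *-identityʳ a zero    = K.trans (K.+-identityʳ _) (K.*-identityʳ _)
    *-identityʳ a (suc n) = begin
      a 0 * 0# + ((a ∘ suc) *ₛ K⟦t⟧.1#) n  ≈⟨ K.+-cong (K.zeroʳ _) (*-identityʳ (a ∘ suc) n) ⟩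
      0# + a (suc n)                       ≈⟨ K.+-identityˡ _ ⟩
      a (suc n)                            ∎

    module _ n {q q′ : K⟦t⟧} (q~q′ : Agree n q q′) where
      Agree-t· : Agree (suc n) (t· q) (t· q′)
      Agree-t· zero    _   = K.refl
      Agree-t· (suc i) i<n = q~q′ i (s≤s⁻¹ i<n)

      Agree-power : ∀ k → Agree (suc n) ((t· q) ^ₛ suc k) ((t· q′) ^ₛ suc k)
      Agree-power²⁺ : ∀ k → Agree (suc (suc n)) ((t· q) ^ₛ suc (suc k)) ((t· q′) ^ₛ suc (suc k))
      Agree-power zero i i<1+n =
        K.trans (*-identityʳ (t· q) i) (K.trans (Agree-t· i i<1+n) (K.sym (*-identityʳ (t· q′) i)))
      Agree-power (suc k) i i<1+n = Agree-power²⁺ k i (ℕₚ.m<n⇒m<1+n i<1+n)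
      Agree-power²⁺ k = Agree-* (suc n) K.refl K.refl
        (*-zero₀ (t· q) ((t· q) ^ₛ k) K.refl) (*-zero₀ (t· q′) ((t· q′) ^ₛ k) K.refl) Agree-t· (Agree-power k)

    reversion-contractive : ∀ f f₁#0 → Contractive (reversionStep f f₁#0)
    reversion-contractive f f₁#0 n {q} {q′} q~q′ i i<1+n =
      K.*-congˡ (K.+-congˡ (K.-‿cong (K.+-cong 0*-cong (K.+-cong 0*-cong
        (Sum.sum-cong-≋ {i} (λ j → K.*-congˡ {f (suc (suc (toℕ j)))} (Agree-power²⁺ n q~q′ (toℕ j) (suc i) (s≤s i<1+n))))))))
      where
      0*-cong : ∀ {x y} → 0# * x ≈ 0# * y
      0*-cong = K.trans (K.zeroˡ _) (K.sym (K.zeroˡ _))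

  reciprocal-correct : ∀ a a₀#0 → (a *ₛ reciprocalSeries a a₀#0) ≈ₛ K⟦t⟧.1#
  reciprocal-correct a a₀#0 n = begin
    a 0 * b n + rest                                    ≈⟨ K.+-congʳ (K.*-congˡ (fix-equation (reciprocal-contractive a a₀#0) n)) ⟩
    a 0 * (inverse (a 0) a₀#0 * (K⟦t⟧.1# n + - (0# * b n + rest))) + rest
                                                        ≈⟨ K.+-congʳ (K.*-congˡ (K.*-congˡ (K.+-congˡ (K.-‿cong 0*x+rest)))) ⟩
    a 0 * (inverse (a 0) a₀#0 * (K⟦t⟧.1# n + - rest)) + rest
                                                        ≈⟨ solve-linear (a 0) a₀#0 _ rest ⟩
    K⟦t⟧.1# n                                           ∎
    where
    b : K⟦t⟧
    b = reciprocalSeries a a₀#0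
    rest : Carrier
    rest = sum {n} (λ i → a (suc (toℕ i)) * b (n ∸ suc (toℕ i)))
    0*x+rest : 0# * b n + rest ≈ rest
    0*x+rest = K.trans (K.+-congʳ (K.zeroˡ _)) (K.+-identityˡ rest)

  reversion-correct : ∀ f → f 0 ≈ 0# → ∀ f₁#0 → (f ∘ₛ reversionSeries f f₁#0) ≈ₛ t
  reversion-correct f f₀≈0 f₁#0 zero    =
    K.trans (K.+-identityʳ _) (K.trans (K.*-congʳ f₀≈0) (K.zeroˡ _))
  reversion-correct f f₀≈0 f₁#0 (suc n) = begin
    f 0 * 0# + (f 1 * (h *ₛ K⟦t⟧.1#) (suc n) + rest)  ≈⟨ K.trans (K.+-congʳ (K.zeroʳ _)) (K.+-identityˡ _) ⟩
    f 1 * (h *ₛ K⟦t⟧.1#) (suc n) + rest               ≈⟨ K.+-congʳ (K.*-cong (K.sym (K.+-identityʳ _)) (*-identityʳ h (suc n))) ⟩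
    (f ′) 0 * q n + rest                              ≈⟨ K.+-congʳ (K.*-congˡ (fix-equation (reversion-contractive f f₁#0) n)) ⟩
    (f ′) 0 * (inverse ((f ′) 0) f₁#0 * (K⟦t⟧.1# n + - (0# * 0# + (0# * (h *ₛ K⟦t⟧.1#) (suc n) + rest)))) + rest
                                                      ≈⟨ K.+-congʳ (K.*-congˡ (K.*-congˡ (K.+-congˡ (K.-‿cong drop)))) ⟩
    (f ′) 0 * (inverse ((f ′) 0) f₁#0 * (K⟦t⟧.1# n + - rest)) + rest
                                                      ≈⟨ solve-linear ((f ′) 0) f₁#0 _ rest ⟩
    K⟦t⟧.1# n                                         ≡⟨ 1≡t n ⟩
    t (suc n)                                         ∎
    where
    q h : K⟦t⟧
    q = fix (reversionStep f f₁#0)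
    h = t· q
    rest : Carrier
    rest = sum {n} (λ k → f (suc (suc (toℕ k))) * (h ^ₛ suc (suc (toℕ k))) (suc n))
    drop : 0# * 0# + (0# * (h *ₛ K⟦t⟧.1#) (suc n) + rest) ≈ rest
    drop = K.trans (K.+-cong (K.zeroˡ _) (K.trans (K.+-congʳ (K.zeroˡ _)) (K.+-identityˡ rest))) (K.+-identityˡ rest)
    1≡t : ∀ n → K⟦t⟧.1# n ≡ t (suc n)
    1≡t zero    = ≡.refl
    1≡t (suc n) = ≡.refl

  infix 11 _⁻¹
  _⁻¹ : InvertibleSeries → InvertibleSeries
  g ⁻¹ = record
    { series = reciprocalSeries g.series g.unit
    ; unit   = #-from-inverse (K.trans (K.sym (K.+-identityʳ _)) (reciprocal-correct g.series g.unit 0))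
    }
    where module g = InvertibleSeries g

  infix 11 _⟨-1⟩
  _⟨-1⟩ : DeltaSeries → DeltaSeries
  f ⟨-1⟩ = record
    { series = h
    ; root   = K.refl
    ; slope  = #-congʳ (K.sym (K.+-identityʳ _)) (#-from-inverse (begin
        f.series 1 * h 1                                           ≈⟨ K.*-congˡ (*-identityʳ h 1) ⟨
        f.series 1 * (h *ₛ K⟦t⟧.1#) 1                              ≈⟨ K.trans (K.+-congʳ (K.zeroʳ _)) (K.trans (K.+-identityˡ _) (K.+-identityʳ _)) ⟨
        f.series 0 * 0# + (f.series 1 * (h *ₛ K⟦t⟧.1#) 1 + 0#)     ≈⟨ reversion-correct f.series f.root f.slope 1 ⟩
        1#                                                         ∎))
    }
    where
    module f = DeltaSeries f
    h : K⟦t⟧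
    h = reversionSeries f.series f.slope

  infixr 9 _∘ᵢ_
  _∘ᵢ_ : InvertibleSeries → DeltaSeries → InvertibleSeries
  g ∘ᵢ h = record
    { series = g.series ∘ₛ DeltaSeries.series h
    ; unit   = #-congʳ (K.sym (K.trans (K.+-identityʳ _) (K.*-identityʳ _))) g.unit
    }
    where module g = InvertibleSeries g

  derivative : DeltaSeries → InvertibleSeries
  derivative f = record { series = DeltaSeries.series f ′ ; unit = DeltaSeries.slope f }

  -- K[x,y,z]: finite formal sums of monomials, identified when all their
  -- coefficients agree.

  record Monomial : Set c where
    constructor _x^_y^_z^_
    field
      coefficient          : Carrier
      xDegree yDegree zDegree : ℕ

  coeff : List Monomial → ℕ → ℕ → ℕ → Carrier
  coeff []                       i j k = 0#
  coeff ((a x^ i′ y^ j′ z^ k′) ∷ p) i j k =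
    (if (i′ ≡ᵇ i) ∧ (j′ ≡ᵇ j) ∧ (k′ ≡ᵇ k) then a else 0#) + coeff p i j k

  polynomialRing : RawRing c ℓ₁
  polynomialRing = record
    { Carrier = List Monomial
    ; _≈_     = λ p q → ∀ i j k → coeff p i j k ≈ coeff q i j k
    ; _+_     = _++_
    ; _*_     = cartesianProductWith λ { (a x^ i y^ j z^ k) (a′ x^ i′ y^ j′ z^ k′) →
                  (a * a′) x^ (i ℕ.+ i′) y^ (j ℕ.+ j′) z^ (k ℕ.+ k′) }
    ; -_      = map λ { (a x^ i y^ j z^ k) → (- a) x^ i y^ j z^ k }
    ; 0#      = []
    ; 1#      = [ 1# x^ 0 y^ 0 z^ 0 ]
    }

  module Pol = RawRing polynomialRing
  open Pol public using () renaming (Carrier to K[x,y,z]; _≈_ to _≈ₚ_; 1# to 1ₚ)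
  open RawSemiringDefs Pol.rawSemiring using () renaming (_×_ to _×ₚ_; sum to sumₚ)

  scalar : Carrier → K[x,y,z]
  scalar a = [ a x^ 0 y^ 0 z^ 0 ]

  x y z : K[x,y,z]
  x = [ 1# x^ 1 y^ 0 z^ 0 ]
  y = [ 1# x^ 0 y^ 1 z^ 0 ]
  z = [ 1# x^ 0 y^ 0 z^ 1 ]

  Operator : Set c
  Operator = K[x,y,z] → K[x,y,z]

  infixl 6 _⊕_ _⊖_
  infixr 8 _⊗_
  _⊕_ _⊖_ : Operator → Operator → Operator
  (S ⊕ T) p = S p Pol.+ T p
  (S ⊖ T) p = S p Pol.+ (Pol.- T p)

  _⊗_ : ℕ → Operator → Operator
  (n ⊗ T) p = n ×ₚ T p

  infix 11 _·
  _· : K[x,y,z] → Operator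
  (p ·) q = p Pol.* q

  infixr 10 _^ₒ_
  _^ₒ_ : Operator → ℕ → Operator
  (T ^ₒ n) p = fold p T n

  -- On y⁰ the exponent j ∸ 1 is harmless, the coefficient being 0.
  ∂y : Operator
  ∂y = map λ { (a x^ i y^ j z^ k) → (j × a) x^ i y^ (j ∸ 1) z^ k }

  Dx⁻¹ : Operator
  Dx⁻¹ = map λ { (a x^ i y^ j z^ k) → (a * 1/ (suc i)) x^ suc i y^ j z^ k }

  -- φ(∂y) = Σ φ m ∂yᵐ; on a monomial of degree j in y the terms with m > j vanish.
  infix 11 _[∂y]
  _[∂y] : K⟦t⟧ → Operator
  φ [∂y] = concatMap λ w →
    sumₚ {suc (Monomial.yDegree w)} (λ m → scalar (φ (toℕ m)) Pol.* (∂y ^ₒ toℕ m) [ w ])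

  1/!_ : ℕ → Carrier
  1/! n = 1/_ (n !) {{n !≢0}}

  exponential : K⟦t⟧
  exponential k = 1/! k

  C₀ : K⟦t⟧
  C₀ k = (- 1#) ^ k * (1/! k) ^ 2

  private
    module Gen = Series polynomialRing

  lift : K⟦t⟧ → Gen.Carrier
  lift a n = scalar (a n)

  -- A(t) C₀(-x H(t)²) exp(y H(t) + z H(t)ʳ); both inner series have zero
  -- constant term when r ≥ 1.
  generatingFunction : (A : InvertibleSeries) (H : DeltaSeries) (r : ℕ) → Gen.Carrier
  generatingFunction A H r =
    lift A.series
      Gen.* (lift C₀ Gen.∘ₛ (Gen.- (Gen.constant x Gen.* h Gen.^ 2)))
      Gen.* (lift exponential Gen.∘ₛ (Gen.constant y Gen.* h Gen.+ Gen.constant z Gen.* h Gen.^ r))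
    where
    module A = InvertibleSeries A
    h : Gen.Carrier
    h = lift (DeltaSeries.series H)

  LeGSheffer : (f : DeltaSeries) (g : InvertibleSeries) (r n : ℕ) → K[x,y,z]
  LeGSheffer f g r n = (n !) ×ₚ generatingFunction ((g ∘ᵢ f ⟨-1⟩) ⁻¹) (f ⟨-1⟩) r n

{-# OPTIONS --safe #-}

module Submission where

-- With φ(u) = C₀(-x u²) exp(y u + z uʳ), the generating function is A φ(H).
-- Since ∂y φ = u φ, a series ψ(∂y) acts on φ(H) as multiplication by ψ(H), and
-- φ′ = M φ for M = y + 2 Dx⁻¹ ∂y + r z ∂yʳ⁻¹.  Hence
-- (A φ(H))′ = (M H′(H⁻¹(∂y)) + (A′/A)(H⁻¹(∂y))) A φ(H), and comparing
-- coefficients of tⁿ gives the second representation; the first follows from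
-- H′ = 1/f′(H) and A′/A = - g′(H) H′ / g(H).
--
-- On coefficients: xⁱ yʲ zᵏ occurs in A φ(H) with the series
-- A Hᵉ / (i!² j! k!), e = 2i + j + rk, on which both operators are computed.

open import Algebra.Apartness.Bundles using (HeytingCommutativeRing; HeytingField)
import Algebra.Apartness.Properties.HeytingCommutativeRing as HeytingProperties
open import Algebra.Bundles using (CommutativeRing; RawRing)
import Algebra.Construct.Pointwise as Pointwise
import Algebra.Definitions.RawSemiring as RawSemiringDefs
import Algebra.Properties.CommutativeMonoid.Mult as Multiples
import Algebra.Properties.CommutativeSemigroup as CommutativeSemigroupProperties
import Algebra.Properties.CommutativeSemiring.Exp as Exponentiation
import Algebra.Properties.Ring as RingProperties
import Algebra.Properties.Semiring.Mult as SemiringMultiples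
import Algebra.Properties.Semiring.Sum as Summation
open import Data.Bool.Base as Bool using (Bool; _∧_; false; if_then_else_; true)
open import Data.Fin.Base using (Fin; toℕ)
open import Data.List.Base using ([]; [_]; _++_; _∷_)
import Data.List.Properties as Listₚ
open import Data.Nat.Base as ℕ using (NonZero; _!; _<_; _∸_; _≡ᵇ_; _≤_; _⊔_; suc; s≤s; s≤s⁻¹; zero; z≤n; ℕ)
import Data.Nat.Properties as ℕₚ
open import Data.Nat.Tactic.RingSolver using (solve-∀)
open import Data.Product.Base using (_,_; proj₁; proj₂; ∃)
open import Defs
open import Function.Base using (_∘_)
open import Level using (Level)
import Relation.Binary.PropositionalEquality.Core as ≡
import Relation.Binary.Reasoning.Setoid as SetoidReasoning
open ≡ using (_≡_)

module RingLemmas {c ℓ} (R : CommutativeRing c ℓ) where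
  open CommutativeRing R
  open CommutativeSemigroupProperties *-commutativeSemigroup using (x∙yz≈y∙xz; interchange; xy∙z≈xz∙y)
  open RingProperties ring using (-‿distribˡ-*)
  open SetoidReasoning setoid

  inverse-unique : ∀ x {u v} → x * u ≈ 1# → x * v ≈ 1# → u ≈ v
  inverse-unique x {u} {v} xu≈1 xv≈1 = begin
    u            ≈⟨ *-identityʳ u ⟨
    u * 1#       ≈⟨ *-congˡ xv≈1 ⟨
    u * (x * v)  ≈⟨ x∙yz≈y∙xz u x v ⟩
    x * (u * v)  ≈⟨ *-assoc x u v ⟨
    x * u * v    ≈⟨ *-congʳ xu≈1 ⟩
    1# * v       ≈⟨ *-identityˡ v ⟩
    v            ∎

  -- With G a = 1 and G′ = γ η this is a′ = - γ η a².
  reciprocal-derivative : ∀ G a a′ γ η → G * a ≈ 1# → γ * η * a + G * a′ ≈ 0# → γ * a * (η * a) ≈ - a′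
  reciprocal-derivative G a a′ γ η Ga≈1 sum≈0 = begin
    γ * a * (η * a)        ≈⟨ interchange γ a η a ⟩
    γ * η * (a * a)        ≈⟨ *-assoc (γ * η) a a ⟨
    γ * η * a * a          ≈⟨ *-congʳ (AbelianGroup.inverseˡ-unique (γ * η * a) (G * a′) sum≈0) ⟩
    - (G * a′) * a         ≈⟨ -‿distribˡ-* (G * a′) a ⟨
    - (G * a′ * a)         ≈⟨ -‿cong (xy∙z≈xz∙y G a′ a) ⟩
    - (G * a * a′)         ≈⟨ -‿cong (*-congʳ Ga≈1) ⟩
    - (1# * a′)            ≈⟨ -‿cong (*-identityˡ a′) ⟩
    - a′                   ∎
    where import Algebra.Properties.AbelianGroup +-abelianGroup as AbelianGroup

module PowerSeries {c ℓ} (R : CommutativeRing c ℓ) where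
  open CommutativeRing R
  open Series rawRing public using (_′; _∘ₛ_; constant; t)
    renaming (Carrier to R⟦t⟧; _≈_ to _≈ₛ_; _+_ to _+ₛ_; _*_ to _*ₛ_; -_ to -ₛ_; 0# to 0ₛ; 1# to 1ₛ; _^_ to _^ₛ_)
  open SemiringMultiples semiring using (_×_; ×-congʳ; ×-comm-*; ×-homo-1)
  open Multiples +-commutativeMonoid using (×-distrib-+)
  open Summation semiring using (sum; sum-cong-≋; sum-replicate-zero; ∑-distrib-+; *-distribˡ-sum)
  open CommutativeSemigroupProperties +-commutativeSemigroup using (interchange)
  open SetoidReasoning setoid

  infixr 8 _∙_
  _∙_ : Carrier → R⟦t⟧ → R⟦t⟧
  (s ∙ a) n = s * a n

  *ₛ-cong-≤ : ∀ n {a a₁ b b₁} → (∀ i → i ≤ n → a i ≈ a₁ i) → (∀ i → i ≤ n → b i ≈ b₁ i) →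
              (a *ₛ b) n ≈ (a₁ *ₛ b₁) n
  *ₛ-cong-≤ zero    p q = +-congʳ (*-cong (p 0 z≤n) (q 0 z≤n))
  *ₛ-cong-≤ (suc n) p q =
    +-cong (*-cong (p 0 z≤n) (q (suc n) ℕₚ.≤-refl))
      (*ₛ-cong-≤ n (λ i i≤n → p (suc i) (s≤s i≤n)) (λ i i≤n → q i (ℕₚ.m≤n⇒m≤1+n i≤n)))

  *ₛ-cong : ∀ {a a₁ b b₁} → a ≈ₛ a₁ → b ≈ₛ b₁ → (a *ₛ b) ≈ₛ (a₁ *ₛ b₁)
  *ₛ-cong p q n = *ₛ-cong-≤ n (λ i _ → p i) (λ i _ → q i)

  *ₛ-congˡ : ∀ a {b b₁} → b ≈ₛ b₁ → (a *ₛ b) ≈ₛ (a *ₛ b₁)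
  *ₛ-congˡ a q = *ₛ-cong {a} (λ _ → refl) q

  *ₛ-congʳ : ∀ b {a a₁} → a ≈ₛ a₁ → (a *ₛ b) ≈ₛ (a₁ *ₛ b)
  *ₛ-congʳ b p = *ₛ-cong {b = b} p (λ _ → refl)

  *ₛ-suc : ∀ n a b → (a *ₛ b) (suc n) ≈ (a *ₛ (b ∘ suc)) n + a (suc n) * b 0
  *ₛ-suc zero    a b = trans (+-congˡ (+-identityʳ _)) (+-congʳ (sym (+-identityʳ _)))
  *ₛ-suc (suc n) a b = trans (+-congˡ (*ₛ-suc n (a ∘ suc) b)) (sym (+-assoc _ _ _))

  *ₛ-comm : ∀ a b → (a *ₛ b) ≈ₛ (b *ₛ a)
  *ₛ-comm a b zero    = +-congʳ (*-comm _ _)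
  *ₛ-comm a b (suc n) = begin
    a 0 * b (suc n) + ((a ∘ suc) *ₛ b) n  ≈⟨ +-cong (*-comm _ _) (*ₛ-comm (a ∘ suc) b n) ⟩
    b (suc n) * a 0 + (b *ₛ (a ∘ suc)) n  ≈⟨ +-comm _ _ ⟩
    (b *ₛ (a ∘ suc)) n + b (suc n) * a 0  ≈⟨ *ₛ-suc n b a ⟨
    (b *ₛ a) (suc n)                      ∎

  *ₛ-distribʳ : ∀ a b d → ((b +ₛ d) *ₛ a) ≈ₛ ((b *ₛ a) +ₛ (d *ₛ a))
  *ₛ-distribʳ a b d zero    = trans (+-cong (distribʳ _ _ _) (sym (+-identityʳ 0#))) (interchange _ _ _ _)
  *ₛ-distribʳ a b d (suc n) =
    trans (+-cong (distribʳ _ _ _) (*ₛ-distribʳ a (b ∘ suc) (d ∘ suc) n)) (interchange _ _ _ _)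

  *ₛ-distribˡ : ∀ a b d → (a *ₛ (b +ₛ d)) ≈ₛ ((a *ₛ b) +ₛ (a *ₛ d))
  *ₛ-distribˡ a b d n = begin
    (a *ₛ (b +ₛ d)) n          ≈⟨ *ₛ-comm a (b +ₛ d) n ⟩
    ((b +ₛ d) *ₛ a) n          ≈⟨ *ₛ-distribʳ a b d n ⟩
    (b *ₛ a) n + (d *ₛ a) n    ≈⟨ +-cong (*ₛ-comm b a n) (*ₛ-comm d a n) ⟩
    (a *ₛ b) n + (a *ₛ d) n    ∎

  ∙-*ₛ : ∀ s a b → ((s ∙ a) *ₛ b) ≈ₛ (s ∙ (a *ₛ b))
  ∙-*ₛ s a b zero    = begin
    s * a 0 * b 0 + 0#        ≈⟨ +-cong (*-assoc _ _ _) (sym (zeroʳ s)) ⟩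
    s * (a 0 * b 0) + s * 0#  ≈⟨ distribˡ _ _ _ ⟨
    s * (a 0 * b 0 + 0#)      ∎
  ∙-*ₛ s a b (suc n) = trans (+-cong (*-assoc _ _ _) (∙-*ₛ s (a ∘ suc) b n)) (sym (distribˡ _ _ _))

  *ₛ-∙ : ∀ s a b → (a *ₛ (s ∙ b)) ≈ₛ (s ∙ (a *ₛ b))
  *ₛ-∙ s a b n = trans (*ₛ-comm a (s ∙ b) n) (trans (∙-*ₛ s b a n) (*-congˡ (*ₛ-comm b a n)))

  *ₛ-zeroˡ : ∀ a → (0ₛ *ₛ a) ≈ₛ 0ₛ
  *ₛ-zeroˡ a zero    = trans (+-congʳ (zeroˡ _)) (+-identityʳ _)
  *ₛ-zeroˡ a (suc n) = trans (+-cong (zeroˡ _) (*ₛ-zeroˡ a n)) (+-identityʳ _)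

  constant-*ₛ : ∀ s a → (constant s *ₛ a) ≈ₛ (s ∙ a)
  constant-*ₛ s a zero    = +-identityʳ _
  constant-*ₛ s a (suc n) = trans (+-congˡ (*ₛ-zeroˡ a n)) (+-identityʳ _)

  *ₛ-assoc : ∀ a b d → ((a *ₛ b) *ₛ d) ≈ₛ (a *ₛ (b *ₛ d))
  *ₛ-assoc a b d zero    = +-congʳ (begin
    (a 0 * b 0 + 0#) * d 0    ≈⟨ *-congʳ (+-identityʳ _) ⟩
    a 0 * b 0 * d 0           ≈⟨ *-assoc _ _ _ ⟩
    a 0 * (b 0 * d 0)         ≈⟨ *-congˡ (+-identityʳ _) ⟨
    a 0 * (b 0 * d 0 + 0#)    ∎)
  *ₛ-assoc a b d (suc n) = begin
    (a 0 * b 0 + 0#) * d (suc n) + (((a 0 ∙ (b ∘ suc)) +ₛ ((a ∘ suc) *ₛ b)) *ₛ d) n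
      ≈⟨ +-cong (*-congʳ (+-identityʳ _)) (*ₛ-distribʳ d (a 0 ∙ (b ∘ suc)) ((a ∘ suc) *ₛ b) n) ⟩
    a 0 * b 0 * d (suc n) + (((a 0 ∙ (b ∘ suc)) *ₛ d) n + (((a ∘ suc) *ₛ b) *ₛ d) n)
      ≈⟨ +-cong (*-assoc _ _ _) (+-cong (∙-*ₛ (a 0) (b ∘ suc) d n) (*ₛ-assoc (a ∘ suc) b d n)) ⟩
    a 0 * (b 0 * d (suc n)) + (a 0 * ((b ∘ suc) *ₛ d) n + ((a ∘ suc) *ₛ (b *ₛ d)) n)
      ≈⟨ +-assoc _ _ _ ⟨
    a 0 * (b 0 * d (suc n)) + a 0 * ((b ∘ suc) *ₛ d) n + ((a ∘ suc) *ₛ (b *ₛ d)) n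
      ≈⟨ +-congʳ (distribˡ _ _ _) ⟨
    (a *ₛ (b *ₛ d)) (suc n) ∎

  *ₛ-identityˡ : ∀ a → (1ₛ *ₛ a) ≈ₛ a
  *ₛ-identityˡ a zero    = trans (+-identityʳ _) (*-identityˡ _)
  *ₛ-identityˡ a (suc n) = trans (+-cong (*-identityˡ _) (*ₛ-zeroˡ a n)) (+-identityʳ _)

  seriesRing : CommutativeRing c ℓ
  seriesRing = record
    { isCommutativeRing = record
      { isRing = record
        { +-isAbelianGroup = Pointwise.isAbelianGroup ℕ +-isAbelianGroup
        ; *-cong           = *ₛ-cong
        ; *-assoc          = *ₛ-assoc
        ; *-identity       = *ₛ-identityˡ , λ a n → trans (*ₛ-comm a 1ₛ n) (*ₛ-identityˡ a n)
        ; distrib          = *ₛ-distribˡ , *ₛ-distribʳ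
        }
      ; *-comm = *ₛ-comm
      }
    }

  module S = CommutativeRing seriesRing
  private
    module SR = SetoidReasoning S.setoid
    module SM = SemiringMultiples S.semiring
    module SE = Exponentiation S.commutativeSemiring

  infixr 5 _∷ₛ_
  _∷ₛ_ : Carrier → R⟦t⟧ → R⟦t⟧
  (s ∷ₛ a) zero    = s
  (s ∷ₛ a) (suc n) = a n

  ×-apply : ∀ m a n → (m SM.× a) n ≈ m × a n
  ×-apply zero    a n = refl
  ×-apply (suc m) a n = +-congˡ (×-apply m a n)

  ′-cong : ∀ {a b} → a ≈ₛ b → (a ′) ≈ₛ (b ′)
  ′-cong a≈b n = ×-congʳ (suc n) (a≈b (suc n))

  ′-+ₛ : ∀ a b → ((a +ₛ b) ′) ≈ₛ (a ′ +ₛ b ′)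
  ′-+ₛ a b n = ×-distrib-+ (a (suc n)) (b (suc n)) (suc n)

  ×-zero : ∀ m → m × 0# ≈ 0#
  ×-zero zero    = refl
  ×-zero (suc m) = trans (+-identityˡ _) (×-zero m)

  ′-constant : ∀ s → (constant s ′) ≈ₛ 0ₛ
  ′-constant s n = ×-zero (suc n)

  ′-suc : ∀ a → (a ′) ≈ₛ ((a ∘ suc) +ₛ (0# ∷ₛ (a ∘ suc) ′))
  ′-suc a zero    = refl
  ′-suc a (suc n) = refl

  0∷-*ₛ-suc : ∀ a b n → ((0# ∷ₛ a) *ₛ b) (suc n) ≈ (a *ₛ b) n
  0∷-*ₛ-suc a b n = trans (+-congʳ (zeroˡ _)) (+-identityˡ _)

  ′-*ₛ : ∀ a b → ((a *ₛ b) ′) ≈ₛ ((a ′ *ₛ b) +ₛ (a *ₛ b ′))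
  ′-*ₛ a b zero    = begin
    a 0 * b 1 + (a 1 * b 0 + 0#) + 0#                      ≈⟨ +-identityʳ _ ⟩
    a 0 * b 1 + (a 1 * b 0 + 0#)                           ≈⟨ +-comm _ _ ⟩
    a 1 * b 0 + 0# + a 0 * b 1                             ≈⟨ +-congˡ (+-identityʳ _) ⟨
    a 1 * b 0 + 0# + (a 0 * b 1 + 0#)                      ≈⟨ +-cong (+-congʳ (*-congʳ (+-identityʳ _))) (+-congʳ (*-congˡ (+-identityʳ _))) ⟨
    (a 1 + 0#) * b 0 + 0# + (a 0 * (b 1 + 0#) + 0#)        ∎
  ′-*ₛ a b (suc m) = begin
    (2+m × (a 0 * b 2+m + (a⁺ *ₛ b) (suc m)))
      ≈⟨ ×-distrib-+ _ _ 2+m ⟩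
    2+m × (a 0 * b 2+m) + ((a⁺ *ₛ b) (suc m) + ((a⁺ *ₛ b) ′) m)
      ≈⟨ +-cong (sym (×-comm-* 2+m _ _)) (+-congˡ (′-*ₛ a⁺ b m)) ⟩
    a 0 * (b ′) (suc m) + ((a⁺ *ₛ b) (suc m) + ((a⁺ ′ *ₛ b) m + (a⁺ *ₛ b ′) m))
      ≈⟨ +-congˡ (+-assoc _ _ _) ⟨
    a 0 * (b ′) (suc m) + ((a⁺ *ₛ b) (suc m) + (a⁺ ′ *ₛ b) m + (a⁺ *ₛ b ′) m)
      ≈⟨ trans (sym (+-assoc _ _ _)) (trans (+-congʳ (+-comm _ _)) (+-assoc _ _ _)) ⟩
    (a⁺ *ₛ b) (suc m) + (a⁺ ′ *ₛ b) m + (a *ₛ b ′) (suc m)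
      ≈⟨ +-congʳ (+-congˡ (0∷-*ₛ-suc (a⁺ ′) b m)) ⟨
    (a⁺ *ₛ b) (suc m) + ((0# ∷ₛ a⁺ ′) *ₛ b) (suc m) + (a *ₛ b ′) (suc m)
      ≈⟨ +-congʳ (*ₛ-distribʳ b a⁺ (0# ∷ₛ a⁺ ′) (suc m)) ⟨
    ((a⁺ +ₛ (0# ∷ₛ a⁺ ′)) *ₛ b) (suc m) + (a *ₛ b ′) (suc m)
      ≈⟨ +-congʳ (*ₛ-congʳ b (′-suc a) (suc m)) ⟨
    (a ′ *ₛ b) (suc m) + (a *ₛ b ′) (suc m) ∎
    where
    2+m = suc (suc m)
    a⁺  = a ∘ suc

  -- For e = 0 the junk exponent is harmless, the factor e being 0.
  powerDerivative : R⟦t⟧ → ℕ → R⟦t⟧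
  powerDerivative a e n = e × (a ^ₛ ℕ.pred e) n

  ′-^ₛ : ∀ a e → ((a ^ₛ e) ′) ≈ₛ (powerDerivative a e *ₛ a ′)
  ′-^ₛ a zero    = SR.begin
    1ₛ ′                       SR.≈⟨ (λ n → ×-zero (suc n)) ⟩
    0ₛ                         SR.≈⟨ *ₛ-zeroˡ (a ′) ⟨
    powerDerivative a 0 *ₛ a ′ SR.∎
  ′-^ₛ a (suc zero) = SR.begin
    (a *ₛ 1ₛ) ′                SR.≈⟨ ′-cong (S.*-identityʳ a) ⟩
    a ′                        SR.≈⟨ *ₛ-identityˡ (a ′) ⟨
    1ₛ *ₛ a ′                  SR.≈⟨ *ₛ-congʳ (a ′) (λ n → ×-homo-1 (1ₛ n)) ⟨
    powerDerivative a 1 *ₛ a ′ SR.∎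
  ′-^ₛ a (suc (suc e)) = SR.begin
    (a *ₛ aᵉ⁺¹) ′                                       SR.≈⟨ ′-*ₛ a aᵉ⁺¹ ⟩
    a ′ *ₛ aᵉ⁺¹ +ₛ a *ₛ aᵉ⁺¹ ′                          SR.≈⟨ S.+-cong (*ₛ-comm (a ′) aᵉ⁺¹) (*ₛ-congˡ a (′-^ₛ a (suc e))) ⟩
    aᵉ⁺¹ *ₛ a ′ +ₛ a *ₛ (powerDerivative a (suc e) *ₛ a ′)
      SR.≈⟨ (λ n → +-congˡ (*ₛ-assoc a (powerDerivative a (suc e)) (a ′) n)) ⟨
    aᵉ⁺¹ *ₛ a ′ +ₛ a *ₛ powerDerivative a (suc e) *ₛ a ′
      SR.≈⟨ *ₛ-distribʳ (a ′) aᵉ⁺¹ (a *ₛ powerDerivative a (suc e)) ⟨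
    (aᵉ⁺¹ +ₛ a *ₛ powerDerivative a (suc e)) *ₛ a ′
      SR.≈⟨ *ₛ-congʳ (a ′) (λ n → +-congˡ {aᵉ⁺¹ n} (trans (*ₛ-congˡ a {powerDerivative a (suc e)} (λ m → sym (×-apply (suc e) (a ^ₛ e) m)) n)
              (trans (SM.×-comm-* (suc e) a (a ^ₛ e) n) (×-apply (suc e) aᵉ⁺¹ n)))) ⟩
    powerDerivative a (suc (suc e)) *ₛ a ′ SR.∎
    where aᵉ⁺¹ = a ^ₛ suc e

  Agree : ℕ → R⟦t⟧ → R⟦t⟧ → Set ℓ
  Agree N a b = ∀ i → i < N → a i ≈ b i

  Agree-*ₛ : ∀ {u} → u 0 ≈ 0# → ∀ N {a b} → Agree N a b → Agree (suc N) (u *ₛ a) (u *ₛ b)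
  Agree-*ₛ {u} u₀≈0 N {a} {b} a~b zero    _   = +-congʳ (0*-cong u₀≈0)
    where
    0*-cong : ∀ {s x y} → s ≈ 0# → s * x ≈ s * y
    0*-cong s≈0 = trans (trans (*-congʳ s≈0) (zeroˡ _)) (sym (trans (*-congʳ s≈0) (zeroˡ _)))
  Agree-*ₛ {u} u₀≈0 N {a} {b} a~b (suc i) i<N = +-cong
    (trans (trans (*-congʳ u₀≈0) (zeroˡ _)) (sym (trans (*-congʳ u₀≈0) (zeroˡ _))))
    (*ₛ-cong-≤ i {u ∘ suc} (λ _ _ → refl) (λ j j≤i → a~b j (ℕₚ.≤-<-trans j≤i (s≤s⁻¹ i<N))))

  horner-unique : ∀ {w} → w 0 ≈ 0# → (F G : R⟦t⟧ → R⟦t⟧) (C : R⟦t⟧ → R⟦t⟧) →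
                  (∀ a → F a ≈ₛ (C a +ₛ (w *ₛ F (a ∘ suc)))) →
                  (∀ a → G a ≈ₛ (C a +ₛ (w *ₛ G (a ∘ suc)))) →
                  ∀ a → F a ≈ₛ G a
  horner-unique {w} w₀≈0 F G C F-horner G-horner a n = agree (suc n) a n ℕₚ.≤-refl
    where
    agree : ∀ N a → Agree N (F a) (G a)
    agree (suc N) a i i<N = begin
      F a i                              ≈⟨ F-horner a i ⟩
      C a i + (w *ₛ F (a ∘ suc)) i       ≈⟨ +-congˡ (Agree-*ₛ {w} w₀≈0 N (agree N (a ∘ suc)) i i<N) ⟩
      C a i + (w *ₛ G (a ∘ suc)) i       ≈⟨ G-horner a i ⟨
      G a i                              ∎

  truncation : R⟦t⟧ → R⟦t⟧ → ℕ → R⟦t⟧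
  truncation a u N m = sum {N} (λ k → a (toℕ k) * (u ^ₛ toℕ k) m)

  *ₛ-sum : ∀ b N (s : Fin N → Carrier) (v : Fin N → R⟦t⟧) →
           (b *ₛ (λ m → sum (λ k → s k * v k m))) ≈ₛ (λ n → sum (λ k → s k * (b *ₛ v k) n))
  *ₛ-sum b zero    s v n = S.zeroʳ b n
  *ₛ-sum b (suc N) s v n = begin
    (b *ₛ ((s₀ ∙ v₀) +ₛ rest)) n                ≈⟨ *ₛ-distribˡ b (s₀ ∙ v₀) rest n ⟩
    (b *ₛ (s₀ ∙ v₀)) n + (b *ₛ rest) n          ≈⟨ +-cong (*ₛ-∙ s₀ b v₀ n) (*ₛ-sum b N (s ∘ Fin.suc) (v ∘ Fin.suc) n) ⟩
    sum (λ k → s k * (b *ₛ v k) n)              ∎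
    where
    s₀   = s Fin.zero
    v₀   = v Fin.zero
    rest : R⟦t⟧
    rest m = sum (λ k → s (Fin.suc k) * v (Fin.suc k) m)

  truncation-horner : ∀ a u N →
    truncation a u (suc N) ≈ₛ (constant (a 0) +ₛ (u *ₛ truncation (a ∘ suc) u N))
  truncation-horner a u N m = +-cong (constant-1 m)
    (sym (*ₛ-sum u N (λ k → a (suc (toℕ k))) (λ k → u ^ₛ toℕ k) m))
    where
    constant-1 : ∀ m → a 0 * 1ₛ m ≈ constant (a 0) m
    constant-1 zero    = *-identityʳ _
    constant-1 (suc m) = zeroʳ _

  module _ {u : R⟦t⟧} (u₀≈0 : u 0 ≈ 0#) where

    truncation-agree : ∀ {N N₁} → N ≤ N₁ → ∀ a → Agree N (truncation a u N) (truncation a u N₁)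
    truncation-agree {suc N} {suc N₁} (s≤s N≤N₁) a i i<N = begin
      truncation a u (suc N) i                                 ≈⟨ truncation-horner a u N i ⟩
      constant (a 0) i + (u *ₛ truncation (a ∘ suc) u N) i     ≈⟨ +-congˡ (Agree-*ₛ {u} u₀≈0 N (truncation-agree N≤N₁ (a ∘ suc)) i i<N) ⟩
      constant (a 0) i + (u *ₛ truncation (a ∘ suc) u N₁) i    ≈⟨ truncation-horner a u N₁ i ⟨
      truncation a u (suc N₁) i                                ∎

    ∘ₛ-truncation : ∀ a N → Agree N (a ∘ₛ u) (truncation a u N)
    ∘ₛ-truncation a N i i<N = truncation-agree i<N a i ℕₚ.≤-refl

    ∘ₛ-horner : ∀ a → (a ∘ₛ u) ≈ₛ (constant (a 0) +ₛ (u *ₛ ((a ∘ suc) ∘ₛ u)))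
    ∘ₛ-horner a n = begin
      (a ∘ₛ u) n                                             ≈⟨ truncation-horner a u n n ⟩
      constant (a 0) n + (u *ₛ truncation (a ∘ suc) u n) n   ≈⟨ +-congˡ (Agree-*ₛ {u} u₀≈0 n (∘ₛ-truncation (a ∘ suc) n) n ℕₚ.≤-refl) ⟨
      constant (a 0) n + (u *ₛ ((a ∘ suc) ∘ₛ u)) n           ∎

    ∘ₛ-*ₛ-sum : ∀ a b N n → n < N →
                ((a ∘ₛ u) *ₛ b) n ≈ sum {N} (λ k → a (toℕ k) * ((u ^ₛ toℕ k) *ₛ b) n)
    ∘ₛ-*ₛ-sum a b N n n<N = begin
      ((a ∘ₛ u) *ₛ b) n          ≈⟨ *ₛ-cong-≤ n {b = b} (λ i i≤n → ∘ₛ-truncation a N i (ℕₚ.≤-<-trans i≤n n<N)) (λ _ _ → refl) ⟩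
      (truncation a u N *ₛ b) n  ≈⟨ *ₛ-comm (truncation a u N) b n ⟩
      (b *ₛ truncation a u N) n  ≈⟨ *ₛ-sum b N (λ k → a (toℕ k)) (λ k → u ^ₛ toℕ k) n ⟩
      sum {N} (λ k → a (toℕ k) * (b *ₛ (u ^ₛ toℕ k)) n)
                                 ≈⟨ sum-cong-≋ {N} (λ k → *-congˡ (*ₛ-comm b (u ^ₛ toℕ k) n)) ⟩
      sum {N} (λ k → a (toℕ k) * ((u ^ₛ toℕ k) *ₛ b) n) ∎

  ∘ₛ-cong : ∀ {a a₁ u u₁} → a ≈ₛ a₁ → u ≈ₛ u₁ → (a ∘ₛ u) ≈ₛ (a₁ ∘ₛ u₁)
  ∘ₛ-cong a≈a₁ u≈u₁ n = sum-cong-≋ {suc n} (λ k → *-cong (a≈a₁ (toℕ k)) (SE.^-congˡ (toℕ k) u≈u₁ n))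

  ∘ₛ-congʳ : ∀ u {a a₁} → a ≈ₛ a₁ → (a ∘ₛ u) ≈ₛ (a₁ ∘ₛ u)
  ∘ₛ-congʳ u a≈a₁ n = sum-cong-≋ {suc n} (λ k → *-congʳ {(u ^ₛ toℕ k) n} (a≈a₁ (toℕ k)))

  ∘ₛ-+ₛ : ∀ a b u → ((a +ₛ b) ∘ₛ u) ≈ₛ ((a ∘ₛ u) +ₛ (b ∘ₛ u))
  ∘ₛ-+ₛ a b u n = trans (sum-cong-≋ {suc n} (λ k → distribʳ ((u ^ₛ toℕ k) n) (a (toℕ k)) (b (toℕ k))))
    (∑-distrib-+ {suc n} (λ k → a (toℕ k) * (u ^ₛ toℕ k) n) (λ k → b (toℕ k) * (u ^ₛ toℕ k) n))

  ∘ₛ-∙ : ∀ s a u → ((s ∙ a) ∘ₛ u) ≈ₛ (s ∙ (a ∘ₛ u))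
  ∘ₛ-∙ s a u n = trans (sum-cong-≋ {suc n} (λ k → *-assoc s (a (toℕ k)) ((u ^ₛ toℕ k) n)))
    (sym (*-distribˡ-sum {suc n} s (λ k → a (toℕ k) * (u ^ₛ toℕ k) n)))

  0ₛ-∘ₛ : ∀ u → (0ₛ ∘ₛ u) ≈ₛ 0ₛ
  0ₛ-∘ₛ u n = trans (sum-cong-≋ {suc n} (λ k → zeroˡ ((u ^ₛ toℕ k) n))) (sum-replicate-zero (suc n))

  module _ {u : R⟦t⟧} (u₀≈0 : u 0 ≈ 0#) where

    0∷-∘ₛ : ∀ a → ((0# ∷ₛ a) ∘ₛ u) ≈ₛ (u *ₛ (a ∘ₛ u))
    0∷-∘ₛ a n = trans (∘ₛ-horner {u} u₀≈0 (0# ∷ₛ a) n) (trans (+-congʳ (constant-0 n)) (+-identityˡ _))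
      where
      constant-0 : constant 0# ≈ₛ 0ₛ
      constant-0 zero    = refl
      constant-0 (suc n) = refl

    constant-∘ₛ : ∀ s → (constant s ∘ₛ u) ≈ₛ constant s
    constant-∘ₛ s n = begin
      (constant s ∘ₛ u) n                    ≈⟨ ∘ₛ-horner {u} u₀≈0 (constant s) n ⟩
      constant s n + (u *ₛ (0ₛ ∘ₛ u)) n      ≈⟨ +-congˡ (*ₛ-congˡ u (0ₛ-∘ₛ u) n) ⟩
      constant s n + (u *ₛ 0ₛ) n             ≈⟨ +-congˡ (S.zeroʳ u n) ⟩
      constant s n + 0#                      ≈⟨ +-identityʳ _ ⟩
      constant s n                           ∎

    1ₛ-∘ₛ : (1ₛ ∘ₛ u) ≈ₛ 1ₛ
    1ₛ-∘ₛ n = trans (∘ₛ-congʳ u 1≈constant n)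
      (trans (constant-∘ₛ 1# n) (sym (1≈constant n)))
      where
      1≈constant : 1ₛ ≈ₛ constant 1#
      1≈constant zero    = refl
      1≈constant (suc n) = refl

    t-∘ₛ : (t ∘ₛ u) ≈ₛ u
    t-∘ₛ = SR.begin
      t ∘ₛ u             SR.≈⟨ ∘ₛ-congʳ u t≈0∷1 ⟩
      (0# ∷ₛ 1ₛ) ∘ₛ u    SR.≈⟨ 0∷-∘ₛ 1ₛ ⟩
      u *ₛ (1ₛ ∘ₛ u)     SR.≈⟨ *ₛ-congˡ u 1ₛ-∘ₛ ⟩
      u *ₛ 1ₛ            SR.≈⟨ S.*-identityʳ u ⟩
      u                  SR.∎
      where
      t≈0∷1 : t ≈ₛ (0# ∷ₛ 1ₛ)
      t≈0∷1 zero          = refl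
      t≈0∷1 (suc zero)    = refl
      t≈0∷1 (suc (suc _)) = refl

    ∘ₛ-*ₛ : ∀ a b → ((a *ₛ b) ∘ₛ u) ≈ₛ ((a ∘ₛ u) *ₛ (b ∘ₛ u))
    ∘ₛ-*ₛ a b = horner-unique {u} u₀≈0 (λ a → (a *ₛ b) ∘ₛ u) (λ a → (a ∘ₛ u) *ₛ (b ∘ₛ u))
                  (λ a → a 0 ∙ (b ∘ₛ u)) left right a
      where
      split : ∀ a → (a *ₛ b) ≈ₛ ((a 0 ∙ b) +ₛ (0# ∷ₛ ((a ∘ suc) *ₛ b)))
      split a zero    = refl
      split a (suc n) = refl

      left : ∀ a → ((a *ₛ b) ∘ₛ u) ≈ₛ ((a 0 ∙ (b ∘ₛ u)) +ₛ (u *ₛ (((a ∘ suc) *ₛ b) ∘ₛ u)))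
      left a = SR.begin
        (a *ₛ b) ∘ₛ u
          SR.≈⟨ ∘ₛ-congʳ u (split a) ⟩
        ((a 0 ∙ b) +ₛ (0# ∷ₛ ((a ∘ suc) *ₛ b))) ∘ₛ u
          SR.≈⟨ ∘ₛ-+ₛ (a 0 ∙ b) (0# ∷ₛ ((a ∘ suc) *ₛ b)) u ⟩
        ((a 0 ∙ b) ∘ₛ u) +ₛ ((0# ∷ₛ ((a ∘ suc) *ₛ b)) ∘ₛ u)
          SR.≈⟨ S.+-cong (∘ₛ-∙ (a 0) b u) (0∷-∘ₛ ((a ∘ suc) *ₛ b)) ⟩
        (a 0 ∙ (b ∘ₛ u)) +ₛ (u *ₛ (((a ∘ suc) *ₛ b) ∘ₛ u)) SR.∎

      right : ∀ a → ((a ∘ₛ u) *ₛ (b ∘ₛ u)) ≈ₛ ((a 0 ∙ (b ∘ₛ u)) +ₛ (u *ₛ (((a ∘ suc) ∘ₛ u) *ₛ (b ∘ₛ u))))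
      right a = SR.begin
        (a ∘ₛ u) *ₛ (b ∘ₛ u)
          SR.≈⟨ *ₛ-congʳ (b ∘ₛ u) (∘ₛ-horner {u} u₀≈0 a) ⟩
        (constant (a 0) +ₛ (u *ₛ ((a ∘ suc) ∘ₛ u))) *ₛ (b ∘ₛ u)
          SR.≈⟨ *ₛ-distribʳ (b ∘ₛ u) (constant (a 0)) (u *ₛ ((a ∘ suc) ∘ₛ u)) ⟩
        (constant (a 0) *ₛ (b ∘ₛ u)) +ₛ ((u *ₛ ((a ∘ suc) ∘ₛ u)) *ₛ (b ∘ₛ u))
          SR.≈⟨ S.+-cong (constant-*ₛ (a 0) (b ∘ₛ u)) (*ₛ-assoc u ((a ∘ suc) ∘ₛ u) (b ∘ₛ u)) ⟩
        (a 0 ∙ (b ∘ₛ u)) +ₛ (u *ₛ (((a ∘ suc) ∘ₛ u) *ₛ (b ∘ₛ u))) SR.∎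

    ∘ₛ-′ : ∀ a → ((a ∘ₛ u) ′) ≈ₛ (((a ′) ∘ₛ u) *ₛ u ′)
    ∘ₛ-′ = horner-unique {u} u₀≈0 (λ a → (a ∘ₛ u) ′) (λ a → ((a ′) ∘ₛ u) *ₛ u ′)
             (λ a → ((a ∘ suc) ∘ₛ u) *ₛ u ′) left right
      where
      left : ∀ a → ((a ∘ₛ u) ′) ≈ₛ ((((a ∘ suc) ∘ₛ u) *ₛ u ′) +ₛ (u *ₛ (((a ∘ suc) ∘ₛ u) ′)))
      left a = SR.begin
        (a ∘ₛ u) ′                                  SR.≈⟨ ′-cong (∘ₛ-horner {u} u₀≈0 a) ⟩
        (constant (a 0) +ₛ (u *ₛ v)) ′              SR.≈⟨ ′-+ₛ (constant (a 0)) (u *ₛ v) ⟩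
        constant (a 0) ′ +ₛ (u *ₛ v) ′              SR.≈⟨ S.+-cong (′-constant (a 0)) (′-*ₛ u v) ⟩
        0ₛ +ₛ ((u ′ *ₛ v) +ₛ (u *ₛ v ′))            SR.≈⟨ S.+-identityˡ _ ⟩
        (u ′ *ₛ v) +ₛ (u *ₛ v ′)                    SR.≈⟨ (λ n → +-congʳ (*ₛ-comm (u ′) v n)) ⟩
        (v *ₛ u ′) +ₛ (u *ₛ v ′)                    SR.∎
        where v = (a ∘ suc) ∘ₛ u

      right : ∀ a → (((a ′) ∘ₛ u) *ₛ u ′) ≈ₛ
                    ((((a ∘ suc) ∘ₛ u) *ₛ u ′) +ₛ (u *ₛ ((((a ∘ suc) ′) ∘ₛ u) *ₛ u ′)))
      right a = SR.begin
        ((a ′) ∘ₛ u) *ₛ u ′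
          SR.≈⟨ *ₛ-congʳ (u ′) (∘ₛ-congʳ u (′-suc a)) ⟩
        ((a⁺ +ₛ (0# ∷ₛ a⁺ ′)) ∘ₛ u) *ₛ u ′
          SR.≈⟨ *ₛ-congʳ (u ′) (∘ₛ-+ₛ a⁺ (0# ∷ₛ a⁺ ′) u) ⟩
        ((a⁺ ∘ₛ u) +ₛ ((0# ∷ₛ a⁺ ′) ∘ₛ u)) *ₛ u ′
          SR.≈⟨ *ₛ-distribʳ (u ′) (a⁺ ∘ₛ u) ((0# ∷ₛ a⁺ ′) ∘ₛ u) ⟩
        ((a⁺ ∘ₛ u) *ₛ u ′) +ₛ (((0# ∷ₛ a⁺ ′) ∘ₛ u) *ₛ u ′)
          SR.≈⟨ (λ n → +-congˡ (*ₛ-congʳ (u ′) (0∷-∘ₛ (a⁺ ′)) n)) ⟩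
        ((a⁺ ∘ₛ u) *ₛ u ′) +ₛ ((u *ₛ (a⁺ ′ ∘ₛ u)) *ₛ u ′)
          SR.≈⟨ (λ n → +-congˡ (*ₛ-assoc u (a⁺ ′ ∘ₛ u) (u ′) n)) ⟩
        ((a⁺ ∘ₛ u) *ₛ u ′) +ₛ (u *ₛ ((a⁺ ′ ∘ₛ u) *ₛ u ′)) SR.∎
        where a⁺ = a ∘ suc

  ∘ₛ-assoc : ∀ {u v} → u 0 ≈ 0# → v 0 ≈ 0# → ∀ a → ((a ∘ₛ u) ∘ₛ v) ≈ₛ (a ∘ₛ (u ∘ₛ v))
  ∘ₛ-assoc {u} {v} u₀≈0 v₀≈0 = horner-unique {u ∘ₛ v} uv₀≈0 (λ a → (a ∘ₛ u) ∘ₛ v) (λ a → a ∘ₛ (u ∘ₛ v))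
                      (λ a → constant (a 0)) left (∘ₛ-horner {u ∘ₛ v} uv₀≈0)
    where
    uv₀≈0 : (u ∘ₛ v) 0 ≈ 0#
    uv₀≈0 = trans (+-identityʳ _) (trans (*-congʳ u₀≈0) (zeroˡ _))

    left : ∀ a → ((a ∘ₛ u) ∘ₛ v) ≈ₛ (constant (a 0) +ₛ ((u ∘ₛ v) *ₛ (((a ∘ suc) ∘ₛ u) ∘ₛ v)))
    left a = SR.begin
      (a ∘ₛ u) ∘ₛ v
        SR.≈⟨ ∘ₛ-congʳ v (∘ₛ-horner {u} u₀≈0 a) ⟩
      (constant (a 0) +ₛ (u *ₛ ((a ∘ suc) ∘ₛ u))) ∘ₛ v
        SR.≈⟨ ∘ₛ-+ₛ (constant (a 0)) (u *ₛ ((a ∘ suc) ∘ₛ u)) v ⟩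
      (constant (a 0) ∘ₛ v) +ₛ ((u *ₛ ((a ∘ suc) ∘ₛ u)) ∘ₛ v)
        SR.≈⟨ S.+-cong (constant-∘ₛ {v} v₀≈0 (a 0)) (∘ₛ-*ₛ {v} v₀≈0 u ((a ∘ suc) ∘ₛ u)) ⟩
      constant (a 0) +ₛ ((u ∘ₛ v) *ₛ (((a ∘ suc) ∘ₛ u) ∘ₛ v)) SR.∎

  monomial : Carrier → ℕ → R⟦t⟧
  monomial s zero    = constant s
  monomial s (suc m) = 0# ∷ₛ monomial s m

  monomial-cong : ∀ {s s₁} → s ≈ s₁ → ∀ m → monomial s m ≈ₛ monomial s₁ m
  monomial-cong s≈s₁ zero    zero    = s≈s₁
  monomial-cong s≈s₁ zero    (suc n) = refl
  monomial-cong s≈s₁ (suc m) zero    = refl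
  monomial-cong s≈s₁ (suc m) (suc n) = monomial-cong s≈s₁ m n

  ∙-monomial : ∀ s s₁ m → (s ∙ monomial s₁ m) ≈ₛ monomial (s * s₁) m
  ∙-monomial s s₁ zero    zero    = refl
  ∙-monomial s s₁ zero    (suc n) = zeroʳ s
  ∙-monomial s s₁ (suc m) zero    = zeroʳ s
  ∙-monomial s s₁ (suc m) (suc n) = ∙-monomial s s₁ m n

  monomial-*ₛ : ∀ s m s₁ m₁ → (monomial s m *ₛ monomial s₁ m₁) ≈ₛ monomial (s * s₁) (m ℕ.+ m₁)
  monomial-*ₛ s zero    s₁ m₁ n       = trans (constant-*ₛ s (monomial s₁ m₁) n) (∙-monomial s s₁ m₁ n)
  monomial-*ₛ s (suc m) s₁ m₁ zero    = trans (+-identityʳ _) (zeroˡ _)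
  monomial-*ₛ s (suc m) s₁ m₁ (suc n) =
    trans (0∷-*ₛ-suc (monomial s m) (monomial s₁ m₁) n) (monomial-*ₛ s m s₁ m₁ n)

  shift-*ₛ-zero : ∀ s a → ((0# ∷ₛ s) *ₛ a) 0 ≈ 0#
  shift-*ₛ-zero s a = trans (+-identityʳ _) (zeroˡ _)

  shift-*ₛ-suc : ∀ s a n → ((0# ∷ₛ constant s) *ₛ a) (suc n) ≈ s * a n
  shift-*ₛ-suc s a n = trans (0∷-*ₛ-suc (constant s) a n) (constant-*ₛ s a n)

module Polynomials {c ℓ₁ ℓ₂} (K : HeytingField c ℓ₁ ℓ₂) (char0 : CharacteristicZero K) where
  open OverField K char0
  open HeytingCommutativeRing (HeytingField.heytingCommutativeRing K) using (commutativeRing)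
  module K = CommutativeRing commutativeRing
  module P₀ = PowerSeries commutativeRing
  module P₁ = PowerSeries P₀.seriesRing
  module P₂ = PowerSeries P₁.seriesRing

  -- The polynomials only form a raw ring; their coefficients are compared
  -- inside the commutative ring K⟦z⟧⟦y⟧⟦x⟧.
  module K³ = CommutativeRing P₂.seriesRing
  private
    module K³R = SetoidReasoning K³.setoid

  term : Monomial → K³.Carrier
  term (a x^ i y^ j z^ k) = P₂.monomial (P₁.monomial (P₀.monomial a k) j) i

  indicator : ∀ a i′ j′ k′ i j k →
    (if (i′ ≡ᵇ i) ∧ (j′ ≡ᵇ j) ∧ (k′ ≡ᵇ k) then a else 0#) ≈ term (a x^ i′ y^ j′ z^ k′) i j k
  indicator a zero     zero     zero     zero    zero    zero    = K.refl
  indicator a zero     zero     zero     zero    zero    (suc k) = K.refl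
  indicator a zero     zero     (suc k′) zero    zero    zero    = K.refl
  indicator a zero     zero     (suc k′) zero    zero    (suc k) = indicator a 0 0 k′ 0 0 k
  indicator a zero     zero     k′       zero    (suc j) k       = K.refl
  indicator a zero     (suc j′) k′       zero    zero    k       = K.refl
  indicator a zero     (suc j′) k′       zero    (suc j) k       = indicator a 0 j′ k′ 0 j k
  indicator a zero     j′       k′       (suc i) j       k       = K.refl
  indicator a (suc i′) j′       k′       zero    j       k       = K.refl
  indicator a (suc i′) j′       k′       (suc i) j       k       = indicator a i′ j′ k′ i j k

  coeff-∷ : ∀ w p → coeff (w ∷ p) K³.≈ (term w K³.+ coeff p)
  coeff-∷ (a x^ i′ y^ j′ z^ k′) p i j k = K.+-congʳ (indicator a i′ j′ k′ i j k)

  coeff-[_] : ∀ w → coeff [ w ] K³.≈ term w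
  coeff-[ w ] i j k = K.trans (coeff-∷ w [] i j k) (K.+-identityʳ _)

  coeff-++ : ∀ p q → coeff (p ++ q) K³.≈ (coeff p K³.+ coeff q)
  coeff-++ []      q i j k = K.sym (K.+-identityˡ _)
  coeff-++ (w ∷ p) q i j k = K.trans (K.+-congˡ (coeff-++ p q i j k)) (K.sym (K.+-assoc _ _ _))

  coeff-neg : ∀ p → coeff (Pol.- p) K³.≈ (K³.- coeff p)
  coeff-neg []      i j k = K.sym -0#≈0#
    where open import Algebra.Properties.Ring K.ring using (-0#≈0#)
  coeff-neg ((a x^ i′ y^ j′ z^ k′) ∷ p) i j k =
    K.trans (K.+-cong (neg-if ((i′ ≡ᵇ i) ∧ (j′ ≡ᵇ j) ∧ (k′ ≡ᵇ k))) (coeff-neg p i j k)) (-‿+-comm _ _)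
    where
    open import Algebra.Properties.Ring K.ring using (-0#≈0#; -‿+-comm)

    neg-if : ∀ b → (if b then - a else 0#) ≈ - (if b then a else 0#)
    neg-if true  = K.refl
    neg-if false = K.sym -0#≈0#

  term-* : ∀ a i j k a₁ i₁ j₁ k₁ →
    term ((a * a₁) x^ (i ℕ.+ i₁) y^ (j ℕ.+ j₁) z^ (k ℕ.+ k₁))
      K³.≈ (term (a x^ i y^ j z^ k) K³.* term (a₁ x^ i₁ y^ j₁ z^ k₁))
  term-* a i j k a₁ i₁ j₁ k₁ = K³.sym {term (a x^ i y^ j z^ k) K³.* term (a₁ x^ i₁ y^ j₁ z^ k₁)} (K³R.begin
    P₂.monomial m i K³.* P₂.monomial m₁ i₁     K³R.≈⟨ P₂.monomial-*ₛ m i m₁ i₁ ⟩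
    P₂.monomial (m P₁.*ₛ m₁) (i ℕ.+ i₁)        K³R.≈⟨ P₂.monomial-cong (P₁.monomial-*ₛ (P₀.monomial a k) j (P₀.monomial a₁ k₁) j₁) (i ℕ.+ i₁) ⟩
    P₂.monomial (P₁.monomial (P₀.monomial a k P₀.*ₛ P₀.monomial a₁ k₁) (j ℕ.+ j₁)) (i ℕ.+ i₁)
      K³R.≈⟨ P₂.monomial-cong (P₁.monomial-cong (P₀.monomial-*ₛ a k a₁ k₁) (j ℕ.+ j₁)) (i ℕ.+ i₁) ⟩
    term ((a * a₁) x^ (i ℕ.+ i₁) y^ (j ℕ.+ j₁) z^ (k ℕ.+ k₁)) K³R.∎)
    where
    m  = P₁.monomial (P₀.monomial a k) j
    m₁ = P₁.monomial (P₀.monomial a₁ k₁) j₁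

  coeff-[]* : ∀ w q → coeff ([ w ] Pol.* q) K³.≈ (term w K³.* coeff q)
  coeff-[]* w []      = K³.sym {term w K³.* K³.0#} (K³.zeroʳ (term w))
  coeff-[]* w@(a x^ i y^ j z^ k) (v@(a₁ x^ i₁ y^ j₁ z^ k₁) ∷ q) = K³R.begin
    coeff ([ w ] Pol.* (v ∷ q))                            K³R.≈⟨ coeff-∷ wv ([ w ] Pol.* q) ⟩
    term (wv) K³.+ coeff ([ w ] Pol.* q)                   K³R.≈⟨ K³.+-cong (term-* a i j k a₁ i₁ j₁ k₁) (coeff-[]* w q) ⟩
    (term w K³.* term v) K³.+ (term w K³.* coeff q)        K³R.≈⟨ K³.distribˡ (term w) (term v) (coeff q) ⟨
    term w K³.* (term v K³.+ coeff q)                      K³R.≈⟨ P₂.*ₛ-congˡ (term w) (coeff-∷ v q) ⟨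
    term w K³.* coeff (v ∷ q)                              K³R.∎
    where wv = (a * a₁) x^ (i ℕ.+ i₁) y^ (j ℕ.+ j₁) z^ (k ℕ.+ k₁)

  ∷-* : ∀ w p q → (w ∷ p) Pol.* q ≡ [ w ] Pol.* q ++ p Pol.* q
  ∷-* w p q = ≡.cong (_++ p Pol.* q) (≡.sym (Listₚ.++-identityʳ _))

  coeff-* : ∀ p q → coeff (p Pol.* q) K³.≈ (coeff p K³.* coeff q)
  coeff-* []      q = K³.sym {K³.0# K³.* coeff q} (K³.zeroˡ (coeff q))
  coeff-* (w ∷ p) q = K³R.begin
    coeff ((w ∷ p) Pol.* q)                                K³R.≡⟨ ≡.cong coeff (∷-* w p q) ⟩
    coeff ([ w ] Pol.* q ++ p Pol.* q)                     K³R.≈⟨ coeff-++ ([ w ] Pol.* q) (p Pol.* q) ⟩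
    coeff ([ w ] Pol.* q) K³.+ coeff (p Pol.* q)           K³R.≈⟨ K³.+-cong (coeff-[]* w q) (coeff-* p q) ⟩
    (term w K³.* coeff q) K³.+ (coeff p K³.* coeff q)      K³R.≈⟨ K³.distribʳ (coeff q) (term w) (coeff p) ⟨
    (term w K³.+ coeff p) K³.* coeff q                     K³R.≈⟨ P₂.*ₛ-congʳ (coeff q) (coeff-∷ w p) ⟨
    coeff (w ∷ p) K³.* coeff q                             K³R.∎

module Operators {c ℓ₁ ℓ₂} (K : HeytingField c ℓ₁ ℓ₂) (char0 : CharacteristicZero K) where
  open OverField K char0
  open Polynomials K char0
  open SemiringMultiples K.semiring using (_×_; ×-congʳ)
  open Multiples K.+-commutativeMonoid using (×-distrib-+)
  open Summation K.semiring using (sum; sum-cong-≋; sum-replicate-zero; ∑-distrib-+)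
  open RawSemiringDefs Pol.rawSemiring using () renaming (_×_ to _×ₚ_; sum to sumₚ)
  open SetoidReasoning K.setoid

  ×-zero : ∀ n → n × 0# ≈ 0#
  ×-zero = P₀.×-zero

  scalar-*³ : ∀ a Q i j k → (term (a x^ 0 y^ 0 z^ 0) K³.* Q) i j k ≈ a * Q i j k
  scalar-*³ a Q i j k = begin
    (P₂.constant (P₁.constant (P₀.constant a)) K³.* Q) i j k     ≈⟨ P₂.constant-*ₛ (P₁.constant (P₀.constant a)) Q i j k ⟩
    (P₁.constant (P₀.constant a) P₁.*ₛ Q i) j k                  ≈⟨ P₁.constant-*ₛ (P₀.constant a) (Q i) j k ⟩
    (P₀.constant a P₀.*ₛ Q i j) k                                ≈⟨ P₀.constant-*ₛ a (Q i j) k ⟩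
    a * Q i j k                                                  ∎

  x-*³-zero : ∀ Q j k → (coeff x K³.* Q) 0 j k ≈ 0#
  x-*³-zero Q j k = K.trans (P₂.*ₛ-congʳ Q (coeff-[ 1# x^ 1 y^ 0 z^ 0 ]) 0 j k)
    (P₂.shift-*ₛ-zero (P₂.constant (P₁.constant (P₀.constant 1#))) Q j k)

  x-*³-suc : ∀ Q i j k → (coeff x K³.* Q) (suc i) j k ≈ Q i j k
  x-*³-suc Q i j k = begin
    (coeff x K³.* Q) (suc i) j k                    ≈⟨ P₂.*ₛ-congʳ Q (coeff-[ 1# x^ 1 y^ 0 z^ 0 ]) (suc i) j k ⟩
    (term (1# x^ 1 y^ 0 z^ 0) K³.* Q) (suc i) j k   ≈⟨ P₂.shift-*ₛ-suc (P₁.constant (P₀.constant 1#)) Q i j k ⟩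
    (P₁.constant (P₀.constant 1#) P₁.*ₛ Q i) j k    ≈⟨ P₁.constant-*ₛ (P₀.constant 1#) (Q i) j k ⟩
    (P₀.constant 1# P₀.*ₛ Q i j) k                  ≈⟨ P₀.constant-*ₛ 1# (Q i j) k ⟩
    1# * Q i j k                                    ≈⟨ K.*-identityˡ _ ⟩
    Q i j k                                         ∎

  y-*³ : ∀ Q i j k → (coeff y K³.* Q) i j k ≈ ((P₀.0ₛ P₁.∷ₛ P₁.constant (P₀.constant 1#)) P₁.*ₛ Q i) j k
  y-*³ Q i j k = K.trans (P₂.*ₛ-congʳ Q (coeff-[ 1# x^ 0 y^ 1 z^ 0 ]) i j k)
    (P₂.constant-*ₛ (P₀.0ₛ P₁.∷ₛ P₁.constant (P₀.constant 1#)) Q i j k)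

  y-*³-zero : ∀ Q i k → (coeff y K³.* Q) i 0 k ≈ 0#
  y-*³-zero Q i k = K.trans (y-*³ Q i 0 k)
    (P₁.shift-*ₛ-zero (P₁.constant (P₀.constant 1#)) (Q i) k)

  y-*³-suc : ∀ Q i j k → (coeff y K³.* Q) i (suc j) k ≈ Q i j k
  y-*³-suc Q i j k = begin
    (coeff y K³.* Q) i (suc j) k                    ≈⟨ y-*³ Q i (suc j) k ⟩
    ((P₀.0ₛ P₁.∷ₛ P₁.constant (P₀.constant 1#)) P₁.*ₛ Q i) (suc j) k
                                                    ≈⟨ P₁.shift-*ₛ-suc (P₀.constant 1#) (Q i) j k ⟩
    (P₀.constant 1# P₀.*ₛ Q i j) k                  ≈⟨ P₀.constant-*ₛ 1# (Q i j) k ⟩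
    1# * Q i j k                                    ≈⟨ K.*-identityˡ _ ⟩
    Q i j k                                         ∎

  z-*³ : ∀ Q i j k → (coeff z K³.* Q) i j k ≈ ((0# P₀.∷ₛ P₀.constant 1#) P₀.*ₛ Q i j) k
  z-*³ Q i j k = begin
    (coeff z K³.* Q) i j k                                            ≈⟨ P₂.*ₛ-congʳ Q (coeff-[ 1# x^ 0 y^ 0 z^ 1 ]) i j k ⟩
    (term (1# x^ 0 y^ 0 z^ 1) K³.* Q) i j k                           ≈⟨ P₂.constant-*ₛ (P₁.constant (0# P₀.∷ₛ P₀.constant 1#)) Q i j k ⟩
    (P₁.constant (0# P₀.∷ₛ P₀.constant 1#) P₁.*ₛ Q i) j k             ≈⟨ P₁.constant-*ₛ (0# P₀.∷ₛ P₀.constant 1#) (Q i) j k ⟩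
    ((0# P₀.∷ₛ P₀.constant 1#) P₀.*ₛ Q i j) k                         ∎

  z-*³-zero : ∀ Q i j → (coeff z K³.* Q) i j 0 ≈ 0#
  z-*³-zero Q i j = K.trans (z-*³ Q i j 0) (P₀.shift-*ₛ-zero (P₀.constant 1#) (Q i j))

  z-*³-suc : ∀ Q i j k → (coeff z K³.* Q) i j (suc k) ≈ Q i j k
  z-*³-suc Q i j k = K.trans (z-*³ Q i j (suc k))
    (K.trans (P₀.shift-*ₛ-suc 1# (Q i j) k) (K.*-identityˡ _))

  coeff-scalar* : ∀ a q i j k → coeff (scalar a Pol.* q) i j k ≈ a * coeff q i j k
  coeff-scalar* a q i j k = K.trans (coeff-[]* (a x^ 0 y^ 0 z^ 0) q i j k) (scalar-*³ a (coeff q) i j k)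

  coeff-× : ∀ n p i j k → coeff (n ×ₚ p) i j k ≈ n × coeff p i j k
  coeff-× zero    p i j k = K.refl
  coeff-× (suc n) p i j k = K.trans (coeff-++ p (n ×ₚ p) i j k) (K.+-congˡ (coeff-× n p i j k))

  coeff-sum : ∀ n (v : Fin n → K[x,y,z]) i j k → coeff (sumₚ v) i j k ≈ sum (λ m → coeff (v m) i j k)
  coeff-sum zero    v i j k = K.refl
  coeff-sum (suc n) v i j k = K.trans (coeff-++ (v Fin.zero) _ i j k) (K.+-congˡ (coeff-sum n (λ m → v (Fin.suc m)) i j k))

  if-zero : ∀ b → (if b then 0# else 0#) ≈ 0#
  if-zero true  = K.refl
  if-zero false = K.refl

  coeff-∂y : ∀ p i j k → coeff (∂y p) i j k ≈ suc j × coeff p i (suc j) k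
  coeff-∂y []      i j k = K.sym (×-zero (suc j))
  coeff-∂y ((a x^ i′ y^ j′ z^ k′) ∷ p) i j k =
    K.trans (K.+-cong (head j′) (coeff-∂y p i j k)) (K.sym (×-distrib-+ _ _ (suc j)))
    where
    xs zs : Bool
    xs = i′ ≡ᵇ i
    zs = k′ ≡ᵇ k

    ∧-false : ∀ b → (if b ∧ false ∧ zs then a else 0#) ≈ 0#
    ∧-false true  = K.refl
    ∧-false false = K.refl

    select : ∀ j′ b e d → (Bool.T e → j′ ≡ j) →
      (if b ∧ e ∧ d then suc j′ × a else 0#) ≈ suc j × (if b ∧ e ∧ d then a else 0#)
    select j′ true  true  true  eq rewrite eq _ = K.refl
    select j′ true  true  false eq = K.sym (×-zero (suc j))
    select j′ true  false d     eq = K.sym (×-zero (suc j))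
    select j′ false e     d     eq = K.sym (×-zero (suc j))

    head : ∀ j′ → (if xs ∧ (j′ ∸ 1 ≡ᵇ j) ∧ zs then j′ × a else 0#)
                    ≈ suc j × (if xs ∧ (j′ ≡ᵇ suc j) ∧ zs then a else 0#)
    head zero     = K.trans (if-zero (xs ∧ (0 ≡ᵇ j) ∧ zs))
                      (K.sym (K.trans (×-congʳ (suc j) (∧-false xs)) (×-zero (suc j))))
    head (suc j′) = select j′ xs (j′ ≡ᵇ j) zs (ℕₚ.≡ᵇ⇒≡ j′ j)

  coeff-Dx⁻¹-zero : ∀ p j k → coeff (Dx⁻¹ p) 0 j k ≈ 0#
  coeff-Dx⁻¹-zero []      j k = K.refl
  coeff-Dx⁻¹-zero ((a x^ i′ y^ j′ z^ k′) ∷ p) j k = K.trans (K.+-identityˡ _) (coeff-Dx⁻¹-zero p j k)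

  coeff-Dx⁻¹-suc : ∀ p i j k → coeff (Dx⁻¹ p) (suc i) j k ≈ coeff p i j k * 1/ (suc i)
  coeff-Dx⁻¹-suc []      i j k = K.sym (K.zeroˡ _)
  coeff-Dx⁻¹-suc ((a x^ i′ y^ j′ z^ k′) ∷ p) i j k =
    K.trans (K.+-cong (select (i′ ≡ᵇ i) ((j′ ≡ᵇ j) ∧ (k′ ≡ᵇ k)) (ℕₚ.≡ᵇ⇒≡ i′ i)) (coeff-Dx⁻¹-suc p i j k))
      (K.sym (K.distribʳ _ _ _))
    where
    select : ∀ b d → (Bool.T b → i′ ≡ i) →
      (if b ∧ d then a * 1/ (suc i′) else 0#) ≈ (if b ∧ d then a else 0#) * 1/ (suc i)
    select true  true  eq rewrite eq _ = K.refl
    select true  false eq = K.sym (K.zeroˡ _)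
    select false d     eq = K.sym (K.zeroˡ _)

  ∂y^-∷ : ∀ m w p → (∂y ^ₒ m) (w ∷ p) ≡ (∂y ^ₒ m) [ w ] ++ (∂y ^ₒ m) p
  ∂y^-∷ zero    w p = ≡.refl
  ∂y^-∷ (suc m) w p = ≡.trans (≡.cong ∂y (∂y^-∷ m w p)) (Listₚ.map-++ _ ((∂y ^ₒ m) [ w ]) _)

  ∂y^-vanish : ∀ m w → Monomial.yDegree w < m → ∀ i j k → coeff ((∂y ^ₒ m) [ w ]) i j k ≈ 0#
  ∂y^-vanish m w deg<m i j k = vanish m i j k (ℕₚ.<-≤-trans deg<m (ℕₚ.m≤n+m m j))
    where
    beyond : ∀ a i′ j′ k′ i j k → j′ < j → coeff [ a x^ i′ y^ j′ z^ k′ ] i j k ≈ 0#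
    beyond a i′ j′ k′ i j k j′<j = K.trans (K.+-identityʳ _) (off (i′ ≡ᵇ i) (j′ ≡ᵇ j) (k′ ≡ᵇ k) (ℕₚ.≡ᵇ⇒≡ j′ j))
      where
      off : ∀ b e d → (Bool.T e → j′ ≡ j) → (if b ∧ e ∧ d then a else 0#) ≈ 0#
      off true  true  d eq = ⊥-elim (ℕₚ.<⇒≢ j′<j (eq _))
        where open import Data.Empty using (⊥-elim)
      off true  false d eq = K.refl
      off false e     d eq = K.refl

    vanish : ∀ m i j k → Monomial.yDegree w < j ℕ.+ m → coeff ((∂y ^ₒ m) [ w ]) i j k ≈ 0#
    vanish zero    i j k deg<j rewrite ℕₚ.+-identityʳ j =
      beyond (Monomial.coefficient w) (Monomial.xDegree w) (Monomial.yDegree w) (Monomial.zDegree w) i j k deg<j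
    vanish (suc m) i j k deg<j = K.trans (coeff-∂y ((∂y ^ₒ m) [ w ]) i j k)
      (K.trans (×-congʳ (suc j) (vanish m i (suc j) k (≡.subst (Monomial.yDegree w <_) (ℕₚ.+-suc j m) deg<j))) (×-zero (suc j)))

  sum-extend : ∀ {n N} → n ≤ N → (v : ℕ → Carrier) → (∀ m → n ≤ m → v m ≈ 0#) →
               sum {n} (λ m → v (toℕ m)) ≈ sum {N} (λ m → v (toℕ m))
  sum-extend {N = N} z≤n v v≈0 = K.sym (K.trans (sum-cong-≋ {N} (λ m → v≈0 (toℕ m) z≤n)) (sum-replicate-zero N))
  sum-extend (s≤s n≤N) v v≈0 = K.+-congˡ (sum-extend n≤N (λ m → v (suc m)) (λ m n≤m → v≈0 (suc m) (s≤s n≤m)))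

  coeff-[∂y] : ∀ φ p → ∃ λ N₀ → ∀ N → N₀ ≤ N → ∀ i j k →
    coeff ((φ [∂y]) p) i j k ≈ sum {N} (λ m → φ (toℕ m) * coeff ((∂y ^ₒ toℕ m) p) i j k)
  coeff-[∂y] φ []      = 0 , λ N _ i j k →
    K.sym (K.trans (sum-cong-≋ {N} (λ m → K.trans (K.*-congˡ (∂y^-[] (toℕ m) i j k)) (K.zeroʳ _))) (sum-replicate-zero N))
    where
    ∂y^-[] : ∀ m i j k → coeff ((∂y ^ₒ m) []) i j k ≈ 0#
    ∂y^-[] zero    i j k = K.refl
    ∂y^-[] (suc m) i j k = K.trans (coeff-∂y ((∂y ^ₒ m) []) i j k) (K.trans (×-congʳ (suc j) (∂y^-[] m i (suc j) k)) (×-zero (suc j)))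
  coeff-[∂y] φ (w ∷ p) with coeff-[∂y] φ p
  ... | N₀ , rest = suc deg ⊔ N₀ , λ N N₀≤N i j k → begin
    coeff ((φ [∂y]) (w ∷ p)) i j k
      ≈⟨ coeff-++ (sumₚ {suc deg} (λ m → scalar (φ (toℕ m)) Pol.* (∂y ^ₒ toℕ m) [ w ])) ((φ [∂y]) p) i j k ⟩
    coeff (sumₚ {suc deg} (λ m → scalar (φ (toℕ m)) Pol.* (∂y ^ₒ toℕ m) [ w ])) i j k + coeff ((φ [∂y]) p) i j k
      ≈⟨ K.+-cong (single N (ℕₚ.≤-trans (ℕₚ.m≤m⊔n (suc deg) N₀) N₀≤N) i j k)
           (rest N (ℕₚ.≤-trans (ℕₚ.m≤n⊔m (suc deg) N₀) N₀≤N) i j k) ⟩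
    sum {N} (λ m → φ (toℕ m) * coeff ((∂y ^ₒ toℕ m) [ w ]) i j k) + sum {N} (λ m → φ (toℕ m) * coeff ((∂y ^ₒ toℕ m) p) i j k)
      ≈⟨ ∑-distrib-+ {N} _ _ ⟨
    sum {N} (λ m → φ (toℕ m) * coeff ((∂y ^ₒ toℕ m) [ w ]) i j k + φ (toℕ m) * coeff ((∂y ^ₒ toℕ m) p) i j k)
      ≈⟨ sum-cong-≋ {N} (λ m → K.trans (K.sym (K.distribˡ _ _ _)) (K.*-congˡ (split (toℕ m) i j k))) ⟩
    sum {N} (λ m → φ (toℕ m) * coeff ((∂y ^ₒ toℕ m) (w ∷ p)) i j k) ∎
    where
    deg = Monomial.yDegree w

    split : ∀ m i j k → coeff ((∂y ^ₒ m) [ w ]) i j k + coeff ((∂y ^ₒ m) p) i j k ≈ coeff ((∂y ^ₒ m) (w ∷ p)) i j k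
    split m i j k rewrite ∂y^-∷ m w p = K.sym (coeff-++ ((∂y ^ₒ m) [ w ]) ((∂y ^ₒ m) p) i j k)

    single : ∀ N → suc deg ≤ N → ∀ i j k →
      coeff (sumₚ {suc deg} (λ m → scalar (φ (toℕ m)) Pol.* (∂y ^ₒ toℕ m) [ w ])) i j k
        ≈ sum {N} (λ m → φ (toℕ m) * coeff ((∂y ^ₒ toℕ m) [ w ]) i j k)
    single N deg<N i j k = begin
      coeff (sumₚ {suc deg} (λ m → scalar (φ (toℕ m)) Pol.* (∂y ^ₒ toℕ m) [ w ])) i j k
        ≈⟨ coeff-sum (suc deg) (λ m → scalar (φ (toℕ m)) Pol.* (∂y ^ₒ toℕ m) [ w ]) i j k ⟩
      sum {suc deg} (λ m → coeff (scalar (φ (toℕ m)) Pol.* (∂y ^ₒ toℕ m) [ w ]) i j k)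
        ≈⟨ sum-cong-≋ {suc deg} (λ m → coeff-scalar* (φ (toℕ m)) ((∂y ^ₒ toℕ m) [ w ]) i j k) ⟩
      sum {suc deg} (λ m → φ (toℕ m) * coeff ((∂y ^ₒ toℕ m) [ w ]) i j k)
        ≈⟨ sum-extend deg<N (λ m → φ m * coeff ((∂y ^ₒ m) [ w ]) i j k)
             (λ m deg<m → K.trans (K.*-congˡ (∂y^-vanish m w deg<m i j k)) (K.zeroʳ _)) ⟩
      sum {N} (λ m → φ (toℕ m) * coeff ((∂y ^ₒ toℕ m) [ w ]) i j k) ∎

module Factorials {c ℓ₁ ℓ₂} (K : HeytingField c ℓ₁ ℓ₂) (char0 : CharacteristicZero K) where
  open OverField K char0
  open Polynomials K char0 using (module K)
  open RingLemmas (HeytingCommutativeRing.commutativeRing (HeytingField.heytingCommutativeRing K)) using (inverse-unique)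
  open HeytingProperties (HeytingField.heytingCommutativeRing K) using (x-0≈x)
  open SemiringMultiples K.semiring using (_×_; ×-congʳ; ×-congˡ; ×-comm-*; ×-assoc-*; ×-assocˡ)
  open CommutativeSemigroupProperties K.*-commutativeSemigroup using (xy∙z≈xz∙y)
  open SetoidReasoning K.setoid

  ×1-*-1/ : ∀ n .{{_ : NonZero n}} → (n × 1#) * 1/ n ≈ 1#
  ×1-*-1/ n = K.trans (K.*-congʳ (K.sym (x-0≈x (n × 1#)))) (proj₂ (proj₂ (#⇒invertible (char0 n))))

  ×-as-* : ∀ n x → n × x ≈ (n × 1#) * x
  ×-as-* n x = K.sym (K.trans (×-assoc-* n 1# x) (×-congʳ n (K.*-identityˡ x)))

  !×1/! : ∀ n → (n !) × 1/! n ≈ 1#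
  !×1/! n = K.trans (×-as-* (n !) (1/! n)) (×1-*-1/ (n !) {{ℕₚ._!≢0 n}})

  1/!-suc : ∀ n → suc n × 1/! (suc n) ≈ 1/! n
  1/!-suc n = inverse-unique ((n !) × 1#) (begin
    ((n !) × 1#) * (suc n × 1/! (suc n))   ≈⟨ ×-as-* (n !) _ ⟨
    (n !) × (suc n × 1/! (suc n))          ≈⟨ ×-assocˡ _ (n !) (suc n) ⟩
    ((n !) ℕ.* suc n) × 1/! (suc n)        ≈⟨ ×-congˡ (ℕₚ.*-comm (n !) (suc n)) ⟩
    (suc n !) × 1/! (suc n)                ≈⟨ !×1/! (suc n) ⟩
    1#                                     ∎)
    (K.trans (K.sym (×-as-* (n !) _)) (!×1/! n))

  1/!-*-1/ : ∀ n → 1/! n * 1/ (suc n) ≈ 1/! (suc n)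
  1/!-*-1/ n = begin
    1/! n * 1/ (suc n)                        ≈⟨ K.*-congʳ (1/!-suc n) ⟨
    (suc n × 1/! (suc n)) * 1/ (suc n)        ≈⟨ K.*-congʳ (×-as-* (suc n) _) ⟩
    (suc n × 1#) * 1/! (suc n) * 1/ (suc n)   ≈⟨ xy∙z≈xz∙y _ _ _ ⟩
    (suc n × 1#) * 1/ (suc n) * 1/! (suc n)   ≈⟨ K.*-congʳ (×1-*-1/ (suc n)) ⟩
    1# * 1/! (suc n)                          ≈⟨ K.*-identityˡ _ ⟩
    1/! (suc n)                               ∎

  weight : ℕ → ℕ → ℕ → Carrier
  weight i j k = 1/! i * 1/! i * (1/! j * 1/! k)

  weight-j : ∀ i j k → suc j × weight i (suc j) k ≈ weight i j k
  weight-j i j k = begin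
    suc j × weight i (suc j) k                              ≈⟨ ×-comm-* (suc j) _ _ ⟨
    1/! i * 1/! i * (suc j × (1/! (suc j) * 1/! k))         ≈⟨ K.*-congˡ (×-assoc-* (suc j) _ _) ⟨
    1/! i * 1/! i * ((suc j × 1/! (suc j)) * 1/! k)         ≈⟨ K.*-congˡ (K.*-congʳ (1/!-suc j)) ⟩
    weight i j k                                            ∎

  weight-k : ∀ i j k → suc k × weight i j (suc k) ≈ weight i j k
  weight-k i j k = begin
    suc k × weight i j (suc k)                              ≈⟨ ×-comm-* (suc k) _ _ ⟨
    1/! i * 1/! i * (suc k × (1/! j * 1/! (suc k)))         ≈⟨ K.*-congˡ (×-comm-* (suc k) _ _) ⟨
    1/! i * 1/! i * (1/! j * (suc k × 1/! (suc k)))         ≈⟨ K.*-congˡ (K.*-congˡ (1/!-suc k)) ⟩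
    weight i j k                                            ∎

  weight-i : ∀ i j k → weight i j k * 1/ (suc i) ≈ suc i × weight (suc i) j k
  weight-i i j k = begin
    1/! i * 1/! i * (1/! j * 1/! k) * 1/ (suc i)                   ≈⟨ xy∙z≈xz∙y _ _ _ ⟩
    1/! i * 1/! i * 1/ (suc i) * (1/! j * 1/! k)                   ≈⟨ K.*-congʳ (K.*-assoc _ _ _) ⟩
    1/! i * (1/! i * 1/ (suc i)) * (1/! j * 1/! k)                 ≈⟨ K.*-congʳ (K.*-cong (K.sym (1/!-suc i)) (1/!-*-1/ i)) ⟩
    (suc i × 1/! (suc i)) * 1/! (suc i) * (1/! j * 1/! k)          ≈⟨ K.*-congʳ (×-assoc-* (suc i) _ _) ⟩
    (suc i × (1/! (suc i) * 1/! (suc i))) * (1/! j * 1/! k)        ≈⟨ ×-assoc-* (suc i) _ _ ⟩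
    suc i × weight (suc i) j k                                     ∎

module Compositions {c ℓ} (R : CommutativeRing c ℓ) where
  open CommutativeRing R
  open PowerSeries R
  open RingLemmas seriesRing
  private
    module SR = SetoidReasoning S.setoid

  t-′ : (t ′) ≈ₛ 1ₛ
  t-′ zero    = +-identityʳ 1#
  t-′ (suc n) = ×-zero (suc (suc n))

  t-*ₛ : ∀ a → (t *ₛ a) ≈ₛ (0# ∷ₛ a)
  t-*ₛ a zero    = trans (+-identityʳ _) (zeroˡ _)
  t-*ₛ a (suc n) = trans (+-cong (zeroˡ _) (trans (*ₛ-congʳ a {t ∘ suc} {1ₛ} tail n) (*ₛ-identityˡ a n))) (+-identityˡ _)
    where
    tail : (t ∘ suc) ≈ₛ 1ₛ
    tail zero    = refl
    tail (suc n) = refl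

  ∘ₛ-t : ∀ a → (a ∘ₛ t) ≈ₛ a
  ∘ₛ-t = horner-unique {t} refl (λ a → a ∘ₛ t) (λ a → a) (λ a → constant (a 0)) (∘ₛ-horner {t} refl) split
    where
    split : ∀ a → a ≈ₛ (constant (a 0) +ₛ (t *ₛ (a ∘ suc)))
    split a zero    = sym (trans (+-congˡ (t-*ₛ (a ∘ suc) 0)) (+-identityʳ _))
    split a (suc n) = sym (trans (+-congˡ (t-*ₛ (a ∘ suc) (suc n))) (+-identityˡ _))

  module _ {f h : R⟦t⟧} (f₀≈0 : f 0 ≈ 0#) (h₀≈0 : h 0 ≈ 0#) (fh≈t : (f ∘ₛ h) ≈ₛ t) where

    ′-reversion : ((f ′ ∘ₛ h) *ₛ h ′) ≈ₛ 1ₛ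
    ′-reversion = SR.begin
      (f ′ ∘ₛ h) *ₛ h ′     SR.≈⟨ ∘ₛ-′ {h} h₀≈0 f ⟨
      (f ∘ₛ h) ′            SR.≈⟨ ′-cong {f ∘ₛ h} {t} fh≈t ⟩
      t ′                   SR.≈⟨ t-′ ⟩
      1ₛ                    SR.∎

    -- A right reversion F of h equals f, as f ∘ (h ∘ F) = (f ∘ h) ∘ F.
    ∘ₛ-cancel : ∀ {F} → F 0 ≈ 0# → (h ∘ₛ F) ≈ₛ t → ∀ a → ((a ∘ₛ F) ∘ₛ h) ≈ₛ a
    ∘ₛ-cancel {F} F₀≈0 hF≈t a = SR.begin
      (a ∘ₛ F) ∘ₛ h     SR.≈⟨ ∘ₛ-assoc {F} {h} F₀≈0 h₀≈0 a ⟩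
      a ∘ₛ (F ∘ₛ h)     SR.≈⟨ ∘ₛ-cong {a} {a} {F ∘ₛ h} {t} (λ _ → refl) Fh≈t ⟩
      a ∘ₛ t            SR.≈⟨ ∘ₛ-t a ⟩
      a                 SR.∎
      where
      F≈f : F ≈ₛ f
      F≈f = SR.begin
        F                 SR.≈⟨ t-∘ₛ {F} F₀≈0 ⟨
        t ∘ₛ F            SR.≈⟨ ∘ₛ-congʳ F {f ∘ₛ h} {t} fh≈t ⟨
        (f ∘ₛ h) ∘ₛ F     SR.≈⟨ ∘ₛ-assoc {h} {F} h₀≈0 F₀≈0 f ⟩
        f ∘ₛ (h ∘ₛ F)     SR.≈⟨ ∘ₛ-cong {f} {f} {h ∘ₛ F} {t} (λ _ → refl) hF≈t ⟩
        f ∘ₛ t            SR.≈⟨ ∘ₛ-t f ⟩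
        f                 SR.∎

      Fh≈t : (F ∘ₛ h) ≈ₛ t
      Fh≈t = SR.begin
        F ∘ₛ h     SR.≈⟨ ∘ₛ-congʳ h {F} {f} F≈f ⟩
        f ∘ₛ h     SR.≈⟨ fh≈t ⟩
        t          SR.∎

  ∘ₛ-reciprocal : ∀ {u} → u 0 ≈ 0# → ∀ a b → (a *ₛ b) ≈ₛ 1ₛ → ((a ∘ₛ u) *ₛ (b ∘ₛ u)) ≈ₛ 1ₛ
  ∘ₛ-reciprocal {u} u₀≈0 a b ab≈1 = SR.begin
    (a ∘ₛ u) *ₛ (b ∘ₛ u)     SR.≈⟨ ∘ₛ-*ₛ {u} u₀≈0 a b ⟨
    (a *ₛ b) ∘ₛ u            SR.≈⟨ ∘ₛ-congʳ u {a *ₛ b} {1ₛ} ab≈1 ⟩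
    1ₛ ∘ₛ u                  SR.≈⟨ 1ₛ-∘ₛ {u} u₀≈0 ⟩
    1ₛ                       SR.∎

  logarithmic-derivative : ∀ {u} → u 0 ≈ 0# → ∀ g g⁻¹ a → (g *ₛ g⁻¹) ≈ₛ 1ₛ → ((g ∘ₛ u) *ₛ a) ≈ₛ 1ₛ →
    (((g ′ *ₛ g⁻¹) ∘ₛ u) *ₛ (u ′ *ₛ a)) ≈ₛ (-ₛ (a ′))
  logarithmic-derivative {u} u₀≈0 g g⁻¹ a gg⁻¹≈1 Ga≈1 = SR.begin
    ((g ′ *ₛ g⁻¹) ∘ₛ u) *ₛ (u ′ *ₛ a)
      SR.≈⟨ *ₛ-congʳ (u ′ *ₛ a) {(g ′ *ₛ g⁻¹) ∘ₛ u} {γ *ₛ (g⁻¹ ∘ₛ u)} (∘ₛ-*ₛ {u} u₀≈0 (g ′) g⁻¹) ⟩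
    (γ *ₛ (g⁻¹ ∘ₛ u)) *ₛ (u ′ *ₛ a)
      SR.≈⟨ *ₛ-congʳ (u ′ *ₛ a) {γ *ₛ (g⁻¹ ∘ₛ u)} {γ *ₛ a} (*ₛ-congˡ γ {g⁻¹ ∘ₛ u} {a}
              (inverse-unique G {g⁻¹ ∘ₛ u} {a} (∘ₛ-reciprocal {u} u₀≈0 g g⁻¹ gg⁻¹≈1) Ga≈1)) ⟩
    (γ *ₛ a) *ₛ (u ′ *ₛ a)
      SR.≈⟨ reciprocal-derivative G a (a ′) γ (u ′) Ga≈1 product-rule ⟩
    -ₛ (a ′) SR.∎
    where
    G γ : R⟦t⟧
    G = g ∘ₛ u
    γ = g ′ ∘ₛ u

    product-rule : (((γ *ₛ u ′) *ₛ a) +ₛ (G *ₛ a ′)) ≈ₛ 0ₛ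
    product-rule = SR.begin
      ((γ *ₛ u ′) *ₛ a) +ₛ (G *ₛ a ′)
        SR.≈⟨ S.+-congʳ {G *ₛ a ′} {G ′ *ₛ a} {(γ *ₛ u ′) *ₛ a} (*ₛ-congʳ a {G ′} {γ *ₛ u ′} (∘ₛ-′ {u} u₀≈0 g)) ⟨
      (G ′ *ₛ a) +ₛ (G *ₛ a ′)   SR.≈⟨ ′-*ₛ G a ⟨
      (G *ₛ a) ′                 SR.≈⟨ ′-cong {G *ₛ a} {1ₛ} Ga≈1 ⟩
      1ₛ ′                       SR.≈⟨ (λ n → ×-zero (suc n)) ⟩
      0ₛ                         SR.∎

module Representations {c ℓ₁ ℓ₂} (K : HeytingField c ℓ₁ ℓ₂) (char0 : CharacteristicZero K) where
  open OverField K char0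
  open InvertibleSeries using (unit) renaming (series to ⟦_⟧)
  open DeltaSeries using (root; slope) renaming (series to ⟪_⟫)

  module Action (H : K⟦t⟧) (H₀≈0 : H 0 ≈ 0#) (r′ : ℕ) where
    open Polynomials K char0 using (module K; module K³; module P₀; coeff-++; coeff-*)
    open Operators K char0
    open Factorials K char0
    open SemiringMultiples K.semiring using (_×_; ×-congʳ; ×-comm-*; ×-assoc-*; ×-homo-+; ×-assocˡ)
    open Summation K.semiring using (sum; sum-cong-≋; *-distribˡ-sum)
    open CommutativeSemigroupProperties K.*-commutativeSemigroup using (x∙yz≈y∙xz; xy∙z≈xz∙y)
    open RawSemiringDefs Pol.rawSemiring using () renaming (_×_ to _×ₚ_)
    open P₀ using (powerDerivative; *ₛ-congˡ; *ₛ-congʳ; *ₛ-assoc; ∘ₛ-*ₛ-sum)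
    private
      module SE = Exponentiation P₀.S.commutativeSemiring
    open SetoidReasoning K.setoid

    r : ℕ
    r = suc r′

    degree : ℕ → ℕ → ℕ → ℕ
    degree i j k = j ℕ.+ 2 ℕ.* i ℕ.+ r ℕ.* k

    -- p is the n-th coefficient of C(t) C₀(-x H(t)²) exp(y H(t) + z H(t)ʳ).
    Represents : ℕ → K⟦t⟧ → K[x,y,z] → Set ℓ₁
    Represents n C p = ∀ i j k → coeff p i j k ≈ weight i j k * (C *ₛ (H ^ₛ degree i j k)) n

    Represents-cong : ∀ {n C D p} → C ≈ₛ D → Represents n C p → Represents n D p
    Represents-cong {n} {C} {D} C≈D rep i j k =
      K.trans (rep i j k) (K.*-congˡ (*ₛ-congʳ (H ^ₛ degree i j k) C≈D n))

    represents-∂y^ : ∀ {n C p} → Represents n C p → ∀ m i j k →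
      coeff ((∂y ^ₒ m) p) i j k ≈ weight i j k * (C *ₛ (H ^ₛ (m ℕ.+ degree i j k))) n
    represents-∂y^ rep zero    i j k = rep i j k
    represents-∂y^ {n} {C} {p} rep (suc m) i j k = begin
      coeff (∂y ((∂y ^ₒ m) p)) i j k
        ≈⟨ coeff-∂y ((∂y ^ₒ m) p) i j k ⟩
      suc j × coeff ((∂y ^ₒ m) p) i (suc j) k
        ≈⟨ ×-congʳ (suc j) (represents-∂y^ {n} {C} {p} rep m i (suc j) k) ⟩
      suc j × (weight i (suc j) k * (C *ₛ (H ^ₛ (m ℕ.+ suc (degree i j k)))) n)
        ≈⟨ ×-assoc-* (suc j) _ _ ⟨
      (suc j × weight i (suc j) k) * (C *ₛ (H ^ₛ (m ℕ.+ suc (degree i j k)))) n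
        ≈⟨ K.*-congʳ (weight-j i j k) ⟩
      weight i j k * (C *ₛ (H ^ₛ (m ℕ.+ suc (degree i j k)))) n
        ≡⟨ ≡.cong (λ e → weight i j k * (C *ₛ (H ^ₛ e)) n) (ℕₚ.+-suc m (degree i j k)) ⟩
      weight i j k * (C *ₛ (H ^ₛ suc (m ℕ.+ degree i j k))) n ∎

    represents-[∂y] : ∀ φ {n C p} → Represents n C p → Represents n ((φ ∘ₛ H) *ₛ C) ((φ [∂y]) p)
    represents-[∂y] φ {n} {C} {p} rep i j k = begin
      coeff ((φ [∂y]) p) i j k
        ≈⟨ proj₂ (coeff-[∂y] φ p) N (ℕₚ.m≤m⊔n _ _) i j k ⟩
      sum {N} (λ m → φ (toℕ m) * coeff ((∂y ^ₒ toℕ m) p) i j k)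
        ≈⟨ sum-cong-≋ {N} (λ m → summand (toℕ m)) ⟩
      sum {N} (λ m → w * (φ (toℕ m) * ((H ^ₛ toℕ m) *ₛ (C *ₛ Hᵉ)) n))
        ≈⟨ *-distribˡ-sum {N} w (λ m → φ (toℕ m) * ((H ^ₛ toℕ m) *ₛ (C *ₛ Hᵉ)) n) ⟨
      w * sum {N} (λ m → φ (toℕ m) * ((H ^ₛ toℕ m) *ₛ (C *ₛ Hᵉ)) n)
        ≈⟨ K.*-congˡ (∘ₛ-*ₛ-sum {H} H₀≈0 φ (C *ₛ Hᵉ) N n (ℕₚ.m≤n⊔m _ (suc n))) ⟨
      w * ((φ ∘ₛ H) *ₛ (C *ₛ Hᵉ)) n
        ≈⟨ K.*-congˡ (*ₛ-assoc (φ ∘ₛ H) C Hᵉ n) ⟨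
      w * (((φ ∘ₛ H) *ₛ C) *ₛ Hᵉ) n ∎
      where
      N  = proj₁ (coeff-[∂y] φ p) ⊔ suc n
      w  = weight i j k
      e  = degree i j k
      Hᵉ = H ^ₛ e

      rearrange : ∀ m → (C *ₛ (H ^ₛ (m ℕ.+ e))) ≈ₛ ((H ^ₛ m) *ₛ (C *ₛ Hᵉ))
      rearrange m l = K.trans (*ₛ-congˡ C (SE.^-homo-* H m e) l) (x∙yz≈y∙xz′ C (H ^ₛ m) Hᵉ l)
        where open CommutativeSemigroupProperties P₀.S.*-commutativeSemigroup using () renaming (x∙yz≈y∙xz to x∙yz≈y∙xz′)

      summand : ∀ m → φ m * coeff ((∂y ^ₒ m) p) i j k ≈ w * (φ m * ((H ^ₛ m) *ₛ (C *ₛ Hᵉ)) n)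
      summand m = begin
        φ m * coeff ((∂y ^ₒ m) p) i j k                   ≈⟨ K.*-congˡ (represents-∂y^ {n} {C} {p} rep m i j k) ⟩
        φ m * (w * (C *ₛ (H ^ₛ (m ℕ.+ e))) n)             ≈⟨ x∙yz≈y∙xz (φ m) w _ ⟩
        w * (φ m * (C *ₛ (H ^ₛ (m ℕ.+ e))) n)             ≈⟨ K.*-congˡ (K.*-congˡ (rearrange m n)) ⟩
        w * (φ m * ((H ^ₛ m) *ₛ (C *ₛ Hᵉ)) n)             ∎

    M : Operator
    M = y · ⊕ 2 ⊗ (Dx⁻¹ ∘ ∂y) ⊕ r ⊗ (z · ∘ ∂y ^ₒ r′)

    module _ {n C p} (rep : Represents n C p) (i j k : ℕ) where
      private
        w : Carrier
        w = weight i j k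

        E : Carrier
        E = w * (C *ₛ (H ^ₛ ℕ.pred (degree i j k))) n

      coeff-y· : coeff (y Pol.* p) i j k ≈ j × E
      coeff-y· = K.trans (coeff-* y p i j k) (by-j j)
        where
        by-j : ∀ j → (coeff y K³.* coeff p) i j k ≈ j × (weight i j k * (C *ₛ (H ^ₛ ℕ.pred (degree i j k))) n)
        by-j zero     = y-*³-zero (coeff p) i k
        by-j (suc j)  = begin
          (coeff y K³.* coeff p) i (suc j) k                          ≈⟨ y-*³-suc (coeff p) i j k ⟩
          coeff p i j k                                               ≈⟨ rep i j k ⟩
          weight i j k * (C *ₛ (H ^ₛ degree i j k)) n                 ≈⟨ K.*-congʳ (weight-j i j k) ⟨
          (suc j × weight i (suc j) k) * (C *ₛ (H ^ₛ degree i j k)) n ≈⟨ ×-assoc-* (suc j) _ _ ⟩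
          suc j × (weight i (suc j) k * (C *ₛ (H ^ₛ degree i j k)) n) ∎

      coeff-Dx⁻¹∂y : coeff (Dx⁻¹ (∂y p)) i j k ≈ i × E
      coeff-Dx⁻¹∂y = by-i i
        where
        by-i : ∀ i → coeff (Dx⁻¹ (∂y p)) i j k ≈ i × (weight i j k * (C *ₛ (H ^ₛ ℕ.pred (degree i j k))) n)
        by-i zero    = coeff-Dx⁻¹-zero (∂y p) j k
        by-i (suc i) = begin
          coeff (Dx⁻¹ (∂y p)) (suc i) j k                                       ≈⟨ coeff-Dx⁻¹-suc (∂y p) i j k ⟩
          coeff (∂y p) i j k * 1/ (suc i)                                       ≈⟨ K.*-congʳ (represents-∂y^ {n} {C} {p} rep 1 i j k) ⟩
          weight i j k * (C *ₛ (H ^ₛ suc (degree i j k))) n * 1/ (suc i)        ≈⟨ xy∙z≈xz∙y _ _ _ ⟩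
          weight i j k * 1/ (suc i) * (C *ₛ (H ^ₛ suc (degree i j k))) n        ≈⟨ K.*-congʳ (weight-i i j k) ⟩
          (suc i × weight (suc i) j k) * (C *ₛ (H ^ₛ suc (degree i j k))) n     ≈⟨ ×-assoc-* (suc i) _ _ ⟩
          suc i × (weight (suc i) j k * (C *ₛ (H ^ₛ suc (degree i j k))) n)     ≡⟨ ≡.cong (λ e → suc i × (weight (suc i) j k * (C *ₛ (H ^ₛ e)) n)) (≡.cong ℕ.pred (degree-suc i j (r ℕ.* k))) ⟩
          suc i × (weight (suc i) j k * (C *ₛ (H ^ₛ ℕ.pred (degree (suc i) j k))) n) ∎
          where
          degree-suc : ∀ i j l → suc (suc (j ℕ.+ 2 ℕ.* i ℕ.+ l)) ≡ j ℕ.+ 2 ℕ.* suc i ℕ.+ l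
          degree-suc = solve-∀

      coeff-z·∂y^ : coeff (z Pol.* (∂y ^ₒ r′) p) i j k ≈ k × E
      coeff-z·∂y^ = K.trans (coeff-* z ((∂y ^ₒ r′) p) i j k) (by-k k)
        where
        q : K[x,y,z]
        q = (∂y ^ₒ r′) p

        by-k : ∀ k → (coeff z K³.* coeff q) i j k ≈ k × (weight i j k * (C *ₛ (H ^ₛ ℕ.pred (degree i j k))) n)
        by-k zero    = z-*³-zero (coeff q) i j
        by-k (suc k) = begin
          (coeff z K³.* coeff q) i j (suc k)                               ≈⟨ z-*³-suc (coeff q) i j k ⟩
          coeff q i j k                                                    ≈⟨ represents-∂y^ {n} {C} {p} rep r′ i j k ⟩
          weight i j k * (C *ₛ (H ^ₛ (r′ ℕ.+ degree i j k))) n             ≈⟨ K.*-congʳ (weight-k i j k) ⟨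
          (suc k × weight i j (suc k)) * (C *ₛ (H ^ₛ (r′ ℕ.+ degree i j k))) n
                                                                           ≈⟨ ×-assoc-* (suc k) _ _ ⟩
          suc k × (weight i j (suc k) * (C *ₛ (H ^ₛ (r′ ℕ.+ degree i j k))) n)
            ≡⟨ ≡.cong (λ e → suc k × (weight i j (suc k) * (C *ₛ (H ^ₛ e)) n)) (≡.cong ℕ.pred (degree-suc r′ (j ℕ.+ 2 ℕ.* i) k)) ⟩
          suc k × (weight i j (suc k) * (C *ₛ (H ^ₛ ℕ.pred (degree i j (suc k)))) n) ∎
          where
          degree-suc : ∀ r′ l k → suc (r′ ℕ.+ (l ℕ.+ suc r′ ℕ.* k)) ≡ l ℕ.+ suc r′ ℕ.* suc k
          degree-suc = solve-∀

      coeff-M : coeff (M p) i j k ≈ w * (C *ₛ powerDerivative H (degree i j k)) n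
      coeff-M = begin
        coeff (M p) i j k
          ≈⟨ coeff-++ ((y · ⊕ 2 ⊗ (Dx⁻¹ ∘ ∂y)) p) _ i j k ⟩
        coeff ((y · ⊕ 2 ⊗ (Dx⁻¹ ∘ ∂y)) p) i j k + coeff (r ×ₚ (z Pol.* (∂y ^ₒ r′) p)) i j k
          ≈⟨ K.+-cong (coeff-++ (y Pol.* p) _ i j k) (coeff-× r (z Pol.* (∂y ^ₒ r′) p) i j k) ⟩
        coeff (y Pol.* p) i j k + coeff (2 ×ₚ Dx⁻¹ (∂y p)) i j k + r × coeff (z Pol.* (∂y ^ₒ r′) p) i j k
          ≈⟨ K.+-cong (K.+-cong coeff-y· (K.trans (coeff-× 2 (Dx⁻¹ (∂y p)) i j k) (×-congʳ 2 coeff-Dx⁻¹∂y))) (×-congʳ r coeff-z·∂y^) ⟩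
        j × E + 2 × (i × E) + r × (k × E)
          ≈⟨ K.+-cong (K.+-congˡ (×-assocˡ E 2 i)) (×-assocˡ E r k) ⟩
        j × E + (2 ℕ.* i) × E + (r ℕ.* k) × E
          ≈⟨ K.+-congʳ (×-homo-+ E j (2 ℕ.* i)) ⟨
        (j ℕ.+ 2 ℕ.* i) × E + (r ℕ.* k) × E
          ≈⟨ ×-homo-+ E (j ℕ.+ 2 ℕ.* i) (r ℕ.* k) ⟨
        e × (w * (C *ₛ (H ^ₛ ℕ.pred e)) n)
          ≈⟨ ×-comm-* e w _ ⟨
        w * (e × (C *ₛ (H ^ₛ ℕ.pred e)) n)
          ≈⟨ K.*-congˡ (P₀.×-apply e (C *ₛ (H ^ₛ ℕ.pred e)) n) ⟨
        w * (e SM.× (C *ₛ (H ^ₛ ℕ.pred e))) n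
          ≈⟨ K.*-congˡ (SM.×-comm-* e C (H ^ₛ ℕ.pred e) n) ⟨
        w * (C *ₛ (e SM.× (H ^ₛ ℕ.pred e))) n
          ≈⟨ K.*-congˡ (*ₛ-congˡ C (P₀.×-apply e (H ^ₛ ℕ.pred e)) n) ⟩
        w * (C *ₛ powerDerivative H e) n ∎
        where
        e = degree i j k
        module SM = SemiringMultiples P₀.S.semiring

  module GeneratingFunction (h : K⟦t⟧) (h₀≈0 : h 0 ≈ 0#) (r′ : ℕ) where
    open Polynomials K char0
    open Operators K char0
    open Factorials K char0
    open SemiringMultiples K.semiring using (_×_; ×-comm-*; ×-assoc-*; ×-homo-1; ×-homo-+; ×-assocˡ)
    open RingProperties K.ring using (-‿distribˡ-*; -‿distribʳ-*; -‿involutive; -1*x≈-x; -0#≈0#)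
    open CommutativeSemigroupProperties K.*-commutativeSemigroup using (xy∙z≈xz∙y; interchange)
    open RawSemiringDefs Pol.rawSemiring using () renaming (_×_ to _×ₚ_; sum to sumₚ)
    open RawSemiringDefs (RawRing.rawSemiring K.rawRing) using (_^_)
    open P₀ using (_∙_; *ₛ-congˡ; *ₛ-congʳ; *ₛ-assoc; *ₛ-∙)
    private
      module SE = Exponentiation P₀.S.commutativeSemiring
      module G = Series polynomialRing
      module Ω = PowerSeries P₂.seriesRing
      module S³ = Summation K³.semiring
      module ΩR = SetoidReasoning Ω.S.setoid
      module K³R = SetoidReasoning K³.setoid
      r : ℕ
      r = suc r′
    open SetoidReasoning K.setoid

    image : G.Carrier → Ω.R⟦t⟧
    image a n = coeff (a n)

    image-* : ∀ a b → image (a G.* b) Ω.≈ₛ (image a Ω.*ₛ image b)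
    image-* a b zero    i j k = K.trans (coeff-++ (a 0 Pol.* b 0) [] i j k) (K.+-congʳ (coeff-* (a 0) (b 0) i j k))
    image-* a b (suc n) i j k = K.trans (coeff-++ (a 0 Pol.* b (suc n)) (((a ∘ suc) G.* b) n) i j k)
      (K.+-cong (coeff-* (a 0) (b (suc n)) i j k) (image-* (a ∘ suc) b n i j k))

    coeff-1ₚ : coeff 1ₚ K³.≈ K³.1#
    coeff-1ₚ i j k = K.trans (coeff-[ 1# x^ 0 y^ 0 z^ 0 ] i j k) (term-1 i j k)
      where
      term-1 : ∀ i j k → term (1# x^ 0 y^ 0 z^ 0) i j k ≈ K³.1# i j k
      term-1 zero    zero    zero    = K.refl
      term-1 zero    zero    (suc k) = K.refl
      term-1 zero    (suc j) k       = K.refl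
      term-1 (suc i) j       k       = K.refl

    image-^ : ∀ a m → image (a G.^ m) Ω.≈ₛ (image a Ω.^ₛ m)
    image-^ a zero    zero    = coeff-1ₚ
    image-^ a zero    (suc n) = λ i j k → K.refl
    image-^ a (suc m) = ΩR.begin
      image (a G.* (a G.^ m))           ΩR.≈⟨ image-* a (a G.^ m) ⟩
      image a Ω.*ₛ image (a G.^ m)      ΩR.≈⟨ Ω.*ₛ-congˡ (image a) (image-^ a m) ⟩
      image a Ω.^ₛ suc m                ΩR.∎

    coeff-sum³ : ∀ n (v : Fin n → K[x,y,z]) → coeff (sumₚ v) K³.≈ S³.sum (λ m → coeff (v m))
    coeff-sum³ zero    v i j k = K.refl
    coeff-sum³ (suc n) v i j k =
      K.trans (coeff-++ (v Fin.zero) _ i j k) (K.+-congˡ (coeff-sum³ n (v ∘ Fin.suc) i j k))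

    image-∘ₛ : ∀ a u → image (a G.∘ₛ u) Ω.≈ₛ (image a Ω.∘ₛ image u)
    image-∘ₛ a u n = K³R.begin
      coeff ((a G.∘ₛ u) n)
        K³R.≈⟨ coeff-sum³ (suc n) (λ m → a (toℕ m) Pol.* (u G.^ toℕ m) n) ⟩
      S³.sum {suc n} (λ m → coeff (a (toℕ m) Pol.* (u G.^ toℕ m) n))
        K³R.≈⟨ S³.sum-cong-≋ {suc n} (λ m → K³.trans {coeff (a (toℕ m) Pol.* (u G.^ toℕ m) n)}
                 (coeff-* (a (toℕ m)) ((u G.^ toℕ m) n))
                 (P₂.*ₛ-congˡ (coeff (a (toℕ m))) (image-^ u (toℕ m) n))) ⟩
      (image a Ω.∘ₛ image u) n K³R.∎

    image-constant : ∀ p → image (G.constant p) Ω.≈ₛ Ω.constant (coeff p)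
    image-constant p zero    i j k = K.refl
    image-constant p (suc n) i j k = K.refl

    image-neg : ∀ a → image (G.- a) Ω.≈ₛ (Ω.-ₛ image a)
    image-neg a n = coeff-neg (a n)

    image-+ : ∀ a b → image (a G.+ b) Ω.≈ₛ (image a Ω.+ₛ image b)
    image-+ a b n = coeff-++ (a n) (b n)

    image-constant-* : ∀ p a → image (G.constant p G.* a) Ω.≈ₛ (Ω.constant (coeff p) Ω.*ₛ image a)
    image-constant-* p a = ΩR.begin
      image (G.constant p G.* a)                   ΩR.≈⟨ image-* (G.constant p) a ⟩
      image (G.constant p) Ω.*ₛ image a            ΩR.≈⟨ Ω.*ₛ-congʳ (image a) {image (G.constant p)} {Ω.constant (coeff p)} (image-constant p) ⟩
      Ω.constant (coeff p) Ω.*ₛ image a            ΩR.∎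

    image-constant-*^ : ∀ p a m → image (G.constant p G.* a G.^ m) Ω.≈ₛ (Ω.constant (coeff p) Ω.*ₛ (image a Ω.^ₛ m))
    image-constant-*^ p a m = ΩR.begin
      image (G.constant p G.* a G.^ m)                   ΩR.≈⟨ image-constant-* p (a G.^ m) ⟩
      Ω.constant (coeff p) Ω.*ₛ image (a G.^ m)          ΩR.≈⟨ Ω.*ₛ-congˡ (Ω.constant (coeff p)) {image (a G.^ m)} {image a Ω.^ₛ m} (image-^ a m) ⟩
      Ω.constant (coeff p) Ω.*ₛ (image a Ω.^ₛ m)         ΩR.∎

    C₀-argument exp-argument : Ω.R⟦t⟧ → Ω.R⟦t⟧
    C₀-argument  η = Ω.-ₛ (Ω.constant (coeff x) Ω.*ₛ (η Ω.^ₛ 2))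
    exp-argument η = (Ω.constant (coeff y) Ω.*ₛ η) Ω.+ₛ (Ω.constant (coeff z) Ω.*ₛ (η Ω.^ₛ r))

    image-C₀-argument : ∀ a → image (G.- (G.constant x G.* a G.^ 2)) Ω.≈ₛ C₀-argument (image a)
    image-C₀-argument a = ΩR.begin
      image (G.- (G.constant x G.* a G.^ 2))           ΩR.≈⟨ image-neg (G.constant x G.* a G.^ 2) ⟩
      Ω.-ₛ image (G.constant x G.* a G.^ 2)            ΩR.≈⟨ Ω.S.-‿cong {image (G.constant x G.* a G.^ 2)} {Ω.constant (coeff x) Ω.*ₛ (image a Ω.^ₛ 2)} (image-constant-*^ x a 2) ⟩
      C₀-argument (image a)                            ΩR.∎

    image-exp-argument : ∀ a → image (G.constant y G.* a G.+ G.constant z G.* a G.^ r) Ω.≈ₛ exp-argument (image a)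
    image-exp-argument a = ΩR.begin
      image (G.constant y G.* a G.+ G.constant z G.* a G.^ r)
        ΩR.≈⟨ image-+ (G.constant y G.* a) (G.constant z G.* a G.^ r) ⟩
      image (G.constant y G.* a) Ω.+ₛ image (G.constant z G.* a G.^ r)
        ΩR.≈⟨ Ω.S.+-cong {image (G.constant y G.* a)} {Ω.constant (coeff y) Ω.*ₛ image a}
                {image (G.constant z G.* a G.^ r)} {Ω.constant (coeff z) Ω.*ₛ (image a Ω.^ₛ r)}
                (image-constant-* y a) (image-constant-*^ z a r) ⟩
      exp-argument (image a) ΩR.∎

    image-product : ∀ (a b e h : G.Carrier) {α β ε η : Ω.R⟦t⟧} →
      image a Ω.≈ₛ α → image b Ω.≈ₛ β → image e Ω.≈ₛ ε → image h Ω.≈ₛ η →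
      image (a G.* (b G.∘ₛ (G.- (G.constant x G.* h G.^ 2))) G.* (e G.∘ₛ (G.constant y G.* h G.+ G.constant z G.* h G.^ r))) Ω.≈ₛ
      (α Ω.*ₛ ((β Ω.∘ₛ C₀-argument η) Ω.*ₛ (ε Ω.∘ₛ exp-argument η)))
    image-product a b e h {α} {β} {ε} {η} a≈α b≈β e≈ε h≈η = ΩR.begin
      image (a G.* P G.* E)                              ΩR.≈⟨ image-* (a G.* P) E ⟩
      image (a G.* P) Ω.*ₛ image E                       ΩR.≈⟨ Ω.*ₛ-congʳ (image E) {image (a G.* P)} {image a Ω.*ₛ image P} (image-* a P) ⟩
      (image a Ω.*ₛ image P) Ω.*ₛ image E                ΩR.≈⟨ Ω.*ₛ-assoc (image a) (image P) (image E) ⟩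
      image a Ω.*ₛ (image P Ω.*ₛ image E)
        ΩR.≈⟨ Ω.*ₛ-cong {image a} {α} {image P Ω.*ₛ image E} {P′ Ω.*ₛ E′} a≈α (Ω.*ₛ-cong {image P} {P′} {image E} {E′}
               (compose b p β (C₀-argument η) b≈β (Ω.S.trans {image p} {C₀-argument (image h)} {C₀-argument η} (image-C₀-argument h) C₀-argument-cong))
               (compose e q ε (exp-argument η) e≈ε (Ω.S.trans {image q} {exp-argument (image h)} {exp-argument η} (image-exp-argument h) exp-argument-cong))) ⟩
      α Ω.*ₛ (P′ Ω.*ₛ E′) ΩR.∎
      where
      module ΩE = Exponentiation Ω.S.commutativeSemiring
      compose : ∀ a u α w → image a Ω.≈ₛ α → image u Ω.≈ₛ w → image (a G.∘ₛ u) Ω.≈ₛ (α Ω.∘ₛ w)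
      compose a u α w a≈α u≈w = ΩR.begin
        image (a G.∘ₛ u)        ΩR.≈⟨ image-∘ₛ a u ⟩
        image a Ω.∘ₛ image u    ΩR.≈⟨ Ω.∘ₛ-cong {image a} {α} {image u} {w} a≈α u≈w ⟩
        α Ω.∘ₛ w                ΩR.∎
      p q P E : G.Carrier
      p = G.- (G.constant x G.* h G.^ 2)
      q = G.constant y G.* h G.+ G.constant z G.* h G.^ r
      P = b G.∘ₛ p
      E = e G.∘ₛ q
      P′ E′ : Ω.R⟦t⟧
      P′ = β Ω.∘ₛ C₀-argument η
      E′ = ε Ω.∘ₛ exp-argument η
      C₀-argument-cong : C₀-argument (image h) Ω.≈ₛ C₀-argument η
      C₀-argument-cong = Ω.S.-‿cong {Ω.constant (coeff x) Ω.*ₛ (image h Ω.^ₛ 2)} {Ω.constant (coeff x) Ω.*ₛ (η Ω.^ₛ 2)}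
        (Ω.*ₛ-congˡ (Ω.constant (coeff x)) {image h Ω.^ₛ 2} {η Ω.^ₛ 2} (ΩE.^-congˡ 2 {image h} {η} h≈η))
      exp-argument-cong : exp-argument (image h) Ω.≈ₛ exp-argument η
      exp-argument-cong = Ω.S.+-cong {Ω.constant (coeff y) Ω.*ₛ image h} {Ω.constant (coeff y) Ω.*ₛ η}
        {Ω.constant (coeff z) Ω.*ₛ (image h Ω.^ₛ r)} {Ω.constant (coeff z) Ω.*ₛ (η Ω.^ₛ r)}
        (Ω.*ₛ-congˡ (Ω.constant (coeff y)) {image h} {η} h≈η)
        (Ω.*ₛ-congˡ (Ω.constant (coeff z)) {image h Ω.^ₛ r} {η Ω.^ₛ r} (ΩE.^-congˡ r {image h} {η} h≈η))

    embed : K⟦t⟧ → Ω.R⟦t⟧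
    embed a = image (lift a)

    π : ℕ → ℕ → ℕ → Ω.R⟦t⟧ → K⟦t⟧
    π i j k ω n = ω n i j k

    coeff-scalar-*³ : ∀ a Q i j k → (coeff (scalar a) K³.* Q) i j k ≈ a * Q i j k
    coeff-scalar-*³ a Q i j k =
      K.trans (P₂.*ₛ-congʳ Q {coeff (scalar a)} {term (a x^ 0 y^ 0 z^ 0)} coeff-[ a x^ 0 y^ 0 z^ 0 ] i j k) (scalar-*³ a Q i j k)

    π-embed : ∀ a ω i j k → π i j k (embed a Ω.*ₛ ω) ≈ₛ (a *ₛ π i j k ω)
    π-embed a ω i j k zero    = K.+-congʳ (coeff-scalar-*³ (a 0) (ω 0) i j k)
    π-embed a ω i j k (suc n) = K.+-cong (coeff-scalar-*³ (a 0) (ω (suc n)) i j k) (π-embed (a ∘ suc) ω i j k n)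

    π-embed-^ : ∀ a m ω i j k → π i j k ((embed a Ω.^ₛ m) Ω.*ₛ ω) ≈ₛ ((a ^ₛ m) *ₛ π i j k ω)
    π-embed-^ a zero    ω i j k n =
      K.trans (Ω.*ₛ-identityˡ ω n i j k) (K.sym (P₀.*ₛ-identityˡ (π i j k ω) n))
    π-embed-^ a (suc m) ω i j k n = begin
      ((embed a Ω.*ₛ aᵐ) Ω.*ₛ ω) n i j k              ≈⟨ Ω.*ₛ-assoc (embed a) aᵐ ω n i j k ⟩
      (embed a Ω.*ₛ (aᵐ Ω.*ₛ ω)) n i j k              ≈⟨ π-embed a (aᵐ Ω.*ₛ ω) i j k n ⟩
      (a *ₛ π i j k (aᵐ Ω.*ₛ ω)) n                    ≈⟨ *ₛ-congˡ a {π i j k (aᵐ Ω.*ₛ ω)} {(a ^ₛ m) *ₛ π i j k ω} (π-embed-^ a m ω i j k) n ⟩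
      (a *ₛ ((a ^ₛ m) *ₛ π i j k ω)) n                ≈⟨ *ₛ-assoc a (a ^ₛ m) (π i j k ω) n ⟨
      ((a ^ₛ suc m) *ₛ π i j k ω) n                   ∎
      where aᵐ = embed a Ω.^ₛ m

    π-v : ∀ ω i j k n → π i j k (C₀-argument (embed h) Ω.*ₛ ω) n ≈ - (coeff x K³.* ((embed h Ω.^ₛ 2) Ω.*ₛ ω) n) i j k
    π-v ω i j k n = begin
      π i j k (C₀-argument (embed h) Ω.*ₛ ω) n
        ≈⟨ ΩP.-‿distribˡ-* (Ω.constant (coeff x) Ω.*ₛ (embed h Ω.^ₛ 2)) ω n i j k ⟨
      - ((Ω.constant (coeff x) Ω.*ₛ (embed h Ω.^ₛ 2)) Ω.*ₛ ω) n i j k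
        ≈⟨ K.-‿cong (Ω.*ₛ-assoc (Ω.constant (coeff x)) (embed h Ω.^ₛ 2) ω n i j k) ⟩
      - (Ω.constant (coeff x) Ω.*ₛ ((embed h Ω.^ₛ 2) Ω.*ₛ ω)) n i j k
        ≈⟨ K.-‿cong (Ω.constant-*ₛ (coeff x) ((embed h Ω.^ₛ 2) Ω.*ₛ ω) n i j k) ⟩
      - (coeff x K³.* ((embed h Ω.^ₛ 2) Ω.*ₛ ω) n) i j k ∎
      where module ΩP = RingProperties Ω.S.ring

    π-u : ∀ ω i j k n → π i j k (exp-argument (embed h) Ω.*ₛ ω) n
      ≈ (coeff y K³.* (embed h Ω.*ₛ ω) n) i j k + (coeff z K³.* ((embed h Ω.^ₛ r) Ω.*ₛ ω) n) i j k
    π-u ω i j k n = begin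
      π i j k (exp-argument (embed h) Ω.*ₛ ω) n
        ≈⟨ Ω.*ₛ-distribʳ ω (Ω.constant (coeff y) Ω.*ₛ embed h) (Ω.constant (coeff z) Ω.*ₛ (embed h Ω.^ₛ r)) n i j k ⟩
      π i j k ((Ω.constant (coeff y) Ω.*ₛ embed h) Ω.*ₛ ω) n + π i j k ((Ω.constant (coeff z) Ω.*ₛ (embed h Ω.^ₛ r)) Ω.*ₛ ω) n
        ≈⟨ K.+-cong (Ω.*ₛ-assoc (Ω.constant (coeff y)) (embed h) ω n i j k)
                    (Ω.*ₛ-assoc (Ω.constant (coeff z)) (embed h Ω.^ₛ r) ω n i j k) ⟩
      π i j k (Ω.constant (coeff y) Ω.*ₛ (embed h Ω.*ₛ ω)) n + π i j k (Ω.constant (coeff z) Ω.*ₛ ((embed h Ω.^ₛ r) Ω.*ₛ ω)) n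
        ≈⟨ K.+-cong (Ω.constant-*ₛ (coeff y) (embed h Ω.*ₛ ω) n i j k)
                    (Ω.constant-*ₛ (coeff z) ((embed h Ω.^ₛ r) Ω.*ₛ ω) n i j k) ⟩
      (coeff y K³.* (embed h Ω.*ₛ ω) n) i j k + (coeff z K³.* ((embed h Ω.^ₛ r) Ω.*ₛ ω) n) i j k ∎

    h-*ₛ-zero : ∀ a → (h *ₛ a) 0 ≈ 0#
    h-*ₛ-zero a = K.trans (K.+-identityʳ _) (K.trans (K.*-congʳ h₀≈0) (K.zeroˡ _))

    constant-η^-zero : ∀ Q m → (Ω.constant Q Ω.*ₛ (embed h Ω.^ₛ suc m)) 0 K³.≈ K³.0#
    constant-η^-zero Q m i j k = begin
      (Ω.constant Q Ω.*ₛ (embed h Ω.^ₛ suc m)) 0 i j k         ≈⟨ Ω.*ₛ-comm (Ω.constant Q) (embed h Ω.^ₛ suc m) 0 i j k ⟩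
      π i j k ((embed h Ω.^ₛ suc m) Ω.*ₛ Ω.constant Q) 0       ≈⟨ π-embed-^ h (suc m) (Ω.constant Q) i j k 0 ⟩
      ((h *ₛ (h ^ₛ m)) *ₛ π i j k (Ω.constant Q)) 0      ≈⟨ *ₛ-assoc h (h ^ₛ m) (π i j k (Ω.constant Q)) 0 ⟩
      (h *ₛ ((h ^ₛ m) *ₛ π i j k (Ω.constant Q))) 0      ≈⟨ h-*ₛ-zero ((h ^ₛ m) *ₛ π i j k (Ω.constant Q)) ⟩
      0#                                                 ∎

    v₀≈0 : C₀-argument (embed h) 0 K³.≈ K³.0#
    v₀≈0 i j k = K.trans (K.-‿cong (constant-η^-zero (coeff x) 1 i j k)) -0#≈0#

    u₀≈0 : exp-argument (embed h) 0 K³.≈ K³.0#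
    u₀≈0 i j k = K.trans (K.+-cong constant-η (constant-η^-zero (coeff z) r′ i j k)) (K.+-identityʳ 0#)
      where
      constant-η : (Ω.constant (coeff y) Ω.*ₛ embed h) 0 i j k ≈ 0#
      constant-η = begin
        (Ω.constant (coeff y) Ω.*ₛ embed h) 0 i j k            ≈⟨ Ω.*ₛ-comm (Ω.constant (coeff y)) (embed h) 0 i j k ⟩
        π i j k (embed h Ω.*ₛ Ω.constant (coeff y)) 0          ≈⟨ π-embed h (Ω.constant (coeff y)) i j k 0 ⟩
        (h *ₛ π i j k (Ω.constant (coeff y))) 0          ≈⟨ h-*ₛ-zero (π i j k (Ω.constant (coeff y))) ⟩
        0#                                               ∎

    factor : ℕ → ℕ → ℕ → Carrier
    factor i j k = P₀.1ₛ i * (1/! j * 1/! k)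

    factor-j : ∀ i j k → suc j × factor i (suc j) k ≈ factor i j k
    factor-j i j k = begin
      suc j × factor i (suc j) k                          ≈⟨ ×-comm-* (suc j) _ _ ⟨
      P₀.1ₛ i * (suc j × (1/! (suc j) * 1/! k))           ≈⟨ K.*-congˡ (×-assoc-* (suc j) _ _) ⟨
      P₀.1ₛ i * ((suc j × 1/! (suc j)) * 1/! k)           ≈⟨ K.*-congˡ (K.*-congʳ (1/!-suc j)) ⟩
      factor i j k                                        ∎

    factor-k : ∀ i j k → suc k × factor i j (suc k) ≈ factor i j k
    factor-k i j k = begin
      suc k × factor i j (suc k)                          ≈⟨ ×-comm-* (suc k) _ _ ⟨
      P₀.1ₛ i * (suc k × (1/! j * 1/! (suc k)))           ≈⟨ K.*-congˡ (×-comm-* (suc k) _ _) ⟨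
      P₀.1ₛ i * (1/! j * (suc k × 1/! (suc k)))           ≈⟨ K.*-congˡ (K.*-congˡ (1/!-suc k)) ⟩
      factor i j k                                        ∎

    private
      exponent : ℕ → ℕ → ℕ
      exponent j k = j ℕ.+ r ℕ.* k

      coefficient pre-coefficient : K⟦t⟧ → ℕ → ℕ → ℕ → Carrier
      coefficient     a i j k = ((j ℕ.+ k) !) × a (j ℕ.+ k) * factor i j k
      pre-coefficient a i j k = (ℕ.pred (j ℕ.+ k) !) × a (j ℕ.+ k) * factor i j k

      coefficient-suc : ∀ a i j k {m} → j ℕ.+ k ≡ suc m →
        (j ℕ.+ k) × pre-coefficient a i j k ≈ coefficient a i j k
      coefficient-suc a i j k {m} eq rewrite eq = begin
        suc m × ((m !) × a (suc m) * factor i j k)        ≈⟨ ×-assoc-* (suc m) _ _ ⟨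
        suc m × ((m !) × a (suc m)) * factor i j k        ≈⟨ K.*-congʳ (×-assocˡ _ (suc m) (m !)) ⟩
        (suc m !) × a (suc m) * factor i j k              ∎

      π-constant-zero : ∀ s i j k n {m} → j ℕ.+ k ≡ suc m →
                        π i j k (Ω.constant (coeff (scalar s))) n ≈ 0#
      π-constant-zero s i j k (suc n) eq = K.refl
      π-constant-zero s i j k zero    eq = K.trans (coeff-[ s x^ 0 y^ 0 z^ 0 ] i j k) (off i j k eq)
        where
        off : ∀ i j k {m} → j ℕ.+ k ≡ suc m → term (s x^ 0 y^ 0 z^ 0) i j k ≈ 0#
        off zero    zero    (suc k) eq = K.refl
        off zero    (suc j) k       eq = K.refl
        off (suc i) j       k       eq = K.refl

    π-exp : ∀ a i j k → π i j k (embed a Ω.∘ₛ exp-argument (embed h)) ≈ₛ (coefficient a i j k ∙ (h ^ₛ exponent j k))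

    y-part : ∀ a i j k n → (coeff y K³.* (embed h Ω.*ₛ (embed (a ∘ suc) Ω.∘ₛ exp-argument (embed h))) n) i j k
      ≈ j × (pre-coefficient a i j k * (h ^ₛ exponent j k) n)
    y-part a i zero    k n = y-*³-zero ((embed h Ω.*ₛ (embed (a ∘ suc) Ω.∘ₛ exp-argument (embed h))) n) i k
    y-part a i (suc j) k n = begin
      (coeff y K³.* (embed h Ω.*ₛ ω) n) i (suc j) k                       ≈⟨ y-*³-suc ((embed h Ω.*ₛ ω) n) i j k ⟩
      π i j k (embed h Ω.*ₛ ω) n                                          ≈⟨ π-embed h ω i j k n ⟩
      (h *ₛ π i j k ω) n                                            ≈⟨ *ₛ-congˡ h {π i j k ω} {coefficient (a ∘ suc) i j k ∙ hᵉ} (π-exp (a ∘ suc) i j k) n ⟩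
      (h *ₛ (coefficient (a ∘ suc) i j k ∙ hᵉ)) n                   ≈⟨ *ₛ-∙ (coefficient (a ∘ suc) i j k) h hᵉ n ⟩
      s * factor i j k * (h *ₛ hᵉ) n                                ≈⟨ K.*-congʳ (K.*-congˡ (factor-j i j k)) ⟨
      s * (suc j × factor i (suc j) k) * (h *ₛ hᵉ) n                ≈⟨ K.*-congʳ (×-comm-* (suc j) _ _) ⟩
      (suc j × (s * factor i (suc j) k)) * (h *ₛ hᵉ) n              ≈⟨ ×-assoc-* (suc j) _ _ ⟩
      suc j × (s * factor i (suc j) k * (h *ₛ hᵉ) n)                ∎
      where
      ω  = embed (a ∘ suc) Ω.∘ₛ exp-argument (embed h)
      s  = ((j ℕ.+ k) !) × a (suc (j ℕ.+ k))
      hᵉ = h ^ₛ exponent j k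

    z-part : ∀ a i j k n → (coeff z K³.* ((embed h Ω.^ₛ r) Ω.*ₛ (embed (a ∘ suc) Ω.∘ₛ exp-argument (embed h))) n) i j k
      ≈ k × (pre-coefficient a i j k * (h ^ₛ exponent j k) n)
    z-part a i j zero    n = z-*³-zero (((embed h Ω.^ₛ r) Ω.*ₛ (embed (a ∘ suc) Ω.∘ₛ exp-argument (embed h))) n) i j
    z-part a i j (suc k) n = begin
      (coeff z K³.* ((embed h Ω.^ₛ r) Ω.*ₛ ω) n) i j (suc k)              ≈⟨ z-*³-suc (((embed h Ω.^ₛ r) Ω.*ₛ ω) n) i j k ⟩
      π i j k ((embed h Ω.^ₛ r) Ω.*ₛ ω) n                                 ≈⟨ π-embed-^ h r ω i j k n ⟩
      ((h ^ₛ r) *ₛ π i j k ω) n                                     ≈⟨ *ₛ-congˡ (h ^ₛ r) {π i j k ω} {coefficient (a ∘ suc) i j k ∙ hᵉ} (π-exp (a ∘ suc) i j k) n ⟩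
      ((h ^ₛ r) *ₛ (coefficient (a ∘ suc) i j k ∙ hᵉ)) n            ≈⟨ *ₛ-∙ (coefficient (a ∘ suc) i j k) (h ^ₛ r) hᵉ n ⟩
      s (j ℕ.+ k) * factor i j k * ((h ^ₛ r) *ₛ hᵉ) n               ≈⟨ K.*-cong (K.*-congˡ (factor-k i j k)) (SE.^-homo-* h r (exponent j k) n) ⟨
      s (j ℕ.+ k) * (suc k × factor i j (suc k)) * (h ^ₛ (r ℕ.+ exponent j k)) n
                                                                    ≈⟨ K.*-congʳ (×-comm-* (suc k) _ _) ⟩
      (suc k × (s (j ℕ.+ k) * factor i j (suc k))) * (h ^ₛ (r ℕ.+ exponent j k)) n
                                                                    ≈⟨ ×-assoc-* (suc k) _ _ ⟩
      suc k × (s (j ℕ.+ k) * factor i j (suc k) * (h ^ₛ (r ℕ.+ exponent j k)) n)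
        ≡⟨ ≡.cong₂ (λ d e → suc k × ((ℕ.pred d !) × a d * factor i j (suc k) * (h ^ₛ e) n))
             (≡.sym (ℕₚ.+-suc j k)) (exponent-suc r′ j k) ⟩
      suc k × (pre-coefficient a i j (suc k) * (h ^ₛ exponent j (suc k)) n) ∎
      where
      ω  = embed (a ∘ suc) Ω.∘ₛ exp-argument (embed h)
      s : ℕ → Carrier
      s d = (d !) × a (suc d)
      hᵉ = h ^ₛ exponent j k
      exponent-suc : ∀ r′ j k → suc r′ ℕ.+ (j ℕ.+ suc r′ ℕ.* k) ≡ j ℕ.+ suc r′ ℕ.* suc k
      exponent-suc = solve-∀

    π-exp a i j k n = begin
      π i j k (embed a Ω.∘ₛ exp-argument (embed h)) n
        ≈⟨ Ω.∘ₛ-horner {exp-argument (embed h)} u₀≈0 (embed a) n i j k ⟩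
      π i j k (Ω.constant (coeff (scalar (a 0)))) n + π i j k (exp-argument (embed h) Ω.*ₛ ω) n
        ≈⟨ K.+-congˡ (π-u ω i j k n) ⟩
      π i j k (Ω.constant (coeff (scalar (a 0)))) n + ((coeff y K³.* (embed h Ω.*ₛ ω) n) i j k + (coeff z K³.* ((embed h Ω.^ₛ r) Ω.*ₛ ω) n) i j k)
        ≈⟨ K.+-congˡ (K.+-cong (y-part a i j k n) (z-part a i j k n)) ⟩
      π i j k (Ω.constant (coeff (scalar (a 0)))) n + (j × pre j k + k × pre j k)
        ≈⟨ K.+-congˡ (×-homo-+ (pre j k) j k) ⟨
      π i j k (Ω.constant (coeff (scalar (a 0)))) n + (j ℕ.+ k) × pre j k
        ≈⟨ assemble j k n ⟩
      coefficient a i j k * (h ^ₛ exponent j k) n ∎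
      where
      ω  = embed (a ∘ suc) Ω.∘ₛ exp-argument (embed h)
      pre : ℕ → ℕ → Carrier
      pre j k = pre-coefficient a i j k * (h ^ₛ exponent j k) n

      assemble-suc : ∀ j k n {m} → j ℕ.+ k ≡ suc m →
        π i j k (Ω.constant (coeff (scalar (a 0)))) n + (j ℕ.+ k) × (pre-coefficient a i j k * (h ^ₛ exponent j k) n)
          ≈ coefficient a i j k * (h ^ₛ exponent j k) n
      assemble-suc j k n eq = begin
        π i j k (Ω.constant (coeff (scalar (a 0)))) n + (j ℕ.+ k) × (pre-coefficient a i j k * (h ^ₛ exponent j k) n)
          ≈⟨ K.+-cong (π-constant-zero (a 0) i j k n eq) (K.sym (×-assoc-* (j ℕ.+ k) _ _)) ⟩
        0# + ((j ℕ.+ k) × pre-coefficient a i j k) * (h ^ₛ exponent j k) n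
          ≈⟨ K.+-identityˡ _ ⟩
        ((j ℕ.+ k) × pre-coefficient a i j k) * (h ^ₛ exponent j k) n
          ≈⟨ K.*-congʳ (coefficient-suc a i j k eq) ⟩
        coefficient a i j k * (h ^ₛ exponent j k) n ∎

      1/!0≈1 : 1/! 0 ≈ 1#
      1/!0≈1 = K.trans (K.sym (×-homo-1 _)) (!×1/! 0)

      constant-part : ∀ i n → π i 0 0 (Ω.constant (coeff (scalar (a 0)))) n ≈ a 0 * P₀.1ₛ i * P₀.1ₛ n
      constant-part i       (suc n) = K.sym (K.zeroʳ _)
      constant-part zero    zero    = K.trans (coeff-[ a 0 x^ 0 y^ 0 z^ 0 ] 0 0 0) (K.sym (K.trans (K.*-identityʳ _) (K.*-identityʳ _)))
      constant-part (suc i) zero    = K.trans (coeff-[ a 0 x^ 0 y^ 0 z^ 0 ] (suc i) 0 0)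
        (K.sym (K.trans (K.*-identityʳ _) (K.zeroʳ _)))

      assemble : ∀ j k n →
        π i j k (Ω.constant (coeff (scalar (a 0)))) n + (j ℕ.+ k) × (pre-coefficient a i j k * (h ^ₛ exponent j k) n)
          ≈ coefficient a i j k * (h ^ₛ exponent j k) n
      assemble (suc j) k       n = assemble-suc (suc j) k n ≡.refl
      assemble zero    (suc k) n = assemble-suc zero (suc k) n ≡.refl
      assemble zero    zero    n = begin
        π i 0 0 (Ω.constant (coeff (scalar (a 0)))) n + 0#     ≈⟨ K.+-identityʳ _ ⟩
        π i 0 0 (Ω.constant (coeff (scalar (a 0)))) n          ≈⟨ constant-part i n ⟩
        a 0 * P₀.1ₛ i * P₀.1ₛ n
          ≈⟨ K.*-congʳ (K.*-cong (K.sym (×-homo-1 (a 0))) (K.sym (K.trans (K.*-congˡ (K.trans (K.*-cong 1/!0≈1 1/!0≈1) (K.*-identityʳ 1#))) (K.*-identityʳ _)))) ⟩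
        coefficient a i 0 0 * (h ^ₛ 0) n                       ≡⟨ ≡.cong (λ e → coefficient a i 0 0 * (h ^ₛ e) n) (ℕₚ.*-zeroʳ r) ⟨
        coefficient a i 0 0 * (h ^ₛ exponent 0 0) n            ∎

    π-C₀ : ∀ a ω j k → (∀ i → π (suc i) j k ω ≈ₛ P₀.0ₛ) → ∀ i →
      π i j k ((embed a Ω.∘ₛ C₀-argument (embed h)) Ω.*ₛ ω) ≈ₛ ((a i * (- 1#) ^ i) ∙ ((h ^ₛ (2 ℕ.* i)) *ₛ π 0 j k ω))
    π-C₀ a ω j k ω⁺≈0 i n = K.trans (horner i) (by-i i)
      where
      P : Ω.R⟦t⟧
      P = embed (a ∘ suc) Ω.∘ₛ C₀-argument (embed h)

      horner : ∀ i → π i j k ((embed a Ω.∘ₛ C₀-argument (embed h)) Ω.*ₛ ω) n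
        ≈ a 0 * π i j k ω n + - (coeff x K³.* ((embed h Ω.^ₛ 2) Ω.*ₛ (P Ω.*ₛ ω)) n) i j k
      horner i = begin
        π i j k ((embed a Ω.∘ₛ C₀-argument (embed h)) Ω.*ₛ ω) n
          ≈⟨ Ω.*ₛ-congʳ ω {embed a Ω.∘ₛ C₀-argument (embed h)} {Ω.constant (embed a 0) Ω.+ₛ (C₀-argument (embed h) Ω.*ₛ P)} (Ω.∘ₛ-horner {C₀-argument (embed h)} v₀≈0 (embed a)) n i j k ⟩
        π i j k ((Ω.constant (embed a 0) Ω.+ₛ (C₀-argument (embed h) Ω.*ₛ P)) Ω.*ₛ ω) n
          ≈⟨ Ω.*ₛ-distribʳ ω (Ω.constant (embed a 0)) (C₀-argument (embed h) Ω.*ₛ P) n i j k ⟩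
        π i j k (Ω.constant (embed a 0) Ω.*ₛ ω) n + π i j k ((C₀-argument (embed h) Ω.*ₛ P) Ω.*ₛ ω) n
          ≈⟨ K.+-cong (K.trans (Ω.constant-*ₛ (embed a 0) ω n i j k) (coeff-scalar-*³ (a 0) (ω n) i j k))
               (K.trans (Ω.*ₛ-assoc (C₀-argument (embed h)) P ω n i j k) (π-v (P Ω.*ₛ ω) i j k n)) ⟩
        a 0 * π i j k ω n + - (coeff x K³.* ((embed h Ω.^ₛ 2) Ω.*ₛ (P Ω.*ₛ ω)) n) i j k ∎

      by-i : ∀ i → a 0 * π i j k ω n + - (coeff x K³.* ((embed h Ω.^ₛ 2) Ω.*ₛ (P Ω.*ₛ ω)) n) i j k
        ≈ a i * (- 1#) ^ i * ((h ^ₛ (2 ℕ.* i)) *ₛ π 0 j k ω) n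
      by-i zero    = begin
        a 0 * π 0 j k ω n + - (coeff x K³.* ((embed h Ω.^ₛ 2) Ω.*ₛ (P Ω.*ₛ ω)) n) 0 j k
          ≈⟨ K.+-congˡ (K.trans (K.-‿cong (x-*³-zero (((embed h Ω.^ₛ 2) Ω.*ₛ (P Ω.*ₛ ω)) n) j k)) -0#≈0#) ⟩
        a 0 * π 0 j k ω n + 0#
          ≈⟨ K.+-identityʳ _ ⟩
        a 0 * π 0 j k ω n
          ≈⟨ K.*-cong (K.*-identityʳ (a 0)) (P₀.*ₛ-identityˡ (π 0 j k ω) n) ⟨
        a 0 * 1# * ((h ^ₛ 0) *ₛ π 0 j k ω) n ∎
      by-i (suc i) = begin
        a 0 * π (suc i) j k ω n + - (coeff x K³.* ((embed h Ω.^ₛ 2) Ω.*ₛ (P Ω.*ₛ ω)) n) (suc i) j k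
          ≈⟨ K.+-cong (K.trans (K.*-congˡ (ω⁺≈0 i n)) (K.zeroʳ _)) (K.-‿cong (x-*³-suc (((embed h Ω.^ₛ 2) Ω.*ₛ (P Ω.*ₛ ω)) n) i j k)) ⟩
        0# + - π i j k ((embed h Ω.^ₛ 2) Ω.*ₛ (P Ω.*ₛ ω)) n
          ≈⟨ K.+-identityˡ _ ⟩
        - π i j k ((embed h Ω.^ₛ 2) Ω.*ₛ (P Ω.*ₛ ω)) n
          ≈⟨ K.-‿cong (π-embed-^ h 2 (P Ω.*ₛ ω) i j k n) ⟩
        - ((h ^ₛ 2) *ₛ π i j k (P Ω.*ₛ ω)) n
          ≈⟨ K.-‿cong (*ₛ-congˡ (h ^ₛ 2) {π i j k (P Ω.*ₛ ω)} {s ∙ Q} (π-C₀ (a ∘ suc) ω j k ω⁺≈0 i) n) ⟩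
        - ((h ^ₛ 2) *ₛ (s ∙ Q)) n
          ≈⟨ K.-‿cong (*ₛ-∙ s (h ^ₛ 2) Q n) ⟩
        - (s * ((h ^ₛ 2) *ₛ Q) n)
          ≈⟨ -‿distribˡ-* s _ ⟩
        - s * ((h ^ₛ 2) *ₛ Q) n
          ≈⟨ K.*-cong (K.sym (K.trans (K.*-congˡ (-1*x≈-x _)) (K.sym (-‿distribʳ-* (a (suc i)) _))))
               (K.sym (*ₛ-assoc (h ^ₛ 2) (h ^ₛ (2 ℕ.* i)) (π 0 j k ω) n)) ⟩
        a (suc i) * (- 1#) ^ suc i * (((h ^ₛ 2) *ₛ (h ^ₛ (2 ℕ.* i))) *ₛ π 0 j k ω) n
          ≈⟨ K.*-congˡ (*ₛ-congʳ (π 0 j k ω) {h ^ₛ (2 ℕ.+ 2 ℕ.* i)} {(h ^ₛ 2) *ₛ (h ^ₛ (2 ℕ.* i))} (SE.^-homo-* h 2 (2 ℕ.* i)) n) ⟨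
        a (suc i) * (- 1#) ^ suc i * ((h ^ₛ (2 ℕ.+ 2 ℕ.* i)) *ₛ π 0 j k ω) n
          ≡⟨ ≡.cong (λ e → a (suc i) * (- 1#) ^ suc i * ((h ^ₛ e) *ₛ π 0 j k ω) n) (ℕₚ.*-suc 2 i) ⟨
        a (suc i) * (- 1#) ^ suc i * ((h ^ₛ (2 ℕ.* suc i)) *ₛ π 0 j k ω) n ∎
        where
        s = a (suc i) * (- 1#) ^ i
        Q : K⟦t⟧
        Q = (h ^ₛ (2 ℕ.* i)) *ₛ π 0 j k ω

    C₀-sign : ∀ i → C₀ i * (- 1#) ^ i ≈ 1/! i * 1/! i
    C₀-sign i = begin
      (- 1#) ^ i * (1/! i * (1/! i * 1#)) * (- 1#) ^ i      ≈⟨ K.*-congʳ (K.*-congˡ (K.*-congˡ (K.*-identityʳ _))) ⟩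
      (- 1#) ^ i * (1/! i * 1/! i) * (- 1#) ^ i             ≈⟨ xy∙z≈xz∙y _ _ _ ⟩
      (- 1#) ^ i * (- 1#) ^ i * (1/! i * 1/! i)             ≈⟨ K.*-congʳ (square i) ⟩
      1# * (1/! i * 1/! i)                                  ≈⟨ K.*-identityˡ _ ⟩
      1/! i * 1/! i                                         ∎
      where
      square : ∀ i → (- 1#) ^ i * (- 1#) ^ i ≈ 1#
      square zero    = K.*-identityʳ 1#
      square (suc i) = begin
        (- 1# * (- 1#) ^ i) * (- 1# * (- 1#) ^ i)           ≈⟨ interchange _ _ _ _ ⟩
        (- 1# * - 1#) * ((- 1#) ^ i * (- 1#) ^ i)           ≈⟨ K.*-cong (K.trans (-1*x≈-x (- 1#)) (-‿involutive 1#)) (square i) ⟩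
        1# * 1#                                             ≈⟨ K.*-identityʳ 1# ⟩
        1#                                                  ∎

    coefficient-exponential : ∀ j k → coefficient exponential 0 j k ≈ 1/! j * 1/! k
    coefficient-exponential j k = K.trans (K.*-cong (!×1/! (j ℕ.+ k)) (K.*-identityˡ _)) (K.*-identityˡ _)

    open Action h h₀≈0 r′ using (Represents; degree)

    π-product : ∀ a i j k →
      π i j k (embed a Ω.*ₛ ((embed C₀ Ω.∘ₛ C₀-argument (embed h)) Ω.*ₛ (embed exponential Ω.∘ₛ exp-argument (embed h))))
        ≈ₛ (weight i j k ∙ (a *ₛ (h ^ₛ degree i j k)))
    π-product a i j k n = begin
      π i j k (embed a Ω.*ₛ ((embed C₀ Ω.∘ₛ C₀-argument (embed h)) Ω.*ₛ E)) n
        ≈⟨ π-embed a ((embed C₀ Ω.∘ₛ C₀-argument (embed h)) Ω.*ₛ E) i j k n ⟩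
      (a *ₛ π i j k ((embed C₀ Ω.∘ₛ C₀-argument (embed h)) Ω.*ₛ E)) n
        ≈⟨ *ₛ-congˡ a {π i j k ((embed C₀ Ω.∘ₛ C₀-argument (embed h)) Ω.*ₛ E)} {weight i j k ∙ (h ^ₛ degree i j k)} inner n ⟩
      (a *ₛ (weight i j k ∙ (h ^ₛ degree i j k))) n
        ≈⟨ *ₛ-∙ (weight i j k) a (h ^ₛ degree i j k) n ⟩
      weight i j k * (a *ₛ (h ^ₛ degree i j k)) n ∎
      where
      E : Ω.R⟦t⟧
      E = embed exponential Ω.∘ₛ exp-argument (embed h)

      E⁺≈0 : ∀ i → π (suc i) j k E ≈ₛ P₀.0ₛ
      E⁺≈0 i m = K.trans (π-exp exponential (suc i) j k m)
        (K.trans (K.*-congʳ (K.trans (K.*-congˡ (K.zeroˡ _)) (K.zeroʳ _))) (K.zeroˡ _))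

      degrees : ∀ i j l → 2 ℕ.* i ℕ.+ (j ℕ.+ l) ≡ j ℕ.+ 2 ℕ.* i ℕ.+ l
      degrees = solve-∀

      inner : π i j k ((embed C₀ Ω.∘ₛ C₀-argument (embed h)) Ω.*ₛ E) ≈ₛ (weight i j k ∙ (h ^ₛ degree i j k))
      inner m = begin
        π i j k ((embed C₀ Ω.∘ₛ C₀-argument (embed h)) Ω.*ₛ E) m
          ≈⟨ π-C₀ C₀ E j k E⁺≈0 i m ⟩
        C₀ i * (- 1#) ^ i * ((h ^ₛ (2 ℕ.* i)) *ₛ π 0 j k E) m
          ≈⟨ K.*-cong (C₀-sign i) (*ₛ-congˡ (h ^ₛ (2 ℕ.* i)) {π 0 j k E} {coefficient exponential 0 j k ∙ (h ^ₛ exponent j k)} (π-exp exponential 0 j k) m) ⟩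
        1/! i * 1/! i * ((h ^ₛ (2 ℕ.* i)) *ₛ (coefficient exponential 0 j k ∙ (h ^ₛ exponent j k))) m
          ≈⟨ K.*-congˡ (*ₛ-∙ (coefficient exponential 0 j k) (h ^ₛ (2 ℕ.* i)) (h ^ₛ exponent j k) m) ⟩
        1/! i * 1/! i * (coefficient exponential 0 j k * ((h ^ₛ (2 ℕ.* i)) *ₛ (h ^ₛ exponent j k)) m)
          ≈⟨ K.*-congˡ (K.*-cong (coefficient-exponential j k) (K.sym (SE.^-homo-* h (2 ℕ.* i) (exponent j k) m))) ⟩
        1/! i * 1/! i * (1/! j * 1/! k * (h ^ₛ (2 ℕ.* i ℕ.+ exponent j k)) m)
          ≈⟨ K.*-assoc _ _ _ ⟨
        weight i j k * (h ^ₛ (2 ℕ.* i ℕ.+ exponent j k)) m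
          ≡⟨ ≡.cong (λ e → weight i j k * (h ^ₛ e) m) (degrees i j (r ℕ.* k)) ⟩
        weight i j k * (h ^ₛ degree i j k) m ∎

    represents : ∀ (A : InvertibleSeries) (H : DeltaSeries) → h ≡ DeltaSeries.series H →
      ∀ n → Represents n (InvertibleSeries.series A) (generatingFunction A H r n)
    represents A H ≡.refl = ≡.subst (λ e → ∀ n → Represents n a (e n)) generatingFunction-≡
      (λ n i j k → K.trans (image-product-embed n i j k) (π-product a i j k n))
      where
      a : K⟦t⟧
      a = InvertibleSeries.series A
      product : G.Carrier
      product = lift a
        G.* (lift C₀ G.∘ₛ (G.- (G.constant x G.* lift h G.^ 2)))
        G.* (lift exponential G.∘ₛ (G.constant y G.* lift h G.+ G.constant z G.* lift h G.^ r))
      generatingFunction-≡ : product ≡ generatingFunction A H r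
      generatingFunction-≡ = ≡.refl
      image-product-embed : image (lift a
        G.* (lift C₀ G.∘ₛ (G.- (G.constant x G.* lift h G.^ 2)))
        G.* (lift exponential G.∘ₛ (G.constant y G.* lift h G.+ G.constant z G.* lift h G.^ r))) Ω.≈ₛ
        (embed a Ω.*ₛ ((embed C₀ Ω.∘ₛ C₀-argument (embed h)) Ω.*ₛ (embed exponential Ω.∘ₛ exp-argument (embed h))))
      image-product-embed = image-product (lift a) (lift C₀) (lift exponential) (lift h)
        {embed a} {embed C₀} {embed exponential} {embed h}
        (λ _ _ _ _ → K.refl) (λ _ _ _ _ → K.refl) (λ _ _ _ _ → K.refl) (λ _ _ _ _ → K.refl)

  module Recurrence (h : K⟦t⟧) (h₀≈0 : h 0 ≈ 0#) (r′ : ℕ) (a : K⟦t⟧) where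
    open Polynomials K char0
    open Operators K char0
    open Factorials K char0
    open Action h h₀≈0 r′
    open P₀ using (_∙_; _+ₛ_; -ₛ_; powerDerivative; *ₛ-congˡ; *ₛ-congʳ; *ₛ-assoc; *ₛ-comm; ∙-*ₛ; *ₛ-∙)
    open SemiringMultiples K.semiring using (_×_; ×-comm-*; ×-assoc-*; ×-homo-1; ×-assocˡ)
    open RingProperties K.ring using (-‿distribˡ-*; -‿distribʳ-*)
    open SetoidReasoning K.setoid
    private
      module SR = SetoidReasoning P₀.S.setoid
      module SP = RingProperties P₀.S.ring

    represents-suc : ∀ n s q X Y → X ≈ₛ (s ∙ (h ′ *ₛ a)) → Y ≈ₛ (s ∙ (a ′)) →
      (∀ i j k → coeff q i j k ≈ weight i j k * (X *ₛ powerDerivative h (degree i j k)) n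
                               + weight i j k * (Y *ₛ (h ^ₛ degree i j k)) n) →
      Represents (suc n) ((suc n × s) ∙ a) q
    represents-suc n s q X Y X≈ Y≈ q≈ i j k = begin
      coeff q i j k
        ≈⟨ q≈ i j k ⟩
      w * (X *ₛ d) n + w * (Y *ₛ hᵉ) n
        ≈⟨ K.distribˡ w _ _ ⟨
      w * ((X *ₛ d) n + (Y *ₛ hᵉ) n)
        ≈⟨ K.*-congˡ (K.+-cong (K.trans (*ₛ-congʳ d {X} {s ∙ (h ′ *ₛ a)} X≈ n) (∙-*ₛ s (h ′ *ₛ a) d n))
                               (K.trans (*ₛ-congʳ hᵉ {Y} {s ∙ (a ′)} Y≈ n) (∙-*ₛ s (a ′) hᵉ n))) ⟩
      w * (s * ((h ′ *ₛ a) *ₛ d) n + s * (a ′ *ₛ hᵉ) n)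
        ≈⟨ K.*-congˡ (K.distribˡ s _ _) ⟨
      w * (s * (((h ′ *ₛ a) *ₛ d) n + (a ′ *ₛ hᵉ) n))
        ≈⟨ K.*-congˡ (K.*-congˡ (derivative-power n)) ⟩
      w * (s * (suc n × (a *ₛ hᵉ) (suc n)))
        ≈⟨ K.*-congˡ (K.trans (×-comm-* (suc n) s _) (K.sym (×-assoc-* (suc n) s _))) ⟩
      w * ((suc n × s) * (a *ₛ hᵉ) (suc n))
        ≈⟨ K.*-congˡ (∙-*ₛ (suc n × s) a hᵉ (suc n)) ⟨
      w * (((suc n × s) ∙ a) *ₛ hᵉ) (suc n) ∎
      where
      w : Carrier
      w  = weight i j k
      hᵉ d : K⟦t⟧
      hᵉ = h ^ₛ degree i j k
      d  = powerDerivative h (degree i j k)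

      derivative-power : (((h ′ *ₛ a) *ₛ d) +ₛ (a ′ *ₛ hᵉ)) ≈ₛ ((a *ₛ hᵉ) ′)
      derivative-power = SR.begin
        ((h ′ *ₛ a) *ₛ d) +ₛ (a ′ *ₛ hᵉ)     SR.≈⟨ P₀.S.+-comm ((h ′ *ₛ a) *ₛ d) (a ′ *ₛ hᵉ) ⟩
        (a ′ *ₛ hᵉ) +ₛ ((h ′ *ₛ a) *ₛ d)     SR.≈⟨ P₀.S.+-congˡ {a ′ *ₛ hᵉ} {(h ′ *ₛ a) *ₛ d} {a *ₛ (d *ₛ h ′)} (xy∙z≈y∙zx (h ′) a d) ⟩
        (a ′ *ₛ hᵉ) +ₛ (a *ₛ (d *ₛ h ′))     SR.≈⟨ P₀.S.+-congˡ {a ′ *ₛ hᵉ} {a *ₛ hᵉ ′} {a *ₛ (d *ₛ h ′)} (*ₛ-congˡ a {hᵉ ′} {d *ₛ h ′} (P₀.′-^ₛ h (degree i j k))) ⟨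
        (a ′ *ₛ hᵉ) +ₛ (a *ₛ hᵉ ′)           SR.≈⟨ P₀.′-*ₛ a hᵉ ⟨
        (a *ₛ hᵉ) ′                          SR.∎
        where open CommutativeSemigroupProperties P₀.S.*-commutativeSemigroup using (xy∙z≈y∙zx)

    module _ (ψ : K⟦t⟧) (ψh≈h′ : (ψ ∘ₛ h) ≈ₛ h ′) where

      composed : ∀ s → ((ψ ∘ₛ h) *ₛ (s ∙ a)) ≈ₛ (s ∙ (h ′ *ₛ a))
      composed s n = K.trans (*ₛ-∙ s (ψ ∘ₛ h) a n) (K.*-congˡ (*ₛ-congʳ a {ψ ∘ₛ h} {h ′} ψh≈h′ n))

      step-⊕ : ∀ χ → ((χ ∘ₛ h) *ₛ a) ≈ₛ a ′ → ∀ n s p → Represents n (s ∙ a) p →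
               Represents (suc n) ((suc n × s) ∙ a) ((M ∘ ψ [∂y] ⊕ χ [∂y]) p)
      step-⊕ χ χa≈a′ n s p rep = represents-suc n s ((M ∘ ψ [∂y] ⊕ χ [∂y]) p) ((ψ ∘ₛ h) *ₛ (s ∙ a)) ((χ ∘ₛ h) *ₛ (s ∙ a))
        (composed s)
        (λ m → K.trans (*ₛ-∙ s (χ ∘ₛ h) a m) (K.*-congˡ (χa≈a′ m)))
        (λ i j k → K.trans (coeff-++ (M ((ψ [∂y]) p)) ((χ [∂y]) p) i j k)
          (K.+-cong (coeff-M {n} {(ψ ∘ₛ h) *ₛ (s ∙ a)} {(ψ [∂y]) p} (represents-[∂y] ψ {n} {s ∙ a} {p} rep) i j k)
                    (represents-[∂y] χ {n} {s ∙ a} {p} rep i j k)))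

      step-⊖ : ∀ θ → ((θ ∘ₛ h) *ₛ (h ′ *ₛ a)) ≈ₛ (-ₛ (a ′)) → ∀ n s p → Represents n (s ∙ a) p →
               Represents (suc n) ((suc n × s) ∙ a) (((M ⊖ θ [∂y]) ∘ ψ [∂y]) p)
      step-⊖ θ θa≈-a′ n s p rep = represents-suc n s (((M ⊖ θ [∂y]) ∘ ψ [∂y]) p) C (-ₛ Z) (composed s) Z≈
        (λ i j k → K.trans (coeff-++ (M q) (Pol.- (θ [∂y]) q) i j k)
          (K.+-cong (coeff-M {n} {C} {q} rep-q i j k)
            (K.trans (coeff-neg ((θ [∂y]) q) i j k)
              (K.trans (K.-‿cong (represents-[∂y] θ {n} {C} {q} rep-q i j k))
                (K.trans (-‿distribʳ-* _ _) (K.*-congˡ (SP.-‿distribˡ-* Z (h ^ₛ degree i j k) n)))))))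
        where
        q : K[x,y,z]
        q = (ψ [∂y]) p
        C Z : K⟦t⟧
        C = (ψ ∘ₛ h) *ₛ (s ∙ a)
        Z = (θ ∘ₛ h) *ₛ C
        rep-q : Represents n C q
        rep-q = represents-[∂y] ψ {n} {s ∙ a} {p} rep
        Z≈ : (-ₛ Z) ≈ₛ (s ∙ (a ′))
        Z≈ m = begin
          - Z m                                         ≈⟨ K.-‿cong (*ₛ-congˡ (θ ∘ₛ h) {C} {s ∙ (h ′ *ₛ a)} (composed s) m) ⟩
          - ((θ ∘ₛ h) *ₛ (s ∙ (h ′ *ₛ a))) m            ≈⟨ K.-‿cong (*ₛ-∙ s (θ ∘ₛ h) (h ′ *ₛ a) m) ⟩
          - (s * ((θ ∘ₛ h) *ₛ (h ′ *ₛ a)) m)            ≈⟨ K.-‿cong (K.*-congˡ (θa≈-a′ m)) ⟩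
          - (s * - (a ′) m)                             ≈⟨ K.-‿cong (-‿distribʳ-* s _) ⟨
          - - (s * (a ′) m)                             ≈⟨ -‿involutive _ ⟩
          s * (a ′) m                                   ∎
          where open RingProperties K.ring using (-‿involutive)

    represents-1ₚ : a 0 ≈ 1# → Represents 0 ((1 × 1#) ∙ a) 1ₚ
    represents-1ₚ a₀≈1 i j k = K.trans (coeff-[ 1# x^ 0 y^ 0 z^ 0 ] i j k) (by-degree i j k)
      where
      C : K⟦t⟧
      C = (1 × 1#) ∙ a

      vanish : ∀ w m → 0# ≈ w * (C *ₛ (h ^ₛ suc m)) 0
      vanish w m = K.sym (begin
        w * (C *ₛ (h *ₛ (h ^ₛ m))) 0           ≈⟨ K.*-congˡ (*ₛ-comm C (h *ₛ (h ^ₛ m)) 0) ⟩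
        w * ((h *ₛ (h ^ₛ m)) *ₛ C) 0           ≈⟨ K.*-congˡ (*ₛ-assoc h (h ^ₛ m) C 0) ⟩
        w * (h 0 * ((h ^ₛ m) *ₛ C) 0 + 0#)     ≈⟨ K.*-congˡ (K.trans (K.+-identityʳ _) (K.trans (K.*-congʳ h₀≈0) (K.zeroˡ _))) ⟩
        w * 0#                                 ≈⟨ K.zeroʳ w ⟩
        0#                                     ∎)

      by-degree : ∀ i j k → term (1# x^ 0 y^ 0 z^ 0) i j k ≈ weight i j k * (C *ₛ (h ^ₛ degree i j k)) 0
      by-degree i       (suc j) k       = K.trans (off i) (vanish (weight i (suc j) k) (degree i j k))
        where
        off : ∀ i → term (1# x^ 0 y^ 0 z^ 0) i (suc j) k ≈ 0#
        off zero    = K.refl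
        off (suc i) = K.refl
      by-degree (suc i) zero    k       = vanish (weight (suc i) 0 k) (ℕ.pred (degree (suc i) 0 k))
      by-degree zero    zero    (suc k) = vanish (weight 0 0 (suc k)) (ℕ.pred (degree 0 0 (suc k)))
      by-degree zero    zero    zero    = K.sym (begin
        weight 0 0 0 * (C *ₛ (h ^ₛ (r ℕ.* 0))) 0   ≡⟨ ≡.cong (λ e → weight 0 0 0 * (C *ₛ (h ^ₛ e)) 0) (ℕₚ.*-zeroʳ r) ⟩
        weight 0 0 0 * (C 0 * 1# + 0#)             ≈⟨ K.*-cong (one-* (one-* 1/!0≈1 1/!0≈1) (one-* 1/!0≈1 1/!0≈1))
                                                        (K.trans (K.+-identityʳ _) (one-* (one-* (×-homo-1 1#) a₀≈1) K.refl)) ⟩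
        1# * 1#                                    ≈⟨ K.*-identityʳ 1# ⟩
        1#                                         ∎)
        where
        1/!0≈1 : 1/! 0 ≈ 1#
        1/!0≈1 = K.trans (K.sym (×-homo-1 _)) (!×1/! 0)
        one-* : ∀ {x y} → x ≈ 1# → y ≈ 1# → x * y ≈ 1#
        one-* x≈1 y≈1 = K.trans (K.*-cong x≈1 y≈1) (K.*-identityʳ 1#)

    represents-^ₒ : a 0 ≈ 1# → (T : Operator) →
      (∀ n s p → Represents n (s ∙ a) p → Represents (suc n) ((suc n × s) ∙ a) (T p)) →
      ∀ n → Represents n (((n !) × 1#) ∙ a) ((T ^ₒ n) 1ₚ)
    represents-^ₒ a₀≈1 T step zero    = represents-1ₚ a₀≈1
    represents-^ₒ a₀≈1 T step (suc n) = Represents-cong {suc n} {(suc n × ((n !) × 1#)) ∙ a} {((suc n !) × 1#) ∙ a} {(T ^ₒ suc n) 1ₚ}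
      (λ m → K.*-congʳ (×-assocˡ 1# (suc n) (n !)))
      (step n ((n !) × 1#) ((T ^ₒ n) 1ₚ) (represents-^ₒ a₀≈1 T step n))

  module Expansion (A : InvertibleSeries) (H : DeltaSeries) (H₀≈0 : ⟪ H ⟫ 0 ≈ 0#) (r′ : ℕ) where
    open Polynomials K char0 using (module K; module P₀)
    open Operators K char0 using (coeff-×)
    open Factorials K char0 using (×-as-*; weight)
    open P₀ using (_∙_; ∙-*ₛ)
    open SemiringMultiples K.semiring using (_×_; ×-congʳ; ×-comm-*)
    open RawSemiringDefs Pol.rawSemiring using () renaming (_×_ to _×ₚ_)
    private
      a h : K⟦t⟧
      a = InvertibleSeries.series A
      h = DeltaSeries.series H
    open Action h H₀≈0 r′ using (Represents; degree)
    open SetoidReasoning K.setoid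

    represents-unique : ∀ n q → Represents n (((n !) × 1#) ∙ a) q → ((n !) ×ₚ generatingFunction A H (suc r′) n) ≈ₚ q
    represents-unique n q rep i j k = begin
      coeff ((n !) ×ₚ p) i j k                                           ≈⟨ coeff-× (n !) p i j k ⟩
      (n !) × coeff p i j k                                              ≈⟨ ×-congʳ (n !) (GeneratingFunction.represents h H₀≈0 r′ A H ≡.refl n i j k) ⟩
      (n !) × (weight i j k * (a *ₛ (h ^ₛ degree i j k)) n)              ≈⟨ ×-comm-* (n !) _ _ ⟨
      weight i j k * ((n !) × (a *ₛ (h ^ₛ degree i j k)) n)              ≈⟨ K.*-congˡ (×-as-* (n !) _) ⟩
      weight i j k * (((n !) × 1#) * (a *ₛ (h ^ₛ degree i j k)) n)       ≈⟨ K.*-congˡ (∙-*ₛ ((n !) × 1#) a (h ^ₛ degree i j k) n) ⟨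
      weight i j k * ((((n !) × 1#) ∙ a) *ₛ (h ^ₛ degree i j k)) n       ≈⟨ rep i j k ⟨
      coeff q i j k                                                      ∎
      where
      p : K[x,y,z]
      p = generatingFunction A H (suc r′) n

  module Sheffer
    (f H : DeltaSeries) (g A : InvertibleSeries)
    (g₀≈1  : ⟦ g ⟧ 0 ≈ 1#)
    (fH≈t  : (⟪ f ⟫ ∘ₛ ⟪ H ⟫) ≈ₛ t)
    (gHA≈1 : ((⟦ g ⟧ ∘ₛ ⟪ H ⟫) *ₛ ⟦ A ⟧) ≈ₛ K⟦t⟧.1#)
    (r′ : ℕ) where
    open HeytingCommutativeRing (HeytingField.heytingCommutativeRing K) using (commutativeRing)
    open Polynomials K char0 using (module K; module P₀)
    open Compositions commutativeRing
    open RingLemmas P₀.seriesRing using (inverse-unique)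
    open P₀ using (*ₛ-cong; *ₛ-congʳ; *ₛ-assoc; *ₛ-comm; 1ₛ; ∘ₛ-*ₛ)
    open RawSemiringDefs Pol.rawSemiring using () renaming (_×_ to _×ₚ_)
    private
      h a : K⟦t⟧
      h = ⟪ H ⟫
      a = ⟦ A ⟧
      module KR = SetoidReasoning K.setoid
    open Action h (root H) r′ using (M)
    open Recurrence h (root H) r′ a
    open Expansion A H (root H) r′ using (represents-unique)
    open SetoidReasoning P₀.S.setoid

    a₀≈1 : a 0 ≈ 1#
    a₀≈1 = KR.begin
      a 0                           KR.≈⟨ K.*-identityˡ _ ⟨
      1# * a 0                      KR.≈⟨ K.*-congʳ (K.trans (K.+-identityʳ _) (K.trans (K.*-identityʳ _) g₀≈1)) ⟨
      (⟦ g ⟧ ∘ₛ h) 0 * a 0          KR.≈⟨ K.+-identityʳ _ ⟨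
      ((⟦ g ⟧ ∘ₛ h) *ₛ a) 0         KR.≈⟨ gHA≈1 0 ⟩
      1#                            KR.∎

    module _ (g⁻¹ f′⁻¹ : K⟦t⟧) (gg⁻¹≈1 : (⟦ g ⟧ *ₛ g⁻¹) ≈ₛ 1ₛ) (f′f′⁻¹≈1 : (⟪ f ⟫ ′ *ₛ f′⁻¹) ≈ₛ 1ₛ) where

      f′⁻¹h≈h′ : (f′⁻¹ ∘ₛ h) ≈ₛ h ′
      f′⁻¹h≈h′ = inverse-unique (⟪ f ⟫ ′ ∘ₛ h) {f′⁻¹ ∘ₛ h} {h ′}
        (∘ₛ-reciprocal {h} (root H) (⟪ f ⟫ ′) f′⁻¹ f′f′⁻¹≈1)
        (′-reversion {⟪ f ⟫} {h} (root f) (root H) fH≈t)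

      representation-⊖ : ∀ n → ((n !) ×ₚ generatingFunction A H (suc r′) n)
        ≈ₚ (((M ⊖ (⟦ g ⟧ ′ *ₛ g⁻¹) [∂y]) ∘ f′⁻¹ [∂y]) ^ₒ n) 1ₚ
      representation-⊖ n = represents-unique n ((T ^ₒ n) 1ₚ) (represents-^ₒ a₀≈1 T
        (step-⊖ f′⁻¹ f′⁻¹h≈h′ (⟦ g ⟧ ′ *ₛ g⁻¹) (logarithmic-derivative {h} (root H) ⟦ g ⟧ g⁻¹ a gg⁻¹≈1 gHA≈1)) n)
        where
        T : Operator
        T = (M ⊖ (⟦ g ⟧ ′ *ₛ g⁻¹) [∂y]) ∘ f′⁻¹ [∂y]

    module _ (η b F bF⁻¹ : K⟦t⟧) (h≈η : ⟪ H ⟫ ≈ₛ η) (gηb≈1 : ((⟦ g ⟧ ∘ₛ η) *ₛ b) ≈ₛ 1ₛ) (F₀≈0 : F 0 ≈ 0#)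
             (HF≈t : (⟪ H ⟫ ∘ₛ F) ≈ₛ t) (bFbF⁻¹≈1 : ((b ∘ₛ F) *ₛ bF⁻¹) ≈ₛ 1ₛ) where

      cancel : ∀ b → ((b ∘ₛ F) ∘ₛ h) ≈ₛ b
      cancel = ∘ₛ-cancel {⟪ f ⟫} {h} (root f) (root H) fH≈t {F} F₀≈0 HF≈t

      b≈a : b ≈ₛ a
      b≈a = inverse-unique (⟦ g ⟧ ∘ₛ h) {b} {a}
        (P₀.S.trans {(⟦ g ⟧ ∘ₛ h) *ₛ b} {(⟦ g ⟧ ∘ₛ η) *ₛ b} {1ₛ}
          (*ₛ-congʳ b {⟦ g ⟧ ∘ₛ h} {⟦ g ⟧ ∘ₛ η} (P₀.∘ₛ-cong {⟦ g ⟧} {⟦ g ⟧} {h} {η} (λ _ → K.refl) h≈η)) gηb≈1)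
        gHA≈1

      η′F-cancel : ((η ′ ∘ₛ F) ∘ₛ h) ≈ₛ h ′
      η′F-cancel = begin
        (η ′ ∘ₛ F) ∘ₛ h     ≈⟨ cancel (η ′) ⟩
        η ′                 ≈⟨ P₀.′-cong {h} {η} h≈η ⟨
        h ′                 ∎

      a′/a-cancel : ((((b ′ ∘ₛ F) *ₛ bF⁻¹) ∘ₛ h) *ₛ a) ≈ₛ a ′
      a′/a-cancel = begin
        (((b ′ ∘ₛ F) *ₛ bF⁻¹) ∘ₛ h) *ₛ a
          ≈⟨ *ₛ-cong {((b ′ ∘ₛ F) *ₛ bF⁻¹) ∘ₛ h} {((b ′ ∘ₛ F) ∘ₛ h) *ₛ (bF⁻¹ ∘ₛ h)} {a} {b} (∘ₛ-*ₛ {h} (root H) (b ′ ∘ₛ F) bF⁻¹) (P₀.S.sym {b} {a} b≈a) ⟩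
        (((b ′ ∘ₛ F) ∘ₛ h) *ₛ (bF⁻¹ ∘ₛ h)) *ₛ b
          ≈⟨ *ₛ-assoc ((b ′ ∘ₛ F) ∘ₛ h) (bF⁻¹ ∘ₛ h) b ⟩
        ((b ′ ∘ₛ F) ∘ₛ h) *ₛ ((bF⁻¹ ∘ₛ h) *ₛ b)
          ≈⟨ *ₛ-cong {(b ′ ∘ₛ F) ∘ₛ h} {b ′} {(bF⁻¹ ∘ₛ h) *ₛ b} {1ₛ} (cancel (b ′)) bF⁻¹h*b≈1 ⟩
        b ′ *ₛ 1ₛ
          ≈⟨ P₀.S.*-identityʳ (b ′) ⟩
        b ′
          ≈⟨ P₀.′-cong {b} {a} b≈a ⟩
        a ′ ∎
        where
        bF⁻¹h*b≈1 : ((bF⁻¹ ∘ₛ h) *ₛ b) ≈ₛ 1ₛ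
        bF⁻¹h*b≈1 = begin
          (bF⁻¹ ∘ₛ h) *ₛ b                   ≈⟨ *ₛ-comm (bF⁻¹ ∘ₛ h) b ⟩
          b *ₛ (bF⁻¹ ∘ₛ h)                   ≈⟨ *ₛ-congʳ (bF⁻¹ ∘ₛ h) {(b ∘ₛ F) ∘ₛ h} {b} (cancel b) ⟨
          ((b ∘ₛ F) ∘ₛ h) *ₛ (bF⁻¹ ∘ₛ h)     ≈⟨ ∘ₛ-reciprocal {h} (root H) (b ∘ₛ F) bF⁻¹ bFbF⁻¹≈1 ⟩
          1ₛ                                 ∎

      representation-⊕ : ∀ n → ((n !) ×ₚ generatingFunction A H (suc r′) n)
        ≈ₚ ((M ∘ (η ′ ∘ₛ F) [∂y] ⊕ ((b ′ ∘ₛ F) *ₛ bF⁻¹) [∂y]) ^ₒ n) 1ₚ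
      representation-⊕ n = represents-unique n ((T ^ₒ n) 1ₚ) (represents-^ₒ a₀≈1 T
        (step-⊕ (η ′ ∘ₛ F) η′F-cancel ((b ′ ∘ₛ F) *ₛ bF⁻¹) a′/a-cancel) n)
        where
        T : Operator
        T = M ∘ (η ′ ∘ₛ F) [∂y] ⊕ ((b ′ ∘ₛ F) *ₛ bF⁻¹) [∂y]

  module Instances
    (f H : DeltaSeries) (g : InvertibleSeries) (g₀≈1 : ⟦ g ⟧ 0 ≈ 1#) (fH≈t : (⟪ f ⟫ ∘ₛ ⟪ H ⟫) ≈ₛ t) (r′ n : ℕ) where
    open RawSemiringDefs Pol.rawSemiring using () renaming (_×_ to _×ₚ_)
    open Polynomials K char0 using (module K; module P₀)
    private
      M : Operator
      M = y · ⊕ 2 ⊗ (Dx⁻¹ ∘ ∂y) ⊕ suc r′ ⊗ (z · ∘ ∂y ^ₒ r′)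

    instance-⊖ : ((n !) ×ₚ generatingFunction ((g ∘ᵢ H) ⁻¹) H (suc r′) n)
      ≈ₚ (((M ⊖ (⟦ g ⟧ ′ *ₛ ⟦ g ⁻¹ ⟧) [∂y]) ∘ ⟦ derivative f ⁻¹ ⟧ [∂y]) ^ₒ n) 1ₚ
    instance-⊖ = Sheffer.representation-⊖ f H g ((g ∘ᵢ H) ⁻¹) g₀≈1 fH≈t
      (reciprocal-correct (⟦ g ⟧ ∘ₛ ⟪ H ⟫) (unit (g ∘ᵢ H)))
      r′ ⟦ g ⁻¹ ⟧ ⟦ derivative f ⁻¹ ⟧
      (reciprocal-correct ⟦ g ⟧ (unit g))
      (reciprocal-correct (⟪ f ⟫ ′) (slope f))
      n

    -- h, F and the apartness proofs are implicit, to be solved from the goal: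
    -- comparing nested reversions by unfolding them is infeasible.  For the same
    -- reason h and F are characterised by their coefficients at 0 and suc k,
    -- from which unification cannot solve them.
    instance-⊕ : ∀ {h F : K⟦t⟧} {h₁#0 : (⟪ H ⟫ ′) 0 # 0#} {gh₀#0 : (⟦ g ⟧ ∘ₛ h) 0 # 0#}
      (let a = reciprocalSeries (⟦ g ⟧ ∘ₛ h) gh₀#0) {aF₀#0 : (a ∘ₛ F) 0 # 0#} →
      h 0 ≈ 0# → (∀ k → ⟪ H ⟫ (suc k) ≈ h (suc k)) →
      F 0 ≈ 0# → (∀ k → reversionSeries ⟪ H ⟫ h₁#0 (suc k) ≈ F (suc k)) →
      ((n !) ×ₚ generatingFunction ((g ∘ᵢ H) ⁻¹) H (suc r′) n)
        ≈ₚ ((M ∘ (h ′ ∘ₛ F) [∂y] ⊕ ((a ′ ∘ₛ F) *ₛ reciprocalSeries (a ∘ₛ F) aF₀#0) [∂y]) ^ₒ n) 1ₚ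
    instance-⊕ {h} {F} {h₁#0} {gh₀#0} {aF₀#0} h₀≈0 H≈h F₀≈0 rev≈F =
      Sheffer.representation-⊕ f H g ((g ∘ᵢ H) ⁻¹) g₀≈1 fH≈t
        (reciprocal-correct (⟦ g ⟧ ∘ₛ ⟪ H ⟫) (unit (g ∘ᵢ H)))
        r′ h (reciprocalSeries (⟦ g ⟧ ∘ₛ h) gh₀#0) F
        (reciprocalSeries (reciprocalSeries (⟦ g ⟧ ∘ₛ h) gh₀#0 ∘ₛ F) aF₀#0)
        ⟪H⟫≈h
        (reciprocal-correct (⟦ g ⟧ ∘ₛ h) gh₀#0) F₀≈0 HF≈t
        (reciprocal-correct (reciprocalSeries (⟦ g ⟧ ∘ₛ h) gh₀#0 ∘ₛ F) aF₀#0)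
        n
      where
      ⟪H⟫≈h : ⟪ H ⟫ ≈ₛ h
      ⟪H⟫≈h zero    = K.trans (root H) (K.sym h₀≈0)
      ⟪H⟫≈h (suc k) = H≈h k

      rev : K⟦t⟧
      rev = reversionSeries ⟪ H ⟫ h₁#0

      F≈rev : F ≈ₛ rev
      F≈rev zero    = F₀≈0
      F≈rev (suc k) = K.sym (rev≈F k)

      HF≈t : (⟪ H ⟫ ∘ₛ F) ≈ₛ t
      HF≈t m = K.trans (P₀.∘ₛ-cong {⟪ H ⟫} {⟪ H ⟫} {F} {rev} (λ _ → K.refl) F≈rev m)
        (reversion-correct ⟪ H ⟫ (root H) h₁#0 m)

open import Data.Product.Base using (_×_)

corollary2p1 :
    ∀ {c ℓ₁ ℓ₂ : Level} (K : HeytingField c ℓ₁ ℓ₂) (char0 : CharacteristicZero K) →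
    let open OverField K char0
        ⟦_⟧ = InvertibleSeries.series
        ⟪_⟫ = DeltaSeries.series
    in
    (f : DeltaSeries) (g : InvertibleSeries) → ⟦ g ⟧ 0 ≈ 1# →
    (r : ℕ) → 1 ≤ r →
    let H = f ⟨-1⟩
        A = (g ∘ᵢ f ⟨-1⟩) ⁻¹
        M = y · ⊕ 2 ⊗ (Dx⁻¹ ∘ ∂y) ⊕ r ⊗ (z · ∘ ∂y ^ₒ (r ∸ 1))
    in
    ∀ n →
    LeGSheffer f g r n
      ≈ₚ (((M ⊖ (⟦ g ⟧ ′ *ₛ ⟦ g ⁻¹ ⟧) [∂y]) ∘ ⟦ derivative f ⁻¹ ⟧ [∂y]) ^ₒ n) 1ₚ
    ×
    LeGSheffer f g r n
      ≈ₚ ((M ∘ (⟪ H ⟫ ′ ∘ₛ ⟪ H ⟨-1⟩ ⟫) [∂y]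
             ⊕ ((⟦ A ⟧ ′ ∘ₛ ⟪ H ⟨-1⟩ ⟫) *ₛ ⟦ (A ∘ᵢ H ⟨-1⟩) ⁻¹ ⟧) [∂y]) ^ₒ n) 1ₚ
corollary2p1 K char0 f g g₀≈1 (suc r′) _ n =
  instance-⊖ , instance-⊕ ≈-refl (λ _ → ≈-refl) ≈-refl (λ _ → ≈-refl)
  where
  open OverField.DeltaSeries using (series; root; slope)
  open HeytingField K using () renaming (refl to ≈-refl)
  f∘H≈t = OverField.reversion-correct K char0 (series f) (root f) (slope f)
  open Representations.Instances K char0 f (OverField._⟨-1⟩ K char0 f) g g₀≈1 f∘H≈t r′ n
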